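{- Let $d \ge 3$ be a prime. Define polynomials $r_n, s_n \in \mathbb{Z}[b]$ by $r_0 = s_0 = 1$ and, for $n \ge 0$, \[ r_{n+1} = (b+1)\,d\, r_n s_n^{d-1}, \qquad s_{n+1} = r_n^d + (d-1) s_n^d. \] For $m \ge 1$ let \[ \mathcal{G}_m(b) = \frac{1}{bd}\left[(b+1)^d d^d s_{m-1}^{d(d-1)} - (bd+1)\,\frac{s_m^d - \bigl((b+1)d\, s_{m-1}^d\bigr)^d}{s_m - (b+1)d\, s_{m-1}^d}\right] \in \mathbb{Z}[b], \] and let $G_m(a) \in \mathbb{Q}[a]$ be the polynomial determined by $G_m((b+1)d) = \mathcal{G}_m(b)$, i.e. $G_m(a) = \mathcal{G}_m(a/d - 1)$. Then for every $m \ge 1$ there exists an irreducible factor $F_m$ of $G_m$ over $\mathbb{Q}$ such that \[ \liminf_{m \to \infty} \frac{\deg F_m}{\deg G_m} \ge 1 - \frac{1}{d^d}. \] Moreover, if $1 \le m \le d$, then $G_m$ is irreducible over $\mathbb{Q}$.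
   Context: The polynomial $G_m$ is the Misiurewicz polynomial for the dynamical portrait $(m,1)$ associated to the one-parameter family of degree-$d$ rational maps $\phi_a(z) = \frac{az}{z^d + d - 1}$ ($a \ne 0$); after the change of variable $a = (b+1)d$, the map in homogeneous coordinates is $\varphi_b([x,y]) = [(b+1)d\,x y^{d-1},\, x^d + (d-1)y^d]$, and $\varphi_b^n([1,1]) = [r_n, s_n]$. The expression defining $\mathcal{G}_m$ is a polynomial in $b$ with integer coefficients. -}

module Defs where

open import Data.Nat as ℕ using (ℕ; zero; suc; _∸_; _≤_)
open import Data.Integer using (+_)
open import Data.Rational as ℚ using (ℚ; 0ℚ; 1ℚ; _≟_)
open import Data.List using (List; []; _∷_; length; reverse; dropWhile)
open import Data.Product using (Σ; _×_; _,_; proj₁; proj₂)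
open import Data.Sum using (_⊎_)
open import Relation.Binary.PropositionalEquality using (_≡_)
open import Relation.Nullary using (¬_)

-- Univariate polynomials over ℚ as coefficient lists (constant term first)

Poly : Set
Poly = List ℚ

coeff : Poly → ℕ → ℚ
coeff []       _       = 0ℚ
coeff (c ∷ p)  zero    = c
coeff (c ∷ p)  (suc i) = coeff p i

infix 4 _≈ₚ_
_≈ₚ_ : Poly → Poly → Set
p ≈ₚ q = ∀ i → coeff p i ≡ coeff q i

strip : Poly → Poly
strip p = reverse (dropWhile (_≟ 0ℚ) (reverse p))

-- degree (the zero polynomial gets degree 0)
deg : Poly → ℕ
deg p = length (strip p) ∸ 1

0ₚ : Poly
0ₚ = []

const : ℚ → Poly
const c = c ∷ []

Xₚ : Poly
Xₚ = 0ℚ ∷ 1ℚ ∷ []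

infixl 6 _+ₚ_ _-ₚ_
infixl 7 _*ₚ_ _·ₚ_
infixr 8 _^ₚ_

_+ₚ_ : Poly → Poly → Poly
[]      +ₚ q       = q
(a ∷ p) +ₚ []      = a ∷ p
(a ∷ p) +ₚ (b ∷ q) = (a ℚ.+ b) ∷ (p +ₚ q)

_·ₚ_ : ℚ → Poly → Poly
c ·ₚ []      = []
c ·ₚ (a ∷ p) = (c ℚ.* a) ∷ (c ·ₚ p)

_-ₚ_ : Poly → Poly → Poly
p -ₚ q = p +ₚ (ℚ.- 1ℚ) ·ₚ q

_*ₚ_ : Poly → Poly → Poly
[]      *ₚ q = []
(a ∷ p) *ₚ q = a ·ₚ q +ₚ (0ℚ ∷ (p *ₚ q))

_^ₚ_ : Poly → ℕ → Poly
p ^ₚ zero    = const 1ℚ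
p ^ₚ suc n   = p *ₚ (p ^ₚ n)

compose : Poly → Poly → Poly
compose []      q = []
compose (c ∷ p) q = const c +ₚ q *ₚ compose p q

-- exact division by the variable b (drop the constant term)
divX : Poly → Poly
divX []      = []
divX (_ ∷ p) = p

_∣ₚ_ : Poly → Poly → Set
f ∣ₚ g = Σ Poly λ h → f *ₚ h ≈ₚ g

IsUnitₚ : Poly → Set
IsUnitₚ f = (deg f ≡ 0) × ¬ (f ≈ₚ 0ₚ)

IrreducibleQ : Poly → Set
IrreducibleQ p = ¬ (p ≈ₚ 0ₚ) × ¬ IsUnitₚ p
  × (∀ f g → f *ₚ g ≈ₚ p → IsUnitₚ f ⊎ IsUnitₚ g)

ℕ→ℚ : ℕ → ℚ
ℕ→ℚ n = (+ n) ℚ./ 1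

-- 1/n for n ≥ 1 (junk value 0 at n = 0, never used for n = 0)
oneOver : ℕ → ℚ
oneOver zero    = 0ℚ
oneOver (suc n) = (+ 1) ℚ./ suc n

A : ℕ → Poly
A d = ℕ→ℚ d ·ₚ (Xₚ +ₚ const 1ℚ)

rs : ℕ → ℕ → Poly × Poly
rs d zero    = const 1ℚ , const 1ℚ
rs d (suc n) =
  let r = proj₁ (rs d n) ; s = proj₂ (rs d n) in
  A d *ₚ r *ₚ s ^ₚ (d ∸ 1) ,
  r ^ₚ d +ₚ ℕ→ℚ (d ∸ 1) ·ₚ s ^ₚ d

r : ℕ → ℕ → Poly
r d n = proj₁ (rs d n)

s : ℕ → ℕ → Poly
s d n = proj₂ (rs d n)

-- Σ_{i<k} u^i v^(k-1-i), i.e. the polynomial (u^k - v^k)/(u - v)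
geomQuot : ℕ → Poly → Poly → Poly
geomQuot zero    u v = 0ₚ
geomQuot (suc k) u v = u ^ₚ k +ₚ v *ₚ geomQuot k u v

-- 𝒢_m(b) for m ≥ 1 (m = suc k); value at m = 0 is unused
calG : ℕ → ℕ → Poly
calG d zero    = 0ₚ
calG d (suc k) =
  let Y = A d *ₚ s d k ^ₚ d
      bracket = A d ^ₚ d *ₚ s d k ^ₚ (d ℕ.* (d ∸ 1))
                -ₚ (ℕ→ℚ d ·ₚ Xₚ +ₚ const 1ℚ) *ₚ geomQuot d (s d (suc k)) Y
  in oneOver d ·ₚ divX bracket

G : ℕ → ℕ → Poly
G d m = compose (calG d m) (oneOver d ·ₚ Xₚ -ₚ const 1ℚ)

{-# OPTIONS --safe #-}
module Submission where

-- Write p = d. With a = (b+1)d, w = bd+1, Yₙ = a sₙᵈ and Zₙ = rₙᵈ - w sₙᵈ one has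
-- sₙ₊₁ = Yₙ + Zₙ, and the bracket defining 𝒢ₙ₊₁ is Bₙ = Zₙ₊₁ / Zₙ.  Expanding
-- (Yₙ + Zₙ)ᵖ, the Newton polygons of Yₙ, Zₙ, Bₙ at p can be followed by induction on n:
-- up to a power of p, 𝒢ₙ₊₁ has a segment from (0, L) to (N, 0), where L = pⁿ and
-- N = (p-1)pⁿ - 1 are coprime.  As in Dumas' criterion, of any two factors of 𝒢ₙ₊₁ one
-- again has such a segment, hence degree at least N; following it down a factorisation
-- over ℚ (which Kronecker's method makes effective) gives the irreducible factor.
-- On the other hand deg sₙ ≤ pᵖ⁺ⁿ⁻¹/(pᵖ - 1), which bounds deg 𝒢ₙ₊₁ and hence the ratio.
-- For n+1 ≤ p the degree of 𝒢ₙ₊₁ is exactly N, with the exception of n = 1, where it is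
-- N+1 and a linear factor has to be excluded: its root would be k/p with k an integer.

-- The nonzero fixed points x of the map satisfy xᵈ = w, so Zₙ = 0 is the condition that the n-th
-- image of [1,1] is fixed, and Bₙ collects the parameters for which this happens one step later.
-- Passing from the bracket to Zₙ₊₁ / Zₙ replaces a closed formula by a recursion in Y and Z. Two
-- weights are followed along it. The plain valuation finds the power of d to be removed and the one
-- index at which it is attained. The weight N v + L i, with N and L taken from the last index n, is
-- used for all earlier indices too: lower bounds for a weight pass to sums and products, while
-- whole polygons would have to be recomputed at each step. Exact valuations are needed at the two
-- ends of the segment only. Beyond index N only integrality is known in general, so only a factor
-- of degree at least N results, and 1/dᵈ measures the gap between N and the degree bound.
-- Constructively an irreducible factor has to be found, not merely asserted; hence reducibility is
-- decided by a finite search, after Gauss's lemma has made the factors integral.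

open import Defs
open import Data.Nat as ℕ using (ℕ; zero; suc; _*_; _+_; _∸_; _^_; _≤_; _<_; z≤n; s≤s)
open import Data.Nat.Primality using (Prime; euclidsLemma; prime⇒nonZero; prime⇒nonTrivial)
open import Data.Product using (Σ; _×_; _,_; proj₁; proj₂)
open import Data.Nat.Properties as ℕP
  using (≤-trans; ≤-reflexive; m≤m+n; *-monoʳ-≤; +-suc; +-monoˡ-≤; +-monoʳ-≤; ≤-refl; n≤1+n;
    +-mono-≤; ≤-pred; <⇒≤; <⇒≱; m≤n+m; <-irrefl; *-mono-≤; m≤n+m∸n; suc-injective;
    *-identityʳ; *-zeroʳ; *-identityˡ; ^-distribˡ-+-*; n≤0⇒n≡0; ≮⇒≥;
    +-cancelˡ-≡; +-cancelʳ-≤; +-cancelˡ-≤; *-monoʳ-<; m≤n+o⇒m∸n≤o; ≤-total; <-cmp)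
import Data.Nat.Divisibility as ℕD
import Data.Nat.Solver as ℕSolver
open import Data.Nat.Combinatorics using (_C_; nCk+nC[k+1]≡[n+1]C[k+1]; k>n⇒nCk≡0; nC1≡n; nCn≡1)
open import Data.Nat.Coprimality using (Coprime; coprime-divisor)
open import Data.Nat.ListAction using (product)
open import Data.Nat.Primality.Factorisation using (PrimeFactorisation; factorise)
open import Data.Integer as ℤ using (ℤ; +_)
import Data.Integer.Properties as ℤP
import Data.Integer.Solver as ℤSolver
open import Data.Integer.Divisibility.Signed as ℤD using (_∣_; divides; _∣?_)
open import Data.Rational as ℚ using (ℚ; 0ℚ; 1ℚ)
import Data.Rational.Properties as ℚP
import Data.Rational.Solver as ℚSolver
import Data.Rational.Unnormalised as ℚᵘ
import Data.Rational.Unnormalised.Properties as ℚᵘP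
open import Data.Empty using (⊥; ⊥-elim)
open import Data.List as List using (List; []; _∷_; length; reverse; dropWhile; takeWhile; _++_; _∷ʳ_)
import Data.List.Properties as ListP
open import Data.List.Relation.Unary.All using (All; []; _∷_)
import Data.List.Relation.Unary.All.Properties as AllP
import Data.List.Relation.Binary.Permutation.Propositional as Perm
import Data.List.Relation.Binary.Permutation.Propositional.Properties as PermP
open import Data.Maybe using (Maybe; just; nothing)
open import Data.Sum as Sum using (_⊎_; inj₁; inj₂)
open import Algebra.Bundles using (CommutativeRing)
import Algebra.Solver.Ring
import Algebra.Solver.Ring.AlmostCommutativeRing as ACR
open import Relation.Binary.Definitions using (tri<; tri≈; tri>)
open import Relation.Binary.PropositionalEquality
import Relation.Binary.Reasoning.Setoid
open import Relation.Nullary using (¬_; Dec; yes; no)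
open import Relation.Nullary.Decidable using (map′; _×-dec_; _⊎-dec_; ¬?)

-- Opaque because unfolding the reduction to lowest terms in z / 1 makes type checking very slow.
opaque
  ι : ℤ → ℚ
  ι z = z ℚ./ 1

  toᵘ-ι : ∀ z → ℚ.toℚᵘ (ι z) ℚᵘ.≃ ℚᵘ.mkℚᵘ z 0
  toᵘ-ι z = ℚP.toℚᵘ-fromℚᵘ (ℚᵘ.mkℚᵘ z 0)

  ι-+ : ∀ a b → ι (a ℤ.+ b) ≡ ι a ℚ.+ ι b
  ι-+ a b = ℚP.toℚᵘ-injective (begin
    ℚ.toℚᵘ (ι (a ℤ.+ b)) ≈⟨ toᵘ-ι (a ℤ.+ b) ⟩
    ℚᵘ.mkℚᵘ (a ℤ.+ b) 0 ≈⟨ ℚᵘ.*≡* (solve 2 (λ x y → (x :+ y) :* con ℤ.1ℤ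
                                              := (x :* con ℤ.1ℤ :+ y :* con ℤ.1ℤ) :* con ℤ.1ℤ) refl a b) ⟩
    ℚᵘ.mkℚᵘ a 0 ℚᵘ.+ ℚᵘ.mkℚᵘ b 0 ≈⟨ ℚᵘP.+-cong (toᵘ-ι a) (toᵘ-ι b) ⟨
    ℚ.toℚᵘ (ι a) ℚᵘ.+ ℚ.toℚᵘ (ι b) ≈⟨ ℚP.toℚᵘ-homo-+ (ι a) (ι b) ⟨
    ℚ.toℚᵘ (ι a ℚ.+ ι b) ∎)
    where
    open ℚᵘP.≃-Reasoning
    open ℤSolver.+-*-Solver

  ι-* : ∀ a b → ι (a ℤ.* b) ≡ ι a ℚ.* ι b
  ι-* a b = ℚP.toℚᵘ-injective (begin
    ℚ.toℚᵘ (ι (a ℤ.* b)) ≈⟨ toᵘ-ι (a ℤ.* b) ⟩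
    ℚᵘ.mkℚᵘ a 0 ℚᵘ.* ℚᵘ.mkℚᵘ b 0 ≈⟨ ℚᵘP.*-cong (toᵘ-ι a) (toᵘ-ι b) ⟨
    ℚ.toℚᵘ (ι a) ℚᵘ.* ℚ.toℚᵘ (ι b) ≈⟨ ℚP.toℚᵘ-homo-* (ι a) (ι b) ⟨
    ℚ.toℚᵘ (ι a ℚ.* ι b) ∎)
    where open ℚᵘP.≃-Reasoning

  ι-neg : ∀ a → ι (ℤ.- a) ≡ ℚ.- ι a
  ι-neg a = begin
    ι (ℤ.- a) ≡⟨ ℚP.+-identityʳ _ ⟨
    ι (ℤ.- a) ℚ.+ 0ℚ ≡⟨ cong (ι (ℤ.- a) ℚ.+_) (ℚP.+-inverseʳ (ι a)) ⟨
    ι (ℤ.- a) ℚ.+ (ι a ℚ.+ ℚ.- ι a) ≡⟨ ℚP.+-assoc (ι (ℤ.- a)) (ι a) _ ⟨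
    (ι (ℤ.- a) ℚ.+ ι a) ℚ.+ ℚ.- ι a ≡⟨ cong (ℚ._+ ℚ.- ι a) (ι-+ (ℤ.- a) a) ⟨
    ι (ℤ.- a ℤ.+ a) ℚ.+ ℚ.- ι a ≡⟨ cong (λ x → ι x ℚ.+ ℚ.- ι a) (ℤP.+-inverseˡ a) ⟩
    0ℚ ℚ.+ ℚ.- ι a ≡⟨ ℚP.+-identityˡ _ ⟩
    ℚ.- ι a ∎
    where open ≡-Reasoning

  ι-injective : ∀ {a b} → ι a ≡ ι b → a ≡ b
  ι-injective {a} {b} eq with ℚᵘP.≃-trans (ℚᵘP.≃-sym (toᵘ-ι a))
                            (ℚᵘP.≃-trans (ℚP.toℚᵘ-cong eq) (toᵘ-ι b))
  ... | ℚᵘ.*≡* p = trans (sym (ℤP.*-identityʳ a)) (trans p (ℤP.*-identityʳ b))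

  ι≡/1 : ∀ z → ι z ≡ z ℚ./ 1
  ι≡/1 z = refl

  ι-0 : ι ℤ.0ℤ ≡ 0ℚ
  ι-0 = refl

  ι-1 : ι ℤ.1ℤ ≡ 1ℚ
  ι-1 = refl

ι≡0⇒≡0 : ∀ {a} → ι a ≡ 0ℚ → a ≡ ℤ.0ℤ
ι≡0⇒≡0 eq = ι-injective (trans eq (sym ι-0))

-- The commutative ring of polynomials

infix 4 _≋_
-- _≈ₚ_ as a record: the two polynomials can then be inferred from a proof.
record _≋_ (p q : Poly) : Set where
  constructor mk≋
  field at : p ≈ₚ q
open _≋_ public

≋-refl : ∀ {p} → p ≋ p
≋-refl = mk≋ λ i → refl

≋-sym : ∀ {p q} → p ≋ q → q ≋ p
≋-sym e = mk≋ λ i → sym (at e i)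

≋-trans : ∀ {p q r} → p ≋ q → q ≋ r → p ≋ r
≋-trans e e′ = mk≋ λ i → trans (at e i) (at e′ i)

≡⇒≋ : ∀ {p q} → p ≡ q → p ≋ q
≡⇒≋ refl = ≋-refl

coeff-+ : ∀ p q i → coeff (p +ₚ q) i ≡ coeff p i ℚ.+ coeff q i
coeff-+ []      q       i       = sym (ℚP.+-identityˡ _)
coeff-+ (a ∷ p) []      i       = sym (ℚP.+-identityʳ _)
coeff-+ (a ∷ p) (b ∷ q) zero    = refl
coeff-+ (a ∷ p) (b ∷ q) (suc i) = coeff-+ p q i

coeff-· : ∀ c p i → coeff (c ·ₚ p) i ≡ c ℚ.* coeff p i
coeff-· c []      i       = sym (ℚP.*-zeroʳ c)
coeff-· c (a ∷ p) zero    = refl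
coeff-· c (a ∷ p) (suc i) = coeff-· c p i

∷-cong : ∀ {a b p q} → a ≡ b → p ≋ q → a ∷ p ≋ b ∷ q
∷-cong refl e = mk≋ λ { zero → refl ; (suc i) → at e i }

0∷[]≋0 : 0ℚ ∷ [] ≋ []
0∷[]≋0 = mk≋ λ { zero → refl ; (suc i) → refl }

+-cong : ∀ {p p′ q q′} → p ≋ p′ → q ≋ q′ → p +ₚ q ≋ p′ +ₚ q′
+-cong {p} {p′} {q} {q′} e e′ = mk≋ λ i → begin
  coeff (p +ₚ q) i ≡⟨ coeff-+ p q i ⟩
  coeff p i ℚ.+ coeff q i ≡⟨ cong₂ ℚ._+_ (at e i) (at e′ i) ⟩
  coeff p′ i ℚ.+ coeff q′ i ≡⟨ coeff-+ p′ q′ i ⟨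
  coeff (p′ +ₚ q′) i ∎
  where open ≡-Reasoning

·-cong : ∀ c {p q} → p ≋ q → c ·ₚ p ≋ c ·ₚ q
·-cong c {p} {q} e = mk≋ λ i →
  trans (coeff-· c p i) (trans (cong (c ℚ.*_) (at e i)) (sym (coeff-· c q i)))

+-assoc : ∀ p q r → (p +ₚ q) +ₚ r ≋ p +ₚ (q +ₚ r)
+-assoc p q r = mk≋ λ i → begin
  coeff (p +ₚ q +ₚ r) i ≡⟨ coeff-+ (p +ₚ q) r i ⟩
  coeff (p +ₚ q) i ℚ.+ coeff r i ≡⟨ cong (ℚ._+ coeff r i) (coeff-+ p q i) ⟩
  coeff p i ℚ.+ coeff q i ℚ.+ coeff r i ≡⟨ ℚP.+-assoc (coeff p i) (coeff q i) (coeff r i) ⟩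
  coeff p i ℚ.+ (coeff q i ℚ.+ coeff r i) ≡⟨ cong (coeff p i ℚ.+_) (coeff-+ q r i) ⟨
  coeff p i ℚ.+ coeff (q +ₚ r) i ≡⟨ coeff-+ p (q +ₚ r) i ⟨
  coeff (p +ₚ (q +ₚ r)) i ∎
  where open ≡-Reasoning

+-comm : ∀ p q → p +ₚ q ≋ q +ₚ p
+-comm p q = mk≋ λ i →
  trans (coeff-+ p q i) (trans (ℚP.+-comm (coeff p i) (coeff q i)) (sym (coeff-+ q p i)))

+-identityʳ : ∀ p → p +ₚ [] ≋ p
+-identityʳ []      = ≋-refl
+-identityʳ (a ∷ p) = ≋-refl

·-+-distrib : ∀ c p q → c ·ₚ (p +ₚ q) ≋ c ·ₚ p +ₚ c ·ₚ q
·-+-distrib c p q = mk≋ λ i → begin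
  coeff (c ·ₚ (p +ₚ q)) i ≡⟨ coeff-· c (p +ₚ q) i ⟩
  c ℚ.* coeff (p +ₚ q) i ≡⟨ cong (c ℚ.*_) (coeff-+ p q i) ⟩
  c ℚ.* (coeff p i ℚ.+ coeff q i) ≡⟨ ℚP.*-distribˡ-+ c (coeff p i) (coeff q i) ⟩
  c ℚ.* coeff p i ℚ.+ c ℚ.* coeff q i ≡⟨ cong₂ ℚ._+_ (coeff-· c p i) (coeff-· c q i) ⟨
  coeff (c ·ₚ p) i ℚ.+ coeff (c ·ₚ q) i ≡⟨ coeff-+ (c ·ₚ p) (c ·ₚ q) i ⟨
  coeff (c ·ₚ p +ₚ c ·ₚ q) i ∎
  where open ≡-Reasoning

+-·-distrib : ∀ c c′ p → (c ℚ.+ c′) ·ₚ p ≋ c ·ₚ p +ₚ c′ ·ₚ p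
+-·-distrib c c′ p = mk≋ λ i → begin
  coeff ((c ℚ.+ c′) ·ₚ p) i ≡⟨ coeff-· (c ℚ.+ c′) p i ⟩
  (c ℚ.+ c′) ℚ.* coeff p i ≡⟨ ℚP.*-distribʳ-+ (coeff p i) c c′ ⟩
  c ℚ.* coeff p i ℚ.+ c′ ℚ.* coeff p i ≡⟨ cong₂ ℚ._+_ (coeff-· c p i) (coeff-· c′ p i) ⟨
  coeff (c ·ₚ p) i ℚ.+ coeff (c′ ·ₚ p) i ≡⟨ coeff-+ (c ·ₚ p) (c′ ·ₚ p) i ⟨
  coeff (c ·ₚ p +ₚ c′ ·ₚ p) i ∎
  where open ≡-Reasoning

·-·-assoc : ∀ c c′ p → c ·ₚ (c′ ·ₚ p) ≋ (c ℚ.* c′) ·ₚ p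
·-·-assoc c c′ p = mk≋ λ i → begin
  coeff (c ·ₚ (c′ ·ₚ p)) i ≡⟨ coeff-· c (c′ ·ₚ p) i ⟩
  c ℚ.* coeff (c′ ·ₚ p) i ≡⟨ cong (c ℚ.*_) (coeff-· c′ p i) ⟩
  c ℚ.* (c′ ℚ.* coeff p i) ≡⟨ ℚP.*-assoc c c′ (coeff p i) ⟨
  c ℚ.* c′ ℚ.* coeff p i ≡⟨ coeff-· (c ℚ.* c′) p i ⟨
  coeff ((c ℚ.* c′) ·ₚ p) i ∎
  where open ≡-Reasoning

1·-identity : ∀ p → 1ℚ ·ₚ p ≋ p
1·-identity p = mk≋ λ i → trans (coeff-· 1ℚ p i) (ℚP.*-identityˡ (coeff p i))

0·-zero : ∀ p → 0ℚ ·ₚ p ≋ []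
0·-zero p = mk≋ λ i → trans (coeff-· 0ℚ p i) (ℚP.*-zeroˡ (coeff p i))

·-∷ : ∀ c p → c ·ₚ (0ℚ ∷ p) ≋ 0ℚ ∷ c ·ₚ p
·-∷ c p = ∷-cong (ℚP.*-zeroʳ c) ≋-refl

∷-+-∷ : ∀ p q → 0ℚ ∷ (p +ₚ q) ≋ (0ℚ ∷ p) +ₚ (0ℚ ∷ q)
∷-+-∷ p q = ∷-cong refl ≋-refl

+-interchange : ∀ p q r t → (p +ₚ q) +ₚ (r +ₚ t) ≋ (p +ₚ r) +ₚ (q +ₚ t)
+-interchange p q r t = mk≋ λ i → begin
  coeff ((p +ₚ q) +ₚ (r +ₚ t)) i ≡⟨ expand p q r t i ⟩
  (coeff p i ℚ.+ coeff q i) ℚ.+ (coeff r i ℚ.+ coeff t i)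
    ≡⟨ solve 4 (λ a b c d → (a :+ b) :+ (c :+ d) := (a :+ c) :+ (b :+ d))
         refl (coeff p i) (coeff q i) (coeff r i) (coeff t i) ⟩
  (coeff p i ℚ.+ coeff r i) ℚ.+ (coeff q i ℚ.+ coeff t i) ≡⟨ expand p r q t i ⟨
  coeff ((p +ₚ r) +ₚ (q +ₚ t)) i ∎
  where
  open ≡-Reasoning
  open ℚSolver.+-*-Solver
  expand : ∀ p q r t i → coeff ((p +ₚ q) +ₚ (r +ₚ t)) i
         ≡ (coeff p i ℚ.+ coeff q i) ℚ.+ (coeff r i ℚ.+ coeff t i)
  expand p q r t i = trans (coeff-+ (p +ₚ q) (r +ₚ t) i) (cong₂ ℚ._+_ (coeff-+ p q i) (coeff-+ r t i))

*-congʳ : ∀ p {q q′} → q ≋ q′ → p *ₚ q ≋ p *ₚ q′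
*-congʳ []      e = ≋-refl
*-congʳ (a ∷ p) e = +-cong (·-cong a e) (∷-cong refl (*-congʳ p e))

*-zeroʳ′ : ∀ p → p *ₚ [] ≋ []
*-zeroʳ′ []      = ≋-refl
*-zeroʳ′ (a ∷ p) = ≋-trans (∷-cong refl (*-zeroʳ′ p)) 0∷[]≋0

-- Multiplication recurses on its left argument only. Unfolding the right one as well makes
-- commutativity an induction, and lets Gauss's lemma peel coefficients off the right factor.
*-∷ : ∀ p b q → p *ₚ (b ∷ q) ≋ b ·ₚ p +ₚ (0ℚ ∷ p *ₚ q)
*-∷ []      b q = ≋-sym 0∷[]≋0
*-∷ (a ∷ p) b q = ∷-cong (cong (ℚ._+ 0ℚ) (ℚP.*-comm a b))
  (≋-trans (+-cong (≋-refl {a ·ₚ q}) (*-∷ p b q))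
  (≋-trans (≋-sym (+-assoc (a ·ₚ q) (b ·ₚ p) _))
  (≋-trans (+-cong (+-comm (a ·ₚ q) (b ·ₚ p)) ≋-refl)
           (+-assoc (b ·ₚ p) (a ·ₚ q) _))))

*-comm : ∀ p q → p *ₚ q ≋ q *ₚ p
*-comm []      q = ≋-sym (*-zeroʳ′ q)
*-comm (a ∷ p) q = ≋-trans (+-cong ≋-refl (∷-cong refl (*-comm p q))) (≋-sym (*-∷ q a p))

*-cong : ∀ {p p′ q q′} → p ≋ p′ → q ≋ q′ → p *ₚ q ≋ p′ *ₚ q′
*-cong {p} {p′} {q} {q′} e e′ =
  ≋-trans (*-congʳ p e′) (≋-trans (*-comm p q′) (≋-trans (*-congʳ q′ e) (*-comm q′ p′)))

*-congˡ : ∀ {p p′} q → p ≋ p′ → p *ₚ q ≋ p′ *ₚ q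
*-congˡ {p} {p′} q e = *-cong {p} {p′} e (≋-refl {q})

+-congʳ : ∀ p {q q′} → q ≋ q′ → p +ₚ q ≋ p +ₚ q′
+-congʳ p e = +-cong (≋-refl {p}) e

+-congˡ : ∀ {p p′} q → p ≋ p′ → p +ₚ q ≋ p′ +ₚ q
+-congˡ {p} {p′} q e = +-cong {p} {p′} e (≋-refl {q})

*-distribʳ : ∀ r p q → (p +ₚ q) *ₚ r ≋ p *ₚ r +ₚ q *ₚ r
*-distribʳ r []      q       = ≋-refl
*-distribʳ r (a ∷ p) []      = ≋-sym (+-identityʳ _)
*-distribʳ r (a ∷ p) (b ∷ q) =
  ≋-trans (+-cong (+-·-distrib a b r) (≋-trans (∷-cong refl (*-distribʳ r p q)) (∷-+-∷ (p *ₚ r) (q *ₚ r))))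
          (+-interchange (a ·ₚ r) (b ·ₚ r) _ _)

·-*-assoc : ∀ c p q → (c ·ₚ p) *ₚ q ≋ c ·ₚ (p *ₚ q)
·-*-assoc c []      q = ≋-refl
·-*-assoc c (a ∷ p) q = ≋-sym (≋-trans (·-+-distrib c (a ·ₚ q) _)
  (+-cong (·-·-assoc c a q) (≋-trans (·-∷ c (p *ₚ q)) (∷-cong refl (≋-sym (·-*-assoc c p q))))))

∷-* : ∀ p q → (0ℚ ∷ p) *ₚ q ≋ 0ℚ ∷ p *ₚ q
∷-* p q = +-cong {q = 0ℚ ∷ p *ₚ q} (0·-zero q) ≋-refl

*-assoc : ∀ p q r → (p *ₚ q) *ₚ r ≋ p *ₚ (q *ₚ r)
*-assoc []      q r = ≋-refl
*-assoc (a ∷ p) q r = ≋-trans (*-distribʳ r (a ·ₚ q) (0ℚ ∷ p *ₚ q))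
  (+-cong (·-*-assoc a q r) (≋-trans (∷-* (p *ₚ q) r) (∷-cong refl (*-assoc p q r))))

const-* : ∀ c q → const c *ₚ q ≋ c ·ₚ q
const-* c q = ≋-trans (+-cong (≋-refl {c ·ₚ q}) 0∷[]≋0) (+-identityʳ _)

negₚ : Poly → Poly
negₚ p = (ℚ.- 1ℚ) ·ₚ p

neg-cong : ∀ {p q} → p ≋ q → negₚ p ≋ negₚ q
neg-cong = ·-cong (ℚ.- 1ℚ)

neg-inverseˡ : ∀ p → negₚ p +ₚ p ≋ []
neg-inverseˡ p = mk≋ λ i → begin
  coeff (negₚ p +ₚ p) i ≡⟨ coeff-+ (negₚ p) p i ⟩
  coeff (negₚ p) i ℚ.+ coeff p i ≡⟨ cong (ℚ._+ coeff p i) (coeff-· (ℚ.- 1ℚ) p i) ⟩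
  (ℚ.- 1ℚ) ℚ.* coeff p i ℚ.+ coeff p i
    ≡⟨ solve 1 (λ x → con (ℚ.- 1ℚ) :* x :+ x := con 0ℚ) refl (coeff p i) ⟩
  0ℚ ∎
  where
  open ≡-Reasoning
  open ℚSolver.+-*-Solver

polyRing : CommutativeRing _ _
polyRing = record
  { Carrier = Poly ; _≈_ = _≋_ ; _+_ = _+ₚ_ ; _*_ = _*ₚ_ ; -_ = negₚ ; 0# = 0ₚ ; 1# = const 1ℚ
  ; isCommutativeRing = record
    { isRing = record
      { +-isAbelianGroup = record
        { isGroup = record
          { isMonoid = record
            { isSemigroup = record
              { isMagma = record
                { isEquivalence = record { refl = ≋-refl ; sym = ≋-sym ; trans = ≋-trans }
                ; ∙-cong = +-cong }
              ; assoc = +-assoc }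
            ; identity = (λ p → ≋-refl) , +-identityʳ }
          ; inverse = neg-inverseˡ , λ p → ≋-trans (+-comm p (negₚ p)) (neg-inverseˡ p)
          ; ⁻¹-cong = neg-cong }
        ; comm = +-comm }
      ; *-cong = *-cong
      ; *-assoc = *-assoc
      ; *-identity = *-identityˡ′ , λ p → ≋-trans (*-comm p _) (*-identityˡ′ p)
      ; distrib = (λ p q r → ≋-trans (*-comm p (q +ₚ r)) (≋-trans (*-distribʳ p q r) (+-cong (*-comm q p) (*-comm r p))))
                , *-distribʳ }
    ; *-comm = *-comm } }
  where
  *-identityˡ′ : ∀ p → const 1ℚ *ₚ p ≋ p
  *-identityˡ′ p = ≋-trans (const-* 1ℚ p) (1·-identity p)

private
  ℚ-raw = CommutativeRing.rawRing ℚP.+-*-commutativeRing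

  -- Rational constants become the coefficients of the ring solver, so that constant polynomials
  -- such as 1 and -1 are normalised along with the variables.
  const-morphism : ℚ-raw ACR.-Raw-AlmostCommutative⟶ ACR.fromCommutativeRing polyRing
  const-morphism = record
    { ⟦_⟧ = const
    ; +-homo = λ _ _ → ≋-refl
    ; *-homo = λ a b → ≋-sym (const-* a (const b))
    ; -‿homo = λ a → ∷-cong (trans (cong ℚ.-_ (sym (ℚP.*-identityˡ a))) (ℚP.neg-distribˡ-* 1ℚ a)) ≋-refl
    ; 0-homo = 0∷[]≋0
    ; 1-homo = ≋-refl }

  const-≟ : ∀ a b → Maybe (const a ≋ const b)
  const-≟ a b with a ℚP.≟ b
  ... | yes refl = just ≋-refl
  ... | no _     = nothing

module PolySolver = Algebra.Solver.Ring ℚ-raw (ACR.fromCommutativeRing polyRing) const-morphism const-≟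

module ≋-Reasoning = Relation.Binary.Reasoning.Setoid (CommutativeRing.setoid polyRing)

const-cong : ∀ {a b} → a ≡ b → const a ≋ const b
const-cong refl = ≋-refl

const-*-const : ∀ a b → const a *ₚ const b ≋ const (a ℚ.* b)
const-*-const a b = const-* a (const b)

^-cong : ∀ n {p q} → p ≋ q → p ^ₚ n ≋ q ^ₚ n
^-cong zero    e = ≋-refl
^-cong (suc n) e = *-cong e (^-cong n e)

^-distrib-+ : ∀ p m n → p ^ₚ (m + n) ≋ p ^ₚ m *ₚ p ^ₚ n
^-distrib-+ p zero    n = ≋-sym (CommutativeRing.*-identityˡ polyRing (p ^ₚ n))
^-distrib-+ p (suc m) n = ≋-trans (*-congʳ p (^-distrib-+ p m n)) (≋-sym (*-assoc p (p ^ₚ m) (p ^ₚ n)))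

^-*-assoc : ∀ p m n → (p ^ₚ m) ^ₚ n ≋ p ^ₚ (m * n)
^-*-assoc p m zero    = ≡⇒≋ (cong (p ^ₚ_) (sym (*-zeroʳ m)))
^-*-assoc p m (suc n) = begin
  p ^ₚ m *ₚ (p ^ₚ m) ^ₚ n ≈⟨ *-congʳ (p ^ₚ m) (^-*-assoc p m n) ⟩
  p ^ₚ m *ₚ p ^ₚ (m * n) ≈⟨ ^-distrib-+ p m (m * n) ⟨
  p ^ₚ (m + m * n) ≡⟨ cong (p ^ₚ_) (ℕP.*-suc m n) ⟨
  p ^ₚ (m * suc n) ∎
  where open ≋-Reasoning

*-^-distrib : ∀ p q n → (p *ₚ q) ^ₚ n ≋ p ^ₚ n *ₚ q ^ₚ n
*-^-distrib p q zero    = ≋-sym (CommutativeRing.*-identityˡ polyRing (const 1ℚ))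
*-^-distrib p q (suc n) = ≋-trans (*-cong (≋-refl {p *ₚ q}) (*-^-distrib p q n))
  (solve 4 (λ x y z t → (x :* y) :* (z :* t) := (x :* z) :* (y :* t)) ≋-refl p q (p ^ₚ n) (q ^ₚ n))
  where open PolySolver

infixr 8 _^ℚ_
_^ℚ_ : ℚ → ℕ → ℚ
x ^ℚ zero  = 1ℚ
x ^ℚ suc n = x ℚ.* x ^ℚ n

X*≋0∷ : ∀ p → Xₚ *ₚ p ≋ 0ℚ ∷ p
X*≋0∷ p = ≋-trans (∷-* (const 1ℚ) p) (∷-cong refl (CommutativeRing.*-identityˡ polyRing p))

coeff₀-* : ∀ p q → coeff (p *ₚ q) 0 ≡ coeff p 0 ℚ.* coeff q 0
coeff₀-* []      q = sym (ℚP.*-zeroˡ (coeff q 0))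
coeff₀-* (a ∷ p) q = trans (coeff-+ (a ·ₚ q) _ 0) (trans (ℚP.+-identityʳ _) (coeff-· a q 0))

coeff₀-^ : ∀ p n → coeff (p ^ₚ n) 0 ≡ coeff p 0 ^ℚ n
coeff₀-^ p zero    = refl
coeff₀-^ p (suc n) = trans (coeff₀-* p (p ^ₚ n)) (cong (coeff p 0 ℚ.*_) (coeff₀-^ p n))

-- Composition and evaluation

∷≋0⇒≋0 : ∀ {a p} → a ∷ p ≋ [] → p ≋ []
∷≋0⇒≋0 e = mk≋ λ i → at e (suc i)

compose-0 : ∀ p q → p ≋ [] → compose p q ≋ []
compose-0 []      q e = ≋-refl
compose-0 (a ∷ p) q e = begin
  const a +ₚ q *ₚ compose p q ≈⟨ +-cong (const-cong (at e 0)) (*-congʳ q (compose-0 p q (∷≋0⇒≋0 e))) ⟩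
  const 0ℚ +ₚ q *ₚ [] ≈⟨ +-cong 0∷[]≋0 (*-zeroʳ′ q) ⟩
  [] ∎
  where open ≋-Reasoning

compose-cong : ∀ {p p′} q → p ≋ p′ → compose p q ≋ compose p′ q
compose-cong {[]}    {p′}     q e = ≋-sym (compose-0 p′ q (≋-sym e))
compose-cong {a ∷ p} {[]}     q e = compose-0 (a ∷ p) q e
compose-cong {a ∷ p} {b ∷ p′} q e = +-cong (const-cong (at e 0))
  (*-congʳ q (compose-cong {p} {p′} q (mk≋ λ i → at e (suc i))))

compose-congʳ : ∀ p {q q′} → q ≋ q′ → compose p q ≋ compose p q′
compose-congʳ []      e = ≋-refl
compose-congʳ (a ∷ p) e = +-congʳ (const a) (*-cong e (compose-congʳ p e))

compose-+ : ∀ p p′ q → compose (p +ₚ p′) q ≋ compose p q +ₚ compose p′ q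
compose-+ []      p′       q = ≋-refl
compose-+ (a ∷ p) []       q = ≋-sym (+-identityʳ _)
compose-+ (a ∷ p) (b ∷ p′) q = ≋-trans
  (+-cong (≋-refl {const (a ℚ.+ b)}) (*-cong (≋-refl {q}) (compose-+ p p′ q)))
  (solve 5 (λ a b x y q → (a :+ b) :+ q :* (x :+ y) := (a :+ q :* x) :+ (b :+ q :* y)) ≋-refl
    (const a) (const b) (compose p q) (compose p′ q) q)
  where open PolySolver

compose-· : ∀ c p q → compose (c ·ₚ p) q ≋ const c *ₚ compose p q
compose-· c []      q = ≋-sym (CommutativeRing.zeroʳ polyRing (const c))
compose-· c (a ∷ p) q = ≋-trans
  (+-cong (≋-sym (const-*-const c a)) (*-cong (≋-refl {q}) (compose-· c p q)))
  (solve 4 (λ c a x q → c :* a :+ q :* (c :* x) := c :* (a :+ q :* x)) ≋-refl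
    (const c) (const a) (compose p q) q)
  where open PolySolver

compose-0∷ : ∀ p q → compose (0ℚ ∷ p) q ≋ q *ₚ compose p q
compose-0∷ p q = +-cong {q = q *ₚ compose p q} 0∷[]≋0 ≋-refl

compose-* : ∀ p p′ q → compose (p *ₚ p′) q ≋ compose p q *ₚ compose p′ q
compose-* []      p′ q = ≋-refl
compose-* (a ∷ p) p′ q = begin
  compose (a ·ₚ p′ +ₚ (0ℚ ∷ p *ₚ p′)) q
    ≈⟨ compose-+ (a ·ₚ p′) _ q ⟩
  compose (a ·ₚ p′) q +ₚ compose (0ℚ ∷ p *ₚ p′) q
    ≈⟨ +-cong (compose-· a p′ q) (≋-trans (compose-0∷ (p *ₚ p′) q) (*-congʳ q (compose-* p p′ q))) ⟩
  const a *ₚ compose p′ q +ₚ q *ₚ (compose p q *ₚ compose p′ q)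
    ≈⟨ solve 4 (λ a x y q → a :* y :+ q :* (x :* y) := (a :+ q :* x) :* y) ≋-refl
         (const a) (compose p q) (compose p′ q) q ⟩
  (const a +ₚ q *ₚ compose p q) *ₚ compose p′ q
    ∎
  where
  open ≋-Reasoning
  open PolySolver

compose-const : ∀ c q → compose (const c) q ≋ const c
compose-const c q = ≋-trans (+-cong (≋-refl {const c}) (*-zeroʳ′ q)) (+-identityʳ _)

compose-X : ∀ q → compose Xₚ q ≋ q
compose-X q = ≋-trans (compose-0∷ (const 1ℚ) q)
  (≋-trans (*-cong (≋-refl {q}) (compose-const 1ℚ q)) (CommutativeRing.*-identityʳ polyRing q))

compose-assoc : ∀ p q t → compose (compose p q) t ≋ compose p (compose q t)
compose-assoc []      q t = ≋-refl
compose-assoc (a ∷ p) q t = begin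
  compose (const a +ₚ q *ₚ compose p q) t
    ≈⟨ compose-+ (const a) (q *ₚ compose p q) t ⟩
  compose (const a) t +ₚ compose (q *ₚ compose p q) t
    ≈⟨ +-cong (compose-const a t) (compose-* q (compose p q) t) ⟩
  const a +ₚ compose q t *ₚ compose (compose p q) t
    ≈⟨ +-cong (≋-refl {const a}) (*-cong (≋-refl {compose q t}) (compose-assoc p q t)) ⟩
  const a +ₚ compose q t *ₚ compose p (compose q t)
    ∎
  where open ≋-Reasoning

compose-id : ∀ p → compose p Xₚ ≋ p
compose-id []      = ≋-refl
compose-id (a ∷ p) = ≋-trans
  (+-cong (≋-refl {const a}) (≋-trans (X*≋0∷ (compose p Xₚ)) (∷-cong refl (compose-id p))))
  (∷-cong (ℚP.+-identityʳ a) ≋-refl)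

-- Evaluation is composition with a constant polynomial; that it respects sums and products is then
-- inherited from `compose-+` and `compose-*`.
eval : Poly → ℚ → ℚ
eval p x = coeff (compose p (const x)) 0

eval-cong : ∀ {p q} x → p ≋ q → eval p x ≡ eval q x
eval-cong x e = at (compose-cong (const x) e) 0

eval-+ : ∀ p q x → eval (p +ₚ q) x ≡ eval p x ℚ.+ eval q x
eval-+ p q x = trans (at (compose-+ p q (const x)) 0) (coeff-+ (compose p (const x)) _ 0)

eval-* : ∀ p q x → eval (p *ₚ q) x ≡ eval p x ℚ.* eval q x
eval-* p q x = trans (at (compose-* p q (const x)) 0) (coeff₀-* (compose p (const x)) _)

eval-· : ∀ c p x → eval (c ·ₚ p) x ≡ c ℚ.* eval p x
eval-· c p x = trans (at (compose-· c p (const x)) 0) (coeff₀-* (const c) (compose p (const x)))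

eval-const : ∀ c x → eval (const c) x ≡ c
eval-const c x = at (compose-const c (const x)) 0

eval-X : ∀ x → eval Xₚ x ≡ x
eval-X x = at (compose-X (const x)) 0

eval-^ : ∀ p n x → eval (p ^ₚ n) x ≡ eval p x ^ℚ n
eval-^ p zero    x = eval-const 1ℚ x
eval-^ p (suc n) x = trans (eval-* p (p ^ₚ n) x) (cong (eval p x ℚ.*_) (eval-^ p n x))

eval-∷ : ∀ a p x → eval (a ∷ p) x ≡ a ℚ.+ x ℚ.* eval p x
eval-∷ a p x = trans (coeff-+ (const a) (const x *ₚ compose p (const x)) 0)
  (cong (a ℚ.+_) (coeff₀-* (const x) (compose p (const x))))

-- Degrees and leading coefficients

record DegLE (p : Poly) (k : ℕ) : Set where
  constructor mkDegLE
  field above : ∀ i → k < i → coeff p i ≡ 0ℚ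
open DegLE public

-- The value `l` may be 0. Products and powers can therefore be formed without nonvanishing
-- hypotheses, which enter only where an actual degree is read off.
record Lead (p : Poly) (k : ℕ) (l : ℚ) : Set where
  constructor mkLead
  field
    lead  : coeff p k ≡ l
    degLE : DegLE p k
open Lead public

DegLE-cong : ∀ {p q k} → p ≋ q → DegLE p k → DegLE q k
DegLE-cong e h = mkDegLE λ i k<i → trans (sym (at e i)) (above h i k<i)

Lead-cong : ∀ {p q k l} → p ≋ q → Lead p k l → Lead q k l
Lead-cong {k = k} e (mkLead a b) = mkLead (trans (sym (at e k)) a) (DegLE-cong e b)

DegLE-mono : ∀ {p k k′} → k ≤ k′ → DegLE p k → DegLE p k′
DegLE-mono k≤k′ h = mkDegLE λ i k′<i → above h i (ℕP.≤-<-trans k≤k′ k′<i)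

DegLE-+ : ∀ {p q k} → DegLE p k → DegLE q k → DegLE (p +ₚ q) k
DegLE-+ {p} {q} h h′ = mkDegLE λ i k<i → trans (coeff-+ p q i) (cong₂ ℚ._+_ (above h i k<i) (above h′ i k<i))

DegLE-· : ∀ c {p k} → DegLE p k → DegLE (c ·ₚ p) k
DegLE-· c {p} h = mkDegLE λ i k<i → trans (coeff-· c p i) (trans (cong (c ℚ.*_) (above h i k<i)) (ℚP.*-zeroʳ c))

DegLE-const : ∀ c k → DegLE (const c) k
DegLE-const c k = mkDegLE λ { (suc i) k<i → refl }

Lead-+ : ∀ {p q k l} → Lead p k l → DegLE q k → ∀ {l′} → coeff q k ≡ l′ → Lead (p +ₚ q) k (l ℚ.+ l′)
Lead-+ {p} {q} {k} (mkLead a b) h e = mkLead (trans (coeff-+ p q k) (cong₂ ℚ._+_ a e)) (DegLE-+ {p} {q} b h)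

Lead-· : ∀ c {p k l} → Lead p k l → Lead (c ·ₚ p) k (c ℚ.* l)
Lead-· c {p} {k} (mkLead a b) = mkLead (trans (coeff-· c p k) (cong (c ℚ.*_) a)) (DegLE-· c {p} b)

Lead-const : ∀ c → Lead (const c) 0 c
Lead-const c = mkLead refl (DegLE-const c 0)

Lead-* : ∀ p q {i j l l′} → Lead p i l → Lead q j l′ → Lead (p *ₚ q) (i + j) (l ℚ.* l′)
Lead-* [] q {i} {j} {l} {l′} (mkLead 0≡l _) _ =
  mkLead (trans (sym (ℚP.*-zeroˡ l′)) (cong (ℚ._* l′) 0≡l)) (mkDegLE λ _ _ → refl)
-- Degree at most 0 forces the tail of the first factor to vanish, so the product is a scalar
-- multiple of `q`.
Lead-* (a ∷ p) q {zero} (mkLead refl h) lq = Lead-cong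
  (≋-trans (≋-sym (+-identityʳ (a ·ₚ q))) (+-congʳ (a ·ₚ q) (≋-sym (≋-trans
    (∷-cong refl (*-congˡ {p} {[]} q (mk≋ λ i → above h (suc i) (s≤s z≤n)))) 0∷[]≋0))))
  (Lead-· a lq)
Lead-* (a ∷ p) q {suc i} {j} {l} {l′} (mkLead e h) lq = mkLead
  (trans (coeff-+ (a ·ₚ q) _ (suc i + j))
    (trans (cong₂ ℚ._+_ (above aq (suc i + j) (s≤s (m≤n+m j i))) (lead ih)) (ℚP.+-identityˡ _)))
  (mkDegLE λ { (suc k) (s≤s lt) → trans (coeff-+ (a ·ₚ q) _ (suc k))
      (cong₂ ℚ._+_ (above aq (suc k) (s≤s (≤-trans (m≤n+m j i) (<⇒≤ lt)))) (above (degLE ih) k lt)) })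
  where
  aq = DegLE-· a {q} (degLE lq)
  ih = Lead-* p q {i} {j} (mkLead e (mkDegLE λ k lt → above h (suc k) (s≤s lt))) lq

DegLE⇒Lead : ∀ {p k} → DegLE p k → Lead p k (coeff p k)
DegLE⇒Lead h = mkLead refl h

DegLE-* : ∀ p q {i j} → DegLE p i → DegLE q j → DegLE (p *ₚ q) (i + j)
DegLE-* p q h h′ = degLE (Lead-* p q (DegLE⇒Lead h) (DegLE⇒Lead h′))

Lead-^ : ∀ n p {i l} → Lead p i l → Lead (p ^ₚ n) (n * i) (l ^ℚ n)
Lead-^ zero    p h = Lead-const 1ℚ
Lead-^ (suc n) p h = Lead-* p (p ^ₚ n) h (Lead-^ n p h)

DegLE-^ : ∀ n p {i} → DegLE p i → DegLE (p ^ₚ n) (n * i)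
DegLE-^ n p h = degLE (Lead-^ n p (DegLE⇒Lead h))

-- Each Horner step multiplies once by a polynomial of degree at most 1. For an invertible
-- substitution the bound applied in both directions gives equality of degrees.
DegLE-compose : ∀ p {q k} → DegLE q 1 → DegLE p k → DegLE (compose p q) k
DegLE-compose []      hq h = mkDegLE λ _ _ → refl
DegLE-compose (a ∷ p) {q} {zero} hq h = DegLE-cong {const a} (≋-sym (begin
  const a +ₚ q *ₚ compose p q ≈⟨ +-congʳ (const a) (*-congʳ q (compose-0 p q (mk≋ λ i → above h (suc i) (s≤s z≤n)))) ⟩
  const a +ₚ q *ₚ [] ≈⟨ +-congʳ (const a) (*-zeroʳ′ q) ⟩
  const a ∎)) (DegLE-const a 0)
  where open ≋-Reasoning
DegLE-compose (a ∷ p) {q} {suc k} hq h = DegLE-+ {const a} {q *ₚ compose p q} (DegLE-const a (suc k))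
  (DegLE-* q (compose p q) hq (DegLE-compose p hq (mkDegLE λ i lt → above h (suc i) (s≤s lt))))

≋0? : ∀ p → Dec (p ≋ [])
≋0? []      = yes ≋-refl
≋0? (a ∷ p) with a ℚP.≟ 0ℚ | ≋0? p
... | yes refl | yes e = yes (≋-trans (∷-cong refl e) 0∷[]≋0)
... | no a≢0   | _     = no λ e → a≢0 (at e 0)
... | _        | no ne = no λ e → ne (∷≋0⇒≋0 e)

private
  coeff-++-zeros : ∀ p zs → All (_≡ 0ℚ) zs → p ++ zs ≋ p
  coeff-++-zeros []      []       []          = ≋-refl
  coeff-++-zeros []      (z ∷ zs) (refl ∷ az) = ≋-trans (∷-cong refl (coeff-++-zeros [] zs az)) 0∷[]≋0
  coeff-++-zeros (a ∷ p) zs       az          = ∷-cong refl (coeff-++-zeros p zs az)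

  strip-≋ : ∀ p → strip p ≋ p
  strip-≋ p = ≋-trans (≋-sym (coeff-++-zeros (strip p) (reverse (takeWhile (ℚ._≟ 0ℚ) (reverse p)))
      (PermP.All-resp-↭ (Perm.↭-sym (PermP.↭-reverse _)) (AllP.all-takeWhile (ℚ._≟ 0ℚ) (reverse p)))))
    (≡⇒≋ (begin
      strip p ++ reverse (takeWhile (ℚ._≟ 0ℚ) (reverse p))
        ≡⟨ ListP.reverse-++ (takeWhile (ℚ._≟ 0ℚ) (reverse p)) _ ⟨
      reverse (takeWhile (ℚ._≟ 0ℚ) (reverse p) ++ dropWhile (ℚ._≟ 0ℚ) (reverse p))
        ≡⟨ cong reverse (ListP.takeWhile++dropWhile (ℚ._≟ 0ℚ) (reverse p)) ⟩
      reverse (reverse p)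
        ≡⟨ ListP.reverse-involutive p ⟩
      p ∎))
    where open ≡-Reasoning

  dropWhile-head : ∀ p {a q} → dropWhile (ℚ._≟ 0ℚ) p ≡ a ∷ q → a ≢ 0ℚ
  dropWhile-head (x ∷ p) eq with x ℚ.≟ 0ℚ
  dropWhile-head (x ∷ p) eq   | yes _  = dropWhile-head p eq
  dropWhile-head (x ∷ p) refl | no x≢0 = x≢0

  coeff-∷ʳ : ∀ p a → Lead (p ∷ʳ a) (length p) a
  coeff-∷ʳ []      a = Lead-const a
  coeff-∷ʳ (b ∷ p) a = mkLead (lead ih) (mkDegLE λ { (suc i) (s≤s lt) → above (degLE ih) i lt })
    where ih = coeff-∷ʳ p a

-- Stripping removes the initial zeros of the reversed list; what remains starts with a nonzero
-- entry, and this is the leading coefficient.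
deg-Lead : ∀ {p} → ¬ p ≋ [] → Σ ℚ λ l → Lead p (deg p) l × l ≢ 0ℚ
deg-Lead {p} p≢0 with dropWhile (ℚ._≟ 0ℚ) (reverse p) in eq
... | [] = ⊥-elim (p≢0 (≋-trans (≋-sym (strip-≋ p)) (≡⇒≋ (cong reverse eq))))
... | a ∷ q = a
  , subst (λ k → Lead p k a) len
      (Lead-cong (≋-trans (≡⇒≋ (trans (sym (ListP.unfold-reverse a q)) (cong reverse (sym eq)))) (strip-≋ p))
        (coeff-∷ʳ (reverse q) a))
  , dropWhile-head (reverse p) eq
  where
  len : length (reverse q) ≡ length (reverse (a ∷ q)) ∸ 1
  len = sym (trans (cong (_∸ 1) (ListP.length-reverse (a ∷ q))) (sym (ListP.length-reverse q)))

Lead-unique : ∀ {p k k′ l l′} → Lead p k l → Lead p k′ l′ → l ≢ 0ℚ → l′ ≢ 0ℚ → k ≡ k′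
Lead-unique {k = k} {k′} (mkLead e h) (mkLead e′ h′) l≢0 l′≢0 with <-cmp k k′
... | tri< lt _ _ = ⊥-elim (l′≢0 (trans (sym e′) (above h k′ lt)))
... | tri≈ _ eq _ = eq
... | tri> _ _ gt = ⊥-elim (l≢0 (trans (sym e) (above h′ k gt)))

Lead⇒≢0 : ∀ {p k l} → Lead p k l → l ≢ 0ℚ → ¬ p ≋ []
Lead⇒≢0 {k = k} (mkLead e _) l≢0 p≋0 = l≢0 (trans (sym e) (at p≋0 k))

Lead⇒deg : ∀ {p k l} → Lead p k l → l ≢ 0ℚ → deg p ≡ k
Lead⇒deg h l≢0 with deg-Lead (Lead⇒≢0 h l≢0)
... | _ , h′ , l′≢0 = Lead-unique h′ h l′≢0 l≢0

DegLE-deg : ∀ p → DegLE p (deg p)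
DegLE-deg p with ≋0? p
... | yes p≋0 = mkDegLE λ i _ → at p≋0 i
... | no p≢0  = degLE (proj₁ (proj₂ (deg-Lead p≢0)))

coeff≢0⇒≤deg : ∀ p i → coeff p i ≢ 0ℚ → i ≤ deg p
coeff≢0⇒≤deg p i ne = ≮⇒≥ λ lt → ne (above (DegLE-deg p) i lt)

≋0⇒deg≡0 : ∀ {p} → p ≋ [] → deg p ≡ 0
≋0⇒deg≡0 {p} p≋0 with dropWhile (ℚ._≟ 0ℚ) (reverse p) in eq
... | [] = refl
... | a ∷ q = ⊥-elim (dropWhile-head (reverse p) eq (trans (sym (lead (coeff-∷ʳ (reverse q) a)))
   (at (≋-trans (≡⇒≋ (trans (sym (ListP.unfold-reverse a q)) (cong reverse (sym eq)))) (≋-trans (strip-≋ p) p≋0))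
     (length (reverse q)))))

DegLE⇒deg≤ : ∀ p {k} → DegLE p k → deg p ≤ k
DegLE⇒deg≤ p {k} h with ≋0? p
... | yes p≋0 = subst (_≤ k) (sym (≋0⇒deg≡0 p≋0)) z≤n
... | no p≢0 with deg-Lead p≢0
...   | _ , mkLead e _ , l≢0 = ≮⇒≥ λ lt → l≢0 (trans (sym e) (above h (deg p) lt))

ℚ-integral : ∀ {a b} → a ≢ 0ℚ → b ≢ 0ℚ → a ℚ.* b ≢ 0ℚ
ℚ-integral {a} {b} a≢0 b≢0 ab≡0 = b≢0 (begin
  b ≡⟨ ℚP.*-identityˡ b ⟨
  1ℚ ℚ.* b ≡⟨ cong (ℚ._* b) (ℚP.*-inverseˡ a) ⟨
  (ℚ.1/ a ℚ.* a) ℚ.* b ≡⟨ ℚP.*-assoc (ℚ.1/ a) a b ⟩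
  ℚ.1/ a ℚ.* (a ℚ.* b) ≡⟨ cong (ℚ.1/ a ℚ.*_) ab≡0 ⟩
  ℚ.1/ a ℚ.* 0ℚ ≡⟨ ℚP.*-zeroʳ (ℚ.1/ a) ⟩
  0ℚ ∎)
  where
  open ≡-Reasoning
  instance _ = ℚ.≢-nonZero a≢0

^ℚ-≢0 : ∀ n {a} → a ≢ 0ℚ → a ^ℚ n ≢ 0ℚ
^ℚ-≢0 zero    a≢0 = λ ()
^ℚ-≢0 (suc n) a≢0 = ℚ-integral a≢0 (^ℚ-≢0 n a≢0)

*≢0⇒≢0ˡ : ∀ {p q} → ¬ p *ₚ q ≋ [] → ¬ p ≋ []
*≢0⇒≢0ˡ {p} {q} h e = h (*-congˡ {p} {[]} q e)

*≢0⇒≢0ʳ : ∀ {p q} → ¬ p *ₚ q ≋ [] → ¬ q ≋ []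
*≢0⇒≢0ʳ {p} {q} h e = h (≋-trans (*-cong (≋-refl {p}) e) (*-zeroʳ′ p))

deg-* : ∀ {p q} → ¬ p ≋ [] → ¬ q ≋ [] → deg (p *ₚ q) ≡ deg p + deg q
deg-* {p} {q} p≢0 q≢0 with deg-Lead p≢0 | deg-Lead q≢0
... | _ , hp , l≢0 | _ , hq , l′≢0 = Lead⇒deg (Lead-* p q hp hq) (ℚ-integral l≢0 l′≢0)

deg-cong : ∀ {p q} → p ≋ q → deg p ≡ deg q
deg-cong {p} {q} e = ℕP.≤-antisym (DegLE⇒deg≤ p (DegLE-cong (≋-sym e) (DegLE-deg q)))
                                  (DegLE⇒deg≤ q (DegLE-cong e (DegLE-deg p)))

Lead-+-lower : ∀ {p q k l m} → Lead p k l → DegLE q m → m < k → Lead (p +ₚ q) k l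
Lead-+-lower {p} {q} {k} {l} h hq m<k = subst (Lead (p +ₚ q) k) (ℚP.+-identityʳ l)
  (Lead-+ h (DegLE-mono (<⇒≤ m<k) hq) (above hq k m<k))

Lead-index : ∀ {p k k′ l} → k ≡ k′ → Lead p k l → Lead p k′ l
Lead-index refl h = h

Lead-value : ∀ {p k l l′} → Lead p k l → Lead p k l′ → l ≡ l′
Lead-value h h′ = trans (sym (lead h)) (lead h′)

^ℚ-distrib-+ : ∀ x a b → x ^ℚ (a + b) ≡ x ^ℚ a ℚ.* x ^ℚ b
^ℚ-distrib-+ x zero    b = sym (ℚP.*-identityˡ (x ^ℚ b))
^ℚ-distrib-+ x (suc a) b = trans (cong (x ℚ.*_) (^ℚ-distrib-+ x a b)) (sym (ℚP.*-assoc x (x ^ℚ a) (x ^ℚ b)))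

^ℚ-*-assoc : ∀ x a b → (x ^ℚ a) ^ℚ b ≡ x ^ℚ (b * a)
^ℚ-*-assoc x a zero    = refl
^ℚ-*-assoc x a (suc b) = trans (cong (x ^ℚ a ℚ.*_) (^ℚ-*-assoc x a b)) (sym (^ℚ-distrib-+ x a (b * a)))

DegLE-geomQuot : ∀ k u v {m} → DegLE u (suc m) → DegLE v (suc m) → DegLE (geomQuot (suc k) u v) (k * suc m)
DegLE-geomQuot zero    u v hu hv = DegLE-cong (≋-sym (≋-trans (+-congʳ (const 1ℚ) (*-zeroʳ′ v)) (+-identityʳ (const 1ℚ)))) (DegLE-const 1ℚ 0)
DegLE-geomQuot (suc k) u v hu hv = DegLE-+ {u ^ₚ suc k} {v *ₚ geomQuot (suc k) u v}
  (DegLE-^ (suc k) u hu) (DegLE-* v (geomQuot (suc k) u v) hv (DegLE-geomQuot k u v hu hv))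

DegLE-neg : ∀ p {k} → DegLE p k → DegLE (negₚ p) k
DegLE-neg p = DegLE-· (ℚ.- 1ℚ) {p}

DegLE-X : DegLE Xₚ 1
DegLE-X = mkDegLE λ { (suc (suc i)) _ → refl ; (suc zero) (s≤s ()) }

Lead-X : Lead Xₚ 1 1ℚ
Lead-X = mkLead refl DegLE-X

head-tail : ∀ f → f ≋ coeff f 0 ∷ divX f
head-tail []      = ≋-sym 0∷[]≋0
head-tail (a ∷ f) = ≋-refl

eval-linear : ∀ f x → DegLE f 1 → eval f x ≡ coeff f 0 ℚ.+ x ℚ.* coeff f 1
eval-linear f x h = trans (eval-cong x linear) (trans (eval-∷ (coeff f 0) (const (coeff f 1)) x)
  (cong (λ y → coeff f 0 ℚ.+ x ℚ.* y) (eval-const (coeff f 1) x)))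
  where
  linear : f ≋ coeff f 0 ∷ const (coeff f 1)
  linear = mk≋ λ { zero → refl ; (suc zero) → refl ; (suc (suc i)) → above h (suc (suc i)) (s≤s (s≤s z≤n)) }

-- Integral polynomials and Gauss's lemma

IsInt : ℚ → Set
IsInt x = Σ ℤ λ z → x ≡ ι z

Integral : Poly → Set
Integral p = ∀ i → IsInt (coeff p i)

Multiple : ℕ → ℚ → Set
Multiple k x = Σ ℤ λ z → x ≡ ι z × + k ∣ z

AllMultiple : ℕ → Poly → Set
AllMultiple k p = ∀ i → Multiple k (coeff p i)

Multiple-+ : ∀ {k x y} → Multiple k x → Multiple k y → Multiple k (x ℚ.+ y)
Multiple-+ (z , refl , h) (z′ , refl , h′) = z ℤ.+ z′ , sym (ι-+ z z′) , ℤD.∣m∣n⇒∣m+n h h′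

Multiple-* : ∀ {k x y} → IsInt x → Multiple k y → Multiple k (x ℚ.* y)
Multiple-* (z , refl) (z′ , refl , h) = z ℤ.* z′ , sym (ι-* z z′) , ℤD.∣n⇒∣m*n z h

Multiple-+ʳ : ∀ {k x y} → Multiple k (x ℚ.+ y) → Multiple k x → Multiple k y
Multiple-+ʳ {k} {x} {y} h h′ = subst (Multiple k)
  (solve 2 (λ x y → (x :+ y) :+ con (ℚ.- 1ℚ) :* x := y) refl x y)
  (Multiple-+ h (Multiple-* (ℤ.-1ℤ , sym (trans (ι-neg ℤ.1ℤ) (cong ℚ.-_ ι-1))) h′))
  where open ℚSolver.+-*-Solver

Multiple-euclid : ∀ {q x y} → Prime q → IsInt x → IsInt y →
  Multiple q (x ℚ.* y) → ¬ Multiple q x → Multiple q y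
Multiple-euclid {q} pq (a , refl) (b , refl) (z , eq , h) ¬qa
  with euclidsLemma ℤ.∣ a ∣ ℤ.∣ b ∣ pq (subst (q ℕD.∣_) (ℤP.abs-* a b)
         (ℤD.∣⇒∣ᵤ (subst (+ q ∣_) (ι-injective (trans (sym eq) (sym (ι-* a b)))) h)))
... | inj₁ q∣a = ⊥-elim (¬qa (a , refl , ℤD.∣ᵤ⇒∣ q∣a))
... | inj₂ q∣b = b , refl , ℤD.∣ᵤ⇒∣ q∣b

Multiple? : ∀ q {x} → IsInt x → Dec (Multiple q x)
Multiple? q (z , refl) with + q ∣? z
... | yes h = yes (z , refl , h)
... | no nh = no λ { (z′ , eq , h) → nh (subst (+ q ∣_) (sym (ι-injective eq)) h) }

Multiple-0 : ∀ {q} → Multiple q 0ℚ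
Multiple-0 = ℤ.0ℤ , sym ι-0 , divides ℤ.0ℤ refl

private
  -- Modulo `q` the constant term `a` is invertible. The lowest coefficient of the product is a c,
  -- so `q` divides c; once c is removed from `g`, the remaining product is again divisible by `q`.
  gauss-unit : ∀ {q} → Prime q → ∀ a p g → IsInt a → Integral p → Integral g → ¬ Multiple q a →
    AllMultiple q ((a ∷ p) *ₚ g) → AllMultiple q g
  gauss-unit pq a p []      ia ip ig ¬qa h i = Multiple-0
  gauss-unit {q} pq a p (c ∷ g) ia ip ig ¬qa h = λ { zero → qc ; (suc i) → gauss-unit pq a p g ia ip (λ j → ig (suc j)) ¬qa rest i }
    where
    qc : Multiple q c
    qc = Multiple-euclid pq ia (ig 0) (subst (Multiple q) (ℚP.+-identityʳ (a ℚ.* c)) (h 0)) ¬qa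

    rest : AllMultiple q ((a ∷ p) *ₚ g)
    rest i = Multiple-+ʳ
      (subst (Multiple q) (trans (at (*-∷ (a ∷ p) c g) (suc i)) (coeff-+ (c ·ₚ (a ∷ p)) (0ℚ ∷ (a ∷ p) *ₚ g) (suc i))) (h (suc i)))
      (subst (Multiple q) (trans (ℚP.*-comm (coeff p i) c) (sym (coeff-· c p i))) (Multiple-* (ip i) qc))

-- The polynomials over ℤ/q form a domain: coefficients of `f` divisible by `q` are dropped from the
-- bottom until one is not, and there `gauss-unit` applies.
gauss-prime : ∀ {q} → Prime q → ∀ f g → Integral f → Integral g →
  AllMultiple q (f *ₚ g) → AllMultiple q f ⊎ AllMultiple q g
gauss-prime pq [] g if ig h = inj₁ λ i → Multiple-0
gauss-prime {q} pq (a ∷ f) g if ig h = go (Multiple? q (if 0))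
  where
  rest : Multiple q a → AllMultiple q (f *ₚ g)
  rest qa i = Multiple-+ʳ (subst (Multiple q) (coeff-+ (a ·ₚ g) (0ℚ ∷ f *ₚ g) (suc i)) (h (suc i)))
    (subst (Multiple q) (trans (ℚP.*-comm (coeff g (suc i)) a) (sym (coeff-· a g (suc i)))) (Multiple-* (ig (suc i)) qa))

  cons : Multiple q a → AllMultiple q f → AllMultiple q (a ∷ f)
  cons qa hf zero    = qa
  cons qa hf (suc i) = hf i

  go : Dec (Multiple q a) → AllMultiple q (a ∷ f) ⊎ AllMultiple q g
  go (no ¬qa) = inj₂ (gauss-unit pq a f g (if 0) (λ i → if (suc i)) ig ¬qa h)
  go (yes qa) = Sum.map₁ (cons qa) (gauss-prime pq f g (λ i → if (suc i)) ig (rest qa))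

↧*≡↥ : ∀ x → ι (ℚ.↧ x) ℚ.* x ≡ ι (ℚ.↥ x)
↧*≡↥ x@(ℚ.mkℚ n d _) = ℚP.toℚᵘ-injective (begin
  ℚ.toℚᵘ (ι (ℚ.↧ x) ℚ.* x) ≈⟨ ℚP.toℚᵘ-homo-* (ι (ℚ.↧ x)) x ⟩
  ℚ.toℚᵘ (ι (ℚ.↧ x)) ℚᵘ.* ℚᵘ.mkℚᵘ n d ≈⟨ ℚᵘP.*-cong (toᵘ-ι (ℚ.↧ x)) ℚᵘP.≃-refl ⟩
  ℚᵘ.mkℚᵘ (ℚ.↧ x) 0 ℚᵘ.* ℚᵘ.mkℚᵘ n d ≈⟨ ℚᵘ.*≡* (trans (ℤP.*-identityʳ _) (trans (ℤP.*-comm (+ suc d) n)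
                                                (cong (λ k → n ℤ.* + k) (sym (*-identityˡ (suc d)))))) ⟩
  ℚᵘ.mkℚᵘ n 0 ≈⟨ toᵘ-ι n ⟨
  ℚ.toℚᵘ (ι n) ∎)
  where open ℚᵘP.≃-Reasoning

d*oneOver≡1 : ∀ d .{{_ : ℕ.NonZero d}} → ι (+ d) ℚ.* oneOver d ≡ 1ℚ
d*oneOver≡1 (suc n) = ℚP.toℚᵘ-injective (begin
  ℚ.toℚᵘ (ι (+ suc n) ℚ.* oneOver (suc n)) ≈⟨ ℚP.toℚᵘ-homo-* (ι (+ suc n)) (oneOver (suc n)) ⟩
  ℚ.toℚᵘ (ι (+ suc n)) ℚᵘ.* ℚ.toℚᵘ (oneOver (suc n)) ≈⟨ ℚᵘP.*-cong (toᵘ-ι (+ suc n)) (ℚP.toℚᵘ-fromℚᵘ (ℚᵘ.mkℚᵘ (+ 1) n)) ⟩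
  ℚᵘ.mkℚᵘ (+ suc n) 0 ℚᵘ.* ℚᵘ.mkℚᵘ (+ 1) n ≈⟨ ℚᵘ.*≡* (trans (ℤP.*-identityʳ _) (trans (ℤP.*-identityʳ (+ suc n))
                                                               (trans (cong +_ (sym (*-identityˡ (suc n)))) (sym (ℤP.*-identityˡ _))))) ⟩
  ℚ.toℚᵘ 1ℚ ∎)
  where open ℚᵘP.≃-Reasoning

inverse : ∀ {x} → x ≢ 0ℚ → Σ ℚ λ y → y ℚ.* x ≡ 1ℚ
inverse {x} x≢0 = ℚ.1/ x , ℚP.*-inverseˡ x
  where instance _ = ℚ.≢-nonZero x≢0

ι≢0 : ∀ k .{{_ : ℕ.NonZero k}} → ι (+ k) ≢ 0ℚ
ι≢0 (suc k) eq with ι≡0⇒≡0 eq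
... | ()

inverse≢0 : ∀ {x y} → y ℚ.* x ≡ 1ℚ → y ≢ 0ℚ
inverse≢0 {x} eq refl with trans (sym (ℚP.*-zeroˡ x)) eq
... | ()

clear-denominators : ∀ p → Σ ℕ λ k → ℕ.NonZero k × Integral (ι (+ k) ·ₚ p)
clear-denominators []      = 1 , _ , λ i → ℤ.0ℤ , sym ι-0
clear-denominators (x ∷ p) with clear-denominators p
... | k , nz , h = ℚ.↧ₙ x * k , ℕP.m*n≢0 (ℚ.↧ₙ x) k {{_}} {{nz}} , λ
    { zero    → ℚ.↥ x ℤ.* + k , (begin
        ι (+ (ℚ.↧ₙ x * k)) ℚ.* x ≡⟨ cong (ℚ._* x) split ⟩
        (ι (ℚ.↧ x) ℚ.* ι (+ k)) ℚ.* x ≡⟨ solve 3 (λ a b c → (a :* b) :* c := (a :* c) :* b) refl (ι (ℚ.↧ x)) (ι (+ k)) x ⟩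
        (ι (ℚ.↧ x) ℚ.* x) ℚ.* ι (+ k) ≡⟨ cong (ℚ._* ι (+ k)) (↧*≡↥ x) ⟩
        ι (ℚ.↥ x) ℚ.* ι (+ k) ≡⟨ ι-* (ℚ.↥ x) (+ k) ⟨
        ι (ℚ.↥ x ℤ.* + k) ∎)
    ; (suc i) → ℚ.↧ x ℤ.* proj₁ (h i) , (begin
        coeff (ι (+ (ℚ.↧ₙ x * k)) ·ₚ p) i ≡⟨ coeff-· _ p i ⟩
        ι (+ (ℚ.↧ₙ x * k)) ℚ.* coeff p i ≡⟨ cong (ℚ._* coeff p i) split ⟩
        ι (ℚ.↧ x) ℚ.* ι (+ k) ℚ.* coeff p i ≡⟨ ℚP.*-assoc (ι (ℚ.↧ x)) (ι (+ k)) (coeff p i) ⟩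
        ι (ℚ.↧ x) ℚ.* (ι (+ k) ℚ.* coeff p i) ≡⟨ cong (ι (ℚ.↧ x) ℚ.*_) (trans (sym (coeff-· (ι (+ k)) p i)) (proj₂ (h i))) ⟩
        ι (ℚ.↧ x) ℚ.* ι (proj₁ (h i)) ≡⟨ ι-* (ℚ.↧ x) (proj₁ (h i)) ⟨
        ι (ℚ.↧ x ℤ.* proj₁ (h i)) ∎) }
  where
  open ≡-Reasoning
  open ℚSolver.+-*-Solver
  split : ι (+ (ℚ.↧ₙ x * k)) ≡ ι (ℚ.↧ x) ℚ.* ι (+ k)
  split = trans (cong ι (ℤP.pos-* (ℚ.↧ₙ x) k)) (ι-* (ℚ.↧ x) (+ k))

infix 4 _∼_
record _∼_ (f g : Poly) : Set where
  constructor mk∼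
  field
    factor   : ℚ
    factor≢0 : factor ≢ 0ℚ
    scaled   : g ≋ factor ·ₚ f

∼-trans : ∀ {f g h} → f ∼ g → g ∼ h → f ∼ h
∼-trans {f} (mk∼ c c≢0 e) (mk∼ c′ c′≢0 e′) = mk∼ (c′ ℚ.* c) (ℚ-integral c′≢0 c≢0)
  (≋-trans e′ (≋-trans (·-cong c′ e) (·-·-assoc c′ c f)))

∼-refl : ∀ {f} → f ∼ f
∼-refl {f} = mk∼ 1ℚ (λ ()) (≋-sym (1·-identity f))

∼⇒≢0 : ∀ {f g} → f ∼ g → ¬ f ≋ [] → ¬ g ≋ []
∼⇒≢0 {f} (mk∼ c c≢0 e) f≢0 g≋0 with inverse c≢0
... | u , uc = f≢0 (begin
  f ≈⟨ 1·-identity f ⟨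
  1ℚ ·ₚ f ≡⟨ cong (_·ₚ f) uc ⟨
  (u ℚ.* c) ·ₚ f ≈⟨ ·-·-assoc u c f ⟨
  u ·ₚ (c ·ₚ f) ≈⟨ ·-cong u (≋-trans (≋-sym e) g≋0) ⟩
  [] ∎)
  where open ≋-Reasoning

∼⇒deg≡ : ∀ {f g} → f ∼ g → deg f ≡ deg g
∼⇒deg≡ {f} {g} fg@(mk∼ c c≢0 e) with ≋0? f
... | yes f≋0 = trans (≋0⇒deg≡0 f≋0) (sym (≋0⇒deg≡0 (≋-trans e (·-cong c f≋0))))
... | no f≢0 with deg-Lead f≢0
...   | _ , h , l≢0 = sym (Lead⇒deg (Lead-cong (≋-sym e) (Lead-· c h)) (ℚ-integral c≢0 l≢0))

record IntegralFactors (f g Q : Poly) : Set where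
  field
    f′ g′ : Poly
    f′-int : Integral f′
    g′-int : Integral g′
    f∼f′ : f ∼ f′
    g∼g′ : g ∼ g′
    f′*g′≋Q : f′ *ₚ g′ ≋ Q

private
  divide-out : ∀ {q} {u} → u ℚ.* ι (+ q) ≡ 1ℚ → ∀ f → AllMultiple q f → Integral (u ·ₚ f)
  divide-out {q} {u} uq f h i with h i
  ... | z , eq , divides k refl = k , (begin
    coeff (u ·ₚ f) i ≡⟨ coeff-· u f i ⟩
    u ℚ.* coeff f i ≡⟨ cong (u ℚ.*_) (trans eq (trans (cong ι (ℤP.*-comm k (+ q))) (ι-* (+ q) k))) ⟩
    u ℚ.* (ι (+ q) ℚ.* ι k) ≡⟨ ℚP.*-assoc u (ι (+ q)) (ι k) ⟨
    (u ℚ.* ι (+ q)) ℚ.* ι k ≡⟨ cong (ℚ._* ι k) uq ⟩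
    1ℚ ℚ.* ι k ≡⟨ ℚP.*-identityˡ (ι k) ⟩
    ι k ∎)
    where open ≡-Reasoning

  cancel-factor : ∀ {u} q k {R} Q → u ℚ.* ι (+ q) ≡ 1ℚ → R ≋ ι (+ (q * k)) ·ₚ Q → u ·ₚ R ≋ ι (+ k) ·ₚ Q
  cancel-factor {u} q k {R} Q uq e = begin
    u ·ₚ R ≈⟨ ·-cong u e ⟩
    u ·ₚ (ι (+ (q * k)) ·ₚ Q) ≈⟨ ·-·-assoc u _ Q ⟩
    (u ℚ.* ι (+ (q * k))) ·ₚ Q ≡⟨ cong (_·ₚ Q) (trans (cong (u ℚ.*_) (trans (cong ι (ℤP.pos-* q k)) (ι-* (+ q) (+ k))))
                                               (trans (sym (ℚP.*-assoc u (ι (+ q)) (ι (+ k))))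
                                               (trans (cong (ℚ._* ι (+ k)) uq) (ℚP.*-identityˡ (ι (+ k)))))) ⟩
    ι (+ k) ·ₚ Q ∎
    where open ≋-Reasoning

  -- No content is ever computed: the primes of the common multiplier are cancelled one at a time,
  -- each against a factor all of whose coefficients it divides.
  divide-primes : ∀ ps → All Prime ps → ∀ f g Q → Integral f → Integral g → Integral Q →
    f *ₚ g ≋ ι (+ product ps) ·ₚ Q → IntegralFactors f g Q
  divide-primes [] [] f g Q if ig iQ e = record
    { f′ = f ; g′ = g ; f′-int = if ; g′-int = ig ; f∼f′ = ∼-refl ; g∼g′ = ∼-refl
    ; f′*g′≋Q = ≋-trans e (≋-trans (≡⇒≋ (cong (_·ₚ Q) ι-1)) (1·-identity Q)) }
  divide-primes (q ∷ ps) (pq ∷ pps) f g Q if ig iQ e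
    with inverse (ι≢0 q {{prime⇒nonZero pq}}) | gauss-prime pq f g if ig multiples
    where
    multiples : AllMultiple q (f *ₚ g)
    multiples i with iQ i
    ... | z , eq = + (q * product ps) ℤ.* z
      , trans (at e i) (trans (coeff-· _ Q i) (trans (cong (ι (+ (q * product ps)) ℚ.*_) eq)
          (sym (ι-* (+ (q * product ps)) z))))
      , ℤD.∣m⇒∣m*n z (divides (+ product ps) (trans (ℤP.pos-* q (product ps)) (ℤP.*-comm (+ q) _)))
  ... | u , uq | inj₁ hf = record
      { f′ = f′ ; g′ = g′ ; f′-int = f′-int ; g′-int = g′-int ; g∼g′ = g∼g′ ; f′*g′≋Q = f′*g′≋Q
      ; f∼f′ = ∼-trans (mk∼ u (inverse≢0 uq) ≋-refl) f∼f′ }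
    where open IntegralFactors (divide-primes ps pps (u ·ₚ f) g Q (divide-out uq f hf) ig iQ
                 (≋-trans (·-*-assoc u f g) (cancel-factor q (product ps) Q uq e)))
  ... | u , uq | inj₂ hg = record
      { f′ = f′ ; g′ = g′ ; f′-int = f′-int ; g′-int = g′-int ; f∼f′ = f∼f′ ; f′*g′≋Q = f′*g′≋Q
      ; g∼g′ = ∼-trans (mk∼ u (inverse≢0 uq) ≋-refl) g∼g′ }
    where open IntegralFactors (divide-primes ps pps f (u ·ₚ g) Q if (divide-out uq g hg) iQ
                 (≋-trans (≋-trans (*-comm f (u ·ₚ g)) (≋-trans (·-*-assoc u g f) (·-cong u (*-comm g f))))
                   (cancel-factor q (product ps) Q uq e)))

-- Clearing denominators gives (k f)(l g) = k l Q with integral factors on the left, and the prime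
-- factors of k l can then be cancelled on that side.
gauss : ∀ f g {Q} → Integral Q → f *ₚ g ≋ Q → IntegralFactors f g Q
gauss f g {Q} iQ e with clear-denominators f | clear-denominators g
... | k , nzk , if | l , nzl , ig = record
    { f′ = f′ ; g′ = g′ ; f′-int = f′-int ; g′-int = g′-int ; f′*g′≋Q = f′*g′≋Q
    ; f∼f′ = ∼-trans (mk∼ (ι (+ k)) (ι≢0 k {{nzk}}) ≋-refl) f∼f′
    ; g∼g′ = ∼-trans (mk∼ (ι (+ l)) (ι≢0 l {{nzl}}) ≋-refl) g∼g′ }
  where
  F = factorise (k * l) {{ℕP.m*n≢0 k l {{nzk}} {{nzl}}}}
  open PrimeFactorisation F
  e′ : (ι (+ k) ·ₚ f) *ₚ (ι (+ l) ·ₚ g) ≋ ι (+ product factors) ·ₚ Q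
  e′ = begin
    (ι (+ k) ·ₚ f) *ₚ (ι (+ l) ·ₚ g) ≈⟨ ·-*-assoc (ι (+ k)) f _ ⟩
    ι (+ k) ·ₚ (f *ₚ (ι (+ l) ·ₚ g)) ≈⟨ ·-cong (ι (+ k)) (≋-trans (*-comm f (ι (+ l) ·ₚ g))
                                             (≋-trans (·-*-assoc (ι (+ l)) g f) (·-cong (ι (+ l)) (≋-trans (*-comm g f) e)))) ⟩
    ι (+ k) ·ₚ (ι (+ l) ·ₚ Q) ≈⟨ ·-·-assoc (ι (+ k)) (ι (+ l)) Q ⟩
    (ι (+ k) ℚ.* ι (+ l)) ·ₚ Q ≡⟨ cong (_·ₚ Q) (trans (sym (ι-* (+ k) (+ l))) (cong ι (trans (sym (ℤP.pos-* k l)) (cong +_ isFactorisation)))) ⟩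
    ι (+ product factors) ·ₚ Q ∎
    where open ≋-Reasoning
  open IntegralFactors (divide-primes factors factorsPrime (ι (+ k) ·ₚ f) (ι (+ l) ·ₚ g) Q if ig iQ e′)

-- Divisibility by prime powers, and monomials

ι-^ : ∀ m k → ι (+ (m ^ k)) ≡ ι (+ m) ^ℚ k
ι-^ m zero    = ι-1
ι-^ m (suc k) = trans (cong ι (ℤP.pos-* m (m ^ k))) (trans (ι-* (+ m) (+ (m ^ k))) (cong (ι (+ m) ℚ.*_) (ι-^ m k)))

ℚ-cancel : ∀ {m a b} → m ≢ 0ℚ → m ℚ.* a ≡ m ℚ.* b → a ≡ b
ℚ-cancel {m} {a} {b} m≢0 eq with inverse m≢0
... | u , um = trans (expand a) (trans (cong (u ℚ.*_) eq) (sym (expand b)))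
  where
  expand : ∀ a → a ≡ u ℚ.* (m ℚ.* a)
  expand a = trans (sym (ℚP.*-identityˡ a)) (trans (cong (ℚ._* a) (sym um)) (ℚP.*-assoc u m a))

Multiple-*₂ : ∀ {k l x y} → Multiple k x → Multiple l y → Multiple (k * l) (x ℚ.* y)
Multiple-*₂ {k} {l} (_ , refl , divides a refl) (_ , refl , divides b refl) =
  _ , sym (ι-* (a ℤ.* + k) (b ℤ.* + l)) , divides (a ℤ.* b) (trans
    (solve 4 (λ a b k l → (a :* k) :* (b :* l) := (a :* b) :* (k :* l)) refl a b (+ k) (+ l))
    (cong (a ℤ.* b ℤ.*_) (sym (ℤP.pos-* k l))))
  where open ℤSolver.+-*-Solver

Multiple-∣ : ∀ {k l x} → l ℕD.∣ k → Multiple k x → Multiple l x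
Multiple-∣ l∣k (z , eq , h) = z , eq , ℤD.∣-trans (ℤD.∣ᵤ⇒∣ l∣k) h

^-∣ : ∀ p {m n} → m ≤ n → p ^ m ℕD.∣ p ^ n
^-∣ p {m} {n} m≤n = subst (λ k → p ^ m ℕD.∣ p ^ k) (ℕP.m+[n∸m]≡n m≤n)
  (subst (p ^ m ℕD.∣_) (sym (^-distribˡ-+-* p m (n ∸ m))) (ℕD.m∣m*n (p ^ (n ∸ m))))

mono : ℕ → ℚ → Poly
mono zero    x = const x
mono (suc i) x = 0ℚ ∷ mono i x

coeff-mono : ∀ i x → coeff (mono i x) i ≡ x
coeff-mono zero    x = refl
coeff-mono (suc i) x = coeff-mono i x

coeff-mono-≢ : ∀ i x {k} → i ≢ k → coeff (mono i x) k ≡ 0ℚ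
coeff-mono-≢ zero    x {zero}  i≢k = ⊥-elim (i≢k refl)
coeff-mono-≢ zero    x {suc k} i≢k = refl
coeff-mono-≢ (suc i) x {zero}  i≢k = refl
coeff-mono-≢ (suc i) x {suc k} i≢k = coeff-mono-≢ i x λ eq → i≢k (cong suc eq)

·-mono : ∀ c j y → c ·ₚ mono j y ≋ mono j (c ℚ.* y)
·-mono c zero    y = ≋-refl
·-mono c (suc j) y = ∷-cong (ℚP.*-zeroʳ c) (·-mono c j y)

mono-* : ∀ i j x y → mono i x *ₚ mono j y ≋ mono (i + j) (x ℚ.* y)
mono-* zero    j x y = ≋-trans (const-* x (mono j y)) (·-mono x j y)
mono-* (suc i) j x y = ≋-trans (∷-* (mono i x) (mono j y)) (∷-cong refl (mono-* i j x y))

-- Exact valuations at a prime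

module Valuation (p : ℕ) (pp : Prime p) where

  -- The valuation is a relation rather than a function, because 0 has no finite one.
  record Exact (e : ℕ) (x : ℚ) : Set where
    constructor exactly
    field
      unit   : ℤ
      equals : x ≡ ι (unit ℤ.* + (p ^ e))
      p∤unit : ¬ (+ p ∣ unit)

  Exact⇒Multiple : ∀ {e x} → Exact e x → Multiple (p ^ e) x
  Exact⇒Multiple (exactly c eq _) = _ , eq , divides c refl

  private instance
    p≢0 : ℕ.NonZero p
    p≢0 = prime⇒nonZero pp

    p^e≢0 : ∀ {e} → ℕ.NonZero (p ^ e)
    p^e≢0 {e} = ℕP.m^n≢0 p e

  prime∣*⇒ : ∀ a b → + p ∣ a ℤ.* b → + p ∣ a ⊎ + p ∣ b
  prime∣*⇒ a b h = Sum.map ℤD.∣ᵤ⇒∣ ℤD.∣ᵤ⇒∣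
    (euclidsLemma ℤ.∣ a ∣ ℤ.∣ b ∣ pp (subst (p ℕD.∣_) (ℤP.abs-* a b) (ℤD.∣⇒∣ᵤ h)))

  Exact-* : ∀ {e e′ x y} → Exact e x → Exact e′ y → Exact (e + e′) (x ℚ.* y)
  Exact-* {e} {e′} (exactly c refl h) (exactly c′ refl h′) = exactly (c ℤ.* c′)
    (trans (sym (ι-* _ _)) (cong ι (trans
        (solve 4 (λ a b k l → (a :* k) :* (b :* l) := (a :* b) :* (k :* l)) refl c c′ (+ (p ^ e)) (+ (p ^ e′)))
        (cong (c ℤ.* c′ ℤ.*_) (trans (sym (ℤP.pos-* (p ^ e) (p ^ e′))) (cong +_ (sym (^-distribˡ-+-* p e e′))))))))
    λ hp → Sum.[ h , h′ ]′ (prime∣*⇒ c c′ hp)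
    where open ℤSolver.+-*-Solver

  Exact-+ : ∀ {e x y} → Exact e x → Multiple (p ^ suc e) y → Exact e (x ℚ.+ y)
  Exact-+ {e} (exactly c refl h) (_ , refl , divides z refl) = exactly (c ℤ.+ z ℤ.* + p)
    (trans (sym (ι-+ _ _)) (cong ι (trans (cong (λ k → c ℤ.* + (p ^ e) ℤ.+ z ℤ.* k) (ℤP.pos-* p (p ^ e)))
        (solve 4 (λ c z p k → c :* k :+ z :* (p :* k) := (c :+ z :* p) :* k) refl c z (+ p) (+ (p ^ e))))))
    λ hp → h (ℤD.∣m+n∣n⇒∣m hp (divides z refl))
    where open ℤSolver.+-*-Solver

  Exact-≥ : ∀ {e e′ x} → Exact e x → Multiple (p ^ e′) x → e′ ≤ e
  Exact-≥ {e} {e′} (exactly c refl h) m = ≮⇒≥ λ lt → h (go (Multiple-∣ (^-∣ p {suc e} {e′} lt) m))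
    where
    go : Multiple (p ^ suc e) (ι (c ℤ.* + (p ^ e))) → + p ∣ c
    go (z , eq , hz) = ℤD.*-cancelʳ-∣ (+ (p ^ e)) {{p^e≢0 {e}}}
      (subst₂ _∣_ (ℤP.pos-* p (p ^ e)) (sym (ι-injective eq)) hz)

  Exact⇒≢0 : ∀ {e x} → Exact e x → x ≢ 0ℚ
  Exact⇒≢0 {e} ex refl = <-irrefl refl (Exact-≥ {e} {suc e} ex Multiple-0)

  private
    -- The number `k` bounds the absolute value of `z`, which drops at every division by `p`; it
    -- serves as the recursion measure.
    exact-fuel : ∀ k z → ℤ.∣ z ∣ ≤ k → z ≢ ℤ.0ℤ → Σ ℕ λ e → Exact e (ι z)
    exact-fuel k z le z≢0 with + p ∣? z
    ... | no h = 0 , exactly z (cong ι (sym (ℤP.*-identityʳ z))) h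
    exact-fuel zero z le z≢0 | yes _ = ⊥-elim (z≢0 (ℤP.∣i∣≡0⇒i≡0 (n≤0⇒n≡0 le)))
    exact-fuel (suc k) .(q ℤ.* + p) le z≢0 | yes (divides q refl) with exact-fuel k q le′ q≢0
      where
      q≢0 : q ≢ ℤ.0ℤ
      q≢0 refl = z≢0 refl
      le′ : ℤ.∣ q ∣ ≤ k
      le′ = ≤-pred (ℕP.<-≤-trans (ℕP.m<m*n ℤ.∣ q ∣ p {{ℕ.≢-nonZero λ eq → q≢0 (ℤP.∣i∣≡0⇒i≡0 eq)}} (ℕ.nonTrivial⇒n>1 p {{prime⇒nonTrivial pp}}))
        (subst (_≤ suc k) (ℤP.abs-* q (+ p)) le))
    ... | e , exactly c eq h = suc e , exactly c (cong ι (begin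
        q ℤ.* + p ≡⟨ cong (ℤ._* + p) (ι-injective eq) ⟩
        c ℤ.* + (p ^ e) ℤ.* + p ≡⟨ solve 3 (λ c k p → c :* k :* p := c :* (p :* k)) refl c (+ (p ^ e)) (+ p) ⟩
        c ℤ.* (+ p ℤ.* + (p ^ e)) ≡⟨ cong (c ℤ.*_) (ℤP.pos-* p (p ^ e)) ⟨
        c ℤ.* + (p * p ^ e) ∎)) h
      where
      open ≡-Reasoning
      open ℤSolver.+-*-Solver

  exact : ∀ {x} → IsInt x → x ≢ 0ℚ → Σ ℕ λ e → Exact e x
  exact (z , refl) x≢0 = exact-fuel ℤ.∣ z ∣ z ≤-refl λ { refl → x≢0 ι-0 }

-- Newton polygons and Dumas' criterion

module Newton (p : ℕ) (pp : Prime p) (N L : ℕ) {{nz : ℕ.NonZero N}} where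

  open Valuation p pp

  -- The exponent is any one that works, not necessarily the valuation, so that sums need no case
  -- distinction on cancellation. A zero coefficient qualifies with exponent `T`, since `N` is at
  -- least 1.
  Wt : ℕ → ℕ → ℚ → Set
  Wt T i x = Σ ℕ λ e → Multiple (p ^ e) x × T ≤ N * e + L * i

  -- The Newton polygon of f at p lies in the half plane T ≤ N v + L i.
  record V (T : ℕ) (f : Poly) : Set where
    constructor mkV
    field wt : ∀ i → Wt T i (coeff f i)
  open V public

  Wt-0 : ∀ {T i} → Wt T i 0ℚ
  Wt-0 {T} = T , Multiple-0 , ≤-trans (ℕP.m≤n*m T N) (m≤m+n (N * T) _)

  Wt-≡ : ∀ {T i x y} → x ≡ y → Wt T i x → Wt T i y
  Wt-≡ refl w = w

  Wt-+ : ∀ {T i x y} → Wt T i x → Wt T i y → Wt T i (x ℚ.+ y)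
  Wt-+ (e , m , h) (e′ , m′ , h′) with ≤-total e e′
  ... | inj₁ le = e  , Multiple-+ m (Multiple-∣ (^-∣ p le) m′) , h
  ... | inj₂ ge = e′ , Multiple-+ (Multiple-∣ (^-∣ p ge) m) m′ , h′

  V-cong : ∀ {T f g} → f ≋ g → V T f → V T g
  V-cong e h = mkV λ i → Wt-≡ (at e i) (wt h i)

  V-mono : ∀ {T T′ f} → T′ ≤ T → V T f → V T′ f
  V-mono le h = mkV λ i → let e , m , h′ = wt h i in e , m , ≤-trans le h′

  V-0 : ∀ {T} → V T []
  V-0 = mkV λ i → Wt-0

  V-+ : ∀ {T f g} → V T f → V T g → V T (f +ₚ g)
  V-+ {T} {f} {g} h h′ = mkV λ i → Wt-≡ (sym (coeff-+ f g i)) (Wt-+ (wt h i) (wt h′ i))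

  V-· : ∀ {T e c f} → Multiple (p ^ e) c → V T f → V (N * e + T) (c ·ₚ f)
  V-· {T} {e} {c} {f} m h = mkV λ i → scale i (wt h i)
    where
    open ℕP.≤-Reasoning
    open ℕSolver.+-*-Solver
    scale : ∀ i → Wt T i (coeff f i) → Wt (N * e + T) i (coeff (c ·ₚ f) i)
    scale i (e′ , m′ , h′) = e + e′
      , subst₂ Multiple (sym (^-distribˡ-+-* p e e′)) (sym (coeff-· c f i)) (Multiple-*₂ m m′)
      , (begin
          N * e + T ≤⟨ +-monoʳ-≤ (N * e) h′ ⟩
          N * e + (N * e′ + L * i) ≡⟨ solve 4 (λ N L e e′ → N :* e :+ (N :* e′ :+ L) := N :* (e :+ e′) :+ L) refl N (L * i) e e′ ⟩
          N * (e + e′) + L * i ∎)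

  -- Moving a coefficient up by one index adds `L` to its weight. Truncated subtraction does no
  -- harm, because weights are never negative.
  V-∷ : ∀ {T a f} → Wt T 0 a → V (T ∸ L) f → V T (a ∷ f)
  V-∷ {T} {a} {f} w h = mkV λ { zero → w ; (suc i) → shift i (wt h i) }
    where
    open ℕP.≤-Reasoning
    open ℕSolver.+-*-Solver
    shift : ∀ i → Wt (T ∸ L) i (coeff f i) → Wt T (suc i) (coeff f i)
    shift i (e , m , h′) = e , m , (begin
      T ≤⟨ m≤n+m∸n T L ⟩
      L + (T ∸ L) ≤⟨ +-monoʳ-≤ L h′ ⟩
      L + (N * e + L * i) ≡⟨ solve 3 (λ L n i → L :+ (n :+ L :* i) := n :+ L :* (con 1 :+ i)) refl L (N * e) i ⟩
      N * e + L * suc i ∎)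

  V-tail : ∀ {T a f} → V T (a ∷ f) → V (T ∸ L) f
  V-tail {T} {a} {f} h = mkV λ i → unshift i (wt h (suc i))
    where
    open ℕSolver.+-*-Solver
    unshift : ∀ i → Wt T (suc i) (coeff f i) → Wt (T ∸ L) i (coeff f i)
    unshift i (e , m , h′) = e , m , m≤n+o⇒m∸n≤o T L (≤-trans h′ (≤-reflexive
      (solve 3 (λ L n i → n :+ L :* (con 1 :+ i) := L :+ (n :+ L :* i)) refl L (N * e) i)))

  V-const : ∀ {T c} e → Multiple (p ^ e) c → T ≤ N * e → V T (const c)
  V-const e m le = V-∷ (e , m , ≤-trans le (m≤m+n _ _)) V-0

  V-int : ∀ {c} → IsInt c → V 0 (const c)
  V-int (z , eq) = V-const 0 (z , eq , divides z (sym (ℤP.*-identityʳ z))) z≤n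

  V-X : V L Xₚ
  V-X = V-∷ Wt-0 (V-mono (≤-reflexive (ℕP.n∸n≡0 L)) (V-int (ℤ.1ℤ , sym ι-1)))

  V-* : ∀ {T T′} f g → V T f → V T′ g → V (T + T′) (f *ₚ g)
  V-* []      g hf hg = V-0
  V-* {T} {T′} (a ∷ f) g hf hg = V-+ (head (wt hf 0))
    (V-∷ Wt-0 (V-mono (m≤n+o⇒m∸n≤o (T + T′) L
       (≤-trans (+-monoˡ-≤ T′ (m≤n+m∸n T L)) (≤-reflexive (ℕP.+-assoc L (T ∸ L) T′))))
       (V-* f g (V-tail hf) hg)))
    where
    head : Wt T 0 a → V (T + T′) (a ·ₚ g)
    head (e , m , h) = V-mono (+-monoˡ-≤ T′ (≤-trans h (≤-reflexive
      (trans (cong (N * e ℕ.+_) (*-zeroʳ L)) (ℕP.+-identityʳ (N * e)))))) (V-· {e = e} m hg)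

  V-^ : ∀ {T} n f → V T f → V (n * T) (f ^ₚ n)
  V-^ zero    f h = V-int (ℤ.1ℤ , sym ι-1)
  V-^ (suc n) f h = V-* f (f ^ₚ n) h (V-^ n f h)

  V-neg : ∀ {T} f → V T f → V T (negₚ f)
  V-neg {T} f h = V-mono (≤-reflexive (cong (ℕ._+ T) (sym (*-zeroʳ N))))
    (V-· {e = 0} {f = f} (ℤ.-1ℤ , sym (trans (ι-neg ℤ.1ℤ) (cong ℚ.-_ ι-1)) , divides ℤ.-1ℤ refl) h)

  V-mono-poly : ∀ {e x} i → Multiple (p ^ e) x → V (N * e + L * i) (mono i x)
  V-mono-poly {e} {x} i m = mkV go
    where
    go : ∀ k → Wt (N * e + L * i) k (coeff (mono i x) k)
    go k with i ℕP.≟ k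
    ... | yes refl = e , subst (Multiple (p ^ e)) (sym (coeff-mono i x)) m , ≤-refl
    ... | no i≢k   = Wt-≡ (sym (coeff-mono-≢ i x i≢k)) Wt-0

  -- The least weight N v + L i of a coefficient is attained at one index only, or (Two) at least at two.
  record Unique (f : Poly) : Set where
    field
      index val : ℕ
      coef      : ℚ
      isExact   : Exact val coef
      rest      : Poly
      decomp    : f ≋ mono index coef +ₚ rest
      rest-V    : V (suc (N * val + L * index)) rest

    minWt : ℕ
    minWt = N * val + L * index

    V-min : V minWt f
    V-min = V-cong (≋-sym decomp) (V-+ {f = mono index coef} {g = rest}
      (V-mono-poly index (Exact⇒Multiple isExact)) (V-mono (n≤1+n _) rest-V))

    -- At the same index a larger weight means a larger valuation, so the contribution of `rest`
    -- cannot change the valuation of the coefficient.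
    exact-at : Exact val (coeff f index)
    exact-at = subst (Exact val) (sym (trans (at decomp index) (trans (coeff-+ (mono index coef) rest index)
      (cong (ℚ._+ coeff rest index) (coeff-mono index coef))))) (Exact-+ isExact (go (wt rest-V index)))
      where
      go : Wt (suc minWt) index (coeff rest index) → Multiple (p ^ suc val) (coeff rest index)
      go (e , m , h) = Multiple-∣ (^-∣ p (ℕP.*-cancelˡ-< N val e (ℕP.+-cancelʳ-< (L * index) (N * val) (N * e) h))) m

    larger : ∀ {k} → index ≢ k → Wt (suc minWt) k (coeff f k)
    larger {k} ne = Wt-≡ (sym (trans (at decomp k) (trans (coeff-+ (mono index coef) rest k)
      (trans (cong (ℚ._+ coeff rest k) (coeff-mono-≢ index coef ne)) (ℚP.+-identityˡ _))))) (wt rest-V k)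

  record Two (f : Poly) : Set where
    field
      i j e e′ : ℕ
      i<j      : i < j
      exact-i  : Exact e (coeff f i)
      exact-j  : Exact e′ (coeff f j)
      sameWt   : N * e + L * i ≡ N * e′ + L * j
      V-min    : V (N * e + L * i) f

  Wt-Exact : ∀ {T i e x} → Wt T i x → Exact e x → T ≤ N * e + L * i
  Wt-Exact {i = i} (e , m , h) ex = ≤-trans h (+-monoˡ-≤ (L * i) (*-monoʳ-≤ N (Exact-≥ ex m)))

  -- At least one of the two tied indices differs from the unique one, and its weight would have to
  -- be strictly larger than the minimum.
  Two⇒¬Unique : ∀ {f} → Two f → ¬ Unique f
  Two⇒¬Unique {f} two uni with index ℕP.≟ i
    where
    open Two two
    open Unique uni using (index)
  ... | no ne = <-irrefl refl (≤-trans (Wt-Exact (U.larger ne) T.exact-i) (Wt-Exact (wt T.V-min U.index) U.exact-at))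
    where
    module T = Two two
    module U = Unique uni
  ... | yes refl = <-irrefl refl (≤-trans (Wt-Exact (U.larger (ℕP.<⇒≢ T.i<j)) T.exact-j)
      (subst (_≤ U.minWt) T.sameWt (Wt-Exact (wt T.V-min U.index) U.exact-at)))
    where
    module T = Two two
    module U = Unique uni

  -- The product of the two minimal monomials stands alone at the sum of the minima. In each of the
  -- two remaining products one factor exceeds its own minimum.
  Unique-* : ∀ {f g} → Unique f → Unique g → Unique (f *ₚ g)
  Unique-* {f} {g} uf ug = record
    { index = F.index + G.index
    ; val = F.val + G.val
    ; coef = F.coef ℚ.* G.coef
    ; isExact = Exact-* F.isExact G.isExact
    ; rest = mf *ₚ G.rest +ₚ F.rest *ₚ g
    ; decomp = begin
        f *ₚ g ≈⟨ *-congˡ g F.decomp ⟩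
        (mf +ₚ F.rest) *ₚ g ≈⟨ *-distribʳ g mf F.rest ⟩
        mf *ₚ g +ₚ F.rest *ₚ g ≈⟨ +-congˡ (F.rest *ₚ g) (≋-trans (*-congʳ mf G.decomp) (distribˡ mf mg G.rest)) ⟩
        (mf *ₚ mg +ₚ mf *ₚ G.rest) +ₚ F.rest *ₚ g ≈⟨ +-assoc (mf *ₚ mg) (mf *ₚ G.rest) (F.rest *ₚ g) ⟩
        mf *ₚ mg +ₚ (mf *ₚ G.rest +ₚ F.rest *ₚ g) ≈⟨ +-congˡ _ (mono-* F.index G.index F.coef G.coef) ⟩
        mono (F.index + G.index) (F.coef ℚ.* G.coef) +ₚ (mf *ₚ G.rest +ₚ F.rest *ₚ g) ∎
    ; rest-V = V-+ {f = mf *ₚ G.rest} {g = F.rest *ₚ g}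
        (V-mono (≤-reflexive weight₁) (V-* mf G.rest (V-mono-poly F.index (Exact⇒Multiple F.isExact)) G.rest-V))
        (V-mono (≤-reflexive weight₂) (V-* F.rest g F.rest-V G.V-min)) }
    where
    module F = Unique uf
    module G = Unique ug
    mf = mono F.index F.coef
    mg = mono G.index G.coef
    open ≋-Reasoning
    open CommutativeRing polyRing using (distribˡ)
    weight₁ : suc (N * (F.val + G.val) + L * (F.index + G.index)) ≡ F.minWt + suc G.minWt
    weight₁ = solve 6 (λ N L v w i j → con 1 :+ (N :* (v :+ w) :+ L :* (i :+ j)) := (N :* v :+ L :* i) :+ (con 1 :+ (N :* w :+ L :* j)))
      refl N L F.val G.val F.index G.index
      where open ℕSolver.+-*-Solver
    weight₂ : suc (N * (F.val + G.val) + L * (F.index + G.index)) ≡ suc F.minWt + G.minWt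
    weight₂ = trans weight₁ (+-suc F.minWt G.minWt)

  private
    Wt-at-0 : ∀ {T e x} → Multiple (p ^ e) x → T ≤ N * e → Wt T 0 x
    Wt-at-0 {e = e} m le = e , m , ≤-trans le (m≤m+n _ _)

    shift-wt : ∀ v i → N * v + L * suc i ≡ N * v + L * i + L
    shift-wt v i = solve 3 (λ n L i → n :+ L :* (con 1 :+ i) := n :+ L :* i :+ L) refl (N * v) L i
      where open ℕSolver.+-*-Solver

    m+n∸n : ∀ {T′ T} → T ≡ T′ + L → T ∸ L ≤ T′
    m+n∸n {T′} refl = ≤-reflexive (ℕP.m+n∸n≡m T′ L)

    shift-Unique : ∀ {a f} (u : Unique f) → Wt (suc (Unique.minWt u + L)) 0 a → Unique (a ∷ f)
    shift-Unique {a} {f} u w = record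
      { index = suc index ; val = val ; coef = coef ; isExact = isExact ; rest = a ∷ rest
      ; decomp = ∷-cong (sym (ℚP.+-identityˡ a)) decomp
      ; rest-V = V-∷ (subst (λ T → Wt (suc T) 0 a) (sym (shift-wt val index)) w)
                     (V-mono (m+n∸n (cong suc (shift-wt val index))) rest-V) }
      where open Unique u

    shift-Two : ∀ {a f} (t : Two f) → Wt (N * Two.e t + L * Two.i t + L) 0 a → Two (a ∷ f)
    shift-Two {a} {f} t w = record
      { i = suc i ; j = suc j ; e = e ; e′ = e′ ; i<j = s≤s i<j ; exact-i = exact-i ; exact-j = exact-j
      ; sameWt = trans (shift-wt e i) (trans (cong (ℕ._+ L) sameWt) (sym (shift-wt e′ j)))
      ; V-min = V-∷ (subst (λ T → Wt T 0 a) (sym (shift-wt e i)) w) (V-mono (m+n∸n (shift-wt e i)) V-min) }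
      where open Two t

    here-Unique : ∀ {a f e T} → Exact e a → V T f → N * e < T + L → Unique (a ∷ f)
    here-Unique {a} {f} {e} {T} ex h lt = record
      { index = 0 ; val = e ; coef = a ; isExact = ex ; rest = 0ℚ ∷ f
      ; decomp = ∷-cong (sym (ℚP.+-identityʳ a)) ≋-refl
      ; rest-V = V-∷ Wt-0 (V-mono (m≤n+o⇒m∸n≤o _ L (≤-trans (≤-reflexive (cong suc
          (trans (cong (N * e ℕ.+_) (*-zeroʳ L)) (ℕP.+-identityʳ _))))
          (≤-trans lt (≤-reflexive (ℕP.+-comm T L))))) h) }

    here-Two : ∀ {a f e} (u : Unique f) → Exact e a → N * e ≡ Unique.minWt u + L → Two (a ∷ f)
    here-Two {a} {f} {e} u ex eq = record
      { i = 0 ; j = suc index ; e = e ; e′ = val ; i<j = s≤s z≤n ; exact-i = ex ; exact-j = exact-at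
      ; sameWt = trans e0 (trans eq (sym (shift-wt val index)))
      ; V-min = V-∷ (e , Exact⇒Multiple ex , ≤-refl) (V-mono (m+n∸n (trans e0 eq)) V-min) }
      where
      open Unique u
      e0 : N * e + L * 0 ≡ N * e
      e0 = trans (cong (N * e ℕ.+_) (*-zeroʳ L)) (ℕP.+-identityʳ _)

    -- Prepending a coefficient raises the minimum of `f` by `L`. Comparing it with the weight N e
    -- of the new constant term decides whether the constant term wins, ties or loses.
    cons-cases : ∀ {a f} → IsInt a → Unique f ⊎ Two f → Unique (a ∷ f) ⊎ Two (a ∷ f)
    cons-cases {a} {f} ia h with a ℚP.≟ 0ℚ
    cons-cases ia (inj₁ u) | yes refl = inj₁ (shift-Unique u Wt-0)
    cons-cases ia (inj₂ t) | yes refl = inj₂ (shift-Two t Wt-0)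
    cons-cases ia h        | no a≢0 with exact ia a≢0
    cons-cases ia (inj₁ u) | no a≢0 | e , ex with <-cmp (N * e) (Unique.minWt u + L)
    ... | tri< lt _ _ = inj₁ (here-Unique ex (Unique.V-min u) lt)
    ... | tri≈ _ eq _ = inj₂ (here-Two u ex eq)
    ... | tri> _ _ gt = inj₁ (shift-Unique u (Wt-at-0 {e = e} (Exact⇒Multiple ex) gt))
    cons-cases ia (inj₂ t) | no a≢0 | e , ex with ℕP.≤-<-connex (N * Two.e t + L * Two.i t + L) (N * e)
    ... | inj₁ le = inj₂ (shift-Two t (Wt-at-0 {e = e} (Exact⇒Multiple ex) le))
    ... | inj₂ lt = inj₁ (here-Unique ex (Two.V-min t) lt)

  unique-or-two : ∀ f → Integral f → ¬ f ≋ [] → Unique f ⊎ Two f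
  unique-or-two []      intf f≢0 = ⊥-elim (f≢0 ≋-refl)
  unique-or-two (a ∷ f) intf f≢0 with ≋0? f
  ... | no ne = cons-cases (intf 0) (unique-or-two f (λ i → intf (suc i)) ne)
  ... | yes f≋0 with exact (intf 0) (λ { refl → f≢0 (≋-trans (∷-cong refl f≋0) 0∷[]≋0) })
  ...   | e , ex = inj₁ (record
      { index = 0 ; val = e ; coef = a ; isExact = ex ; rest = []
      ; decomp = ∷-cong refl f≋0 ; rest-V = V-0 })

  -- Dumas' argument in contrapositive form: if both factors attained their minimum only once, so
  -- would the product.
  Two-factor : ∀ {f g h} → Integral f → Integral g → f *ₚ g ≋ h → Two h → Two f ⊎ Two g
  Two-factor {f} {g} {h} intf intg eq two
    with unique-or-two f intf (*≢0⇒≢0ˡ {f} {g} fg≢0) | unique-or-two g intg (*≢0⇒≢0ʳ {f} {g} fg≢0)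
    where
    fg≢0 : ¬ f *ₚ g ≋ []
    fg≢0 e = Exact⇒≢0 (Two.exact-i two) (at (≋-trans (≋-sym eq) e) (Two.i two))
  ... | inj₂ tf | _       = inj₁ tf
  ... | inj₁ _  | inj₂ tg = inj₂ tg
  ... | inj₁ uf | inj₁ ug = ⊥-elim (Two⇒¬Unique two (Unique-cong eq (Unique-* uf ug)))
    where
    Unique-cong : ∀ {f g} → f ≋ g → Unique f → Unique g
    Unique-cong e u = record { Unique u ; decomp = ≋-trans (≋-sym e) (Unique.decomp u) }

  -- Equal weights give N e = N e′ + L (j - i). By coprimality `N` divides the positive number j -
  -- i, which is at most j and hence at most the degree.
  Two⇒N≤deg : Coprime N L → ∀ {f} → Two f → N ≤ deg f
  Two⇒N≤deg cop {f} two = ≤-trans (ℕD.∣⇒≤ {{ℕ.≢-nonZero (ℕP.m>n⇒m∸n≢0 i<j)}} N∣k)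
      (≤-trans (ℕP.m∸n≤m j i) (coeff≢0⇒≤deg f j (Exact⇒≢0 exact-j)))
    where
    open Two two
    eq : N * e ≡ N * e′ + L * (j ∸ i)
    eq = ℕP.+-cancelʳ-≡ (L * i) _ _ (trans sameWt (trans (cong (λ k → N * e′ + L * k) (sym (ℕP.m∸n+n≡m (<⇒≤ i<j))))
      (solve 4 (λ n L k i → n :+ L :* (k :+ i) := n :+ L :* k :+ L :* i) refl (N * e′) L (j ∸ i) i)))
      where open ℕSolver.+-*-Solver
    N∣k : N ℕD.∣ j ∸ i
    N∣k = coprime-divisor cop (ℕD.∣m+n∣m⇒∣n (subst (N ℕD.∣_) eq (ℕD.m∣m*n e)) (ℕD.m∣m*n e′))

-- Valuations of values

eval-mono : ∀ i c x → eval (mono i c) x ≡ c ℚ.* x ^ℚ i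
eval-mono zero    c x = trans (eval-const c x) (sym (ℚP.*-identityʳ c))
eval-mono (suc i) c x = trans (eval-∷ 0ℚ (mono i c) x) (trans (ℚP.+-identityˡ _)
  (trans (cong (x ℚ.*_) (eval-mono i c x)) (solve 3 (λ x c y → x :* (c :* y) := c :* (x :* y)) refl x c (x ^ℚ i))))
  where open ℚSolver.+-*-Solver

module Evaluation (p : ℕ) (pp : Prime p) (N L : ℕ) {{nz : ℕ.NonZero N}} where
  open Newton p pp N L

  -- The condition L ≤ N j says that the valuation of `x` reaches the slope L / N, so a monomial of
  -- weight at least `T` takes a value of valuation k with T ≤ N k.
  eval-V : ∀ {T x j} f → Multiple (p ^ j) x → L ≤ N * j → V T f →
    Σ ℕ λ k → Multiple (p ^ k) (eval f x) × T ≤ N * k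
  eval-V {T} {x} []      hx L≤ h = T , Multiple-0 , ℕP.m≤n*m T N
  eval-V {T} {x} {j} (a ∷ f) hx L≤ h with wt h 0 | eval-V f hx L≤ (V-tail h)
  ... | k , m , le | k′ , m′ , le′ = min , subst (Multiple (p ^ min)) (sym (eval-∷ a f x))
        (Multiple-+ (Multiple-∣ (^-∣ p (ℕP.m⊓n≤m k (j + k′))) m)
                    (Multiple-∣ (^-∣ p (ℕP.m⊓n≤n k (j + k′))) (subst (λ q → Multiple q (x ℚ.* eval f x)) (sym (^-distribˡ-+-* p j k′)) (Multiple-*₂ hx m′))))
      , subst (T ≤_) (sym (ℕP.*-distribˡ-⊓ N k (j + k′))) (ℕP.⊓-glb
          (≤-trans le (≤-reflexive (trans (cong (N * k ℕ.+_) (*-zeroʳ L)) (ℕP.+-identityʳ _))))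
          (≤-trans (m≤n+m∸n T L) (≤-trans (+-mono-≤ L≤ le′) (≤-reflexive (sym (ℕP.*-distribˡ-+ N j k′))))))
    where min = k ℕ.⊓ (j + k′)

-- If m pᵏ = q b with k positive, then `p` divides q, as it does not divide `b`; cancelling it
-- lowers the exponent by one.
strip-prime-power : ∀ {p} → Prime p → ∀ k {b m} → ¬ (p ℕD.∣ b) → b ℕD.∣ m * p ^ k → b ℕD.∣ m
strip-prime-power         pp zero    {b} {m} p∤b h = subst (b ℕD.∣_) (*-identityʳ m) h
strip-prime-power {p} pp (suc k) {b} {m} p∤b (ℕD.divides q eq) = strip-prime-power pp k p∤b (cancel
    (Sum.[ (λ z → z) , (λ p∣b → ⊥-elim (p∤b p∣b)) ]′ (euclidsLemma q b pp (ℕD.divides (m * p ^ k)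
      (trans (sym eq) (solve 3 (λ m p k → m :* (p :* k) := m :* k :* p) refl m p (p ^ k)))))))
  where
  open ℕSolver.+-*-Solver
  cancel : p ℕD.∣ q → b ℕD.∣ m * p ^ k
  cancel (ℕD.divides q′ q≡) = ℕD.divides q′ (ℕP.*-cancelˡ-≡ (m * p ^ k) (q′ * b) p {{prime⇒nonZero pp}}
    (trans (solve 3 (λ m p k → p :* (m :* k) := m :* (p :* k)) refl m p (p ^ k))
      (trans eq (trans (cong (ℕ._* b) q≡) (solve 3 (λ q p b → q :* p :* b := p :* (q :* b)) refl q′ p b)))))

-- Bounding the coefficients of an integral polynomial by its values at consecutive integers

evalℤ : List ℤ → ℤ → ℤ
evalℤ []      x = ℤ.0ℤ
evalℤ (a ∷ f) x = a ℤ.+ x ℤ.* evalℤ f x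

toPoly : List ℤ → Poly
toPoly = List.map ι

eval-toPoly : ∀ f x → eval (toPoly f) (ι x) ≡ ι (evalℤ f x)
eval-toPoly []      x = sym ι-0
eval-toPoly (a ∷ f) x = begin
  eval (toPoly (a ∷ f)) (ι x) ≡⟨ eval-∷ (ι a) (toPoly f) (ι x) ⟩
  ι a ℚ.+ ι x ℚ.* eval (toPoly f) (ι x) ≡⟨ cong (λ y → ι a ℚ.+ ι x ℚ.* y) (eval-toPoly f x) ⟩
  ι a ℚ.+ ι x ℚ.* ι (evalℤ f x) ≡⟨ cong (ι a ℚ.+_) (ι-* x (evalℤ f x)) ⟨
  ι a ℚ.+ ι (x ℤ.* evalℤ f x) ≡⟨ ι-+ a _ ⟨
  ι (a ℤ.+ x ℤ.* evalℤ f x) ∎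
  where open ≡-Reasoning

-- Synthetic division by x - M, whose remainder is the value at `M`.
quotient : ℤ → List ℤ → List ℤ
quotient M []          = []
quotient M (a ∷ [])    = []
quotient M (a ∷ b ∷ f) = evalℤ (b ∷ f) M ∷ quotient M (b ∷ f)

quotient-eval : ∀ M f x → evalℤ f x ≡ evalℤ f M ℤ.+ (x ℤ.- M) ℤ.* evalℤ (quotient M f) x
quotient-eval M []          x = solve 2 (λ x M → con ℤ.0ℤ := con ℤ.0ℤ :+ (x :- M) :* con ℤ.0ℤ) refl x M
  where open ℤSolver.+-*-Solver
quotient-eval M (a ∷ [])    x = solve 3 (λ a x M → a :+ x :* con ℤ.0ℤ
    := (a :+ M :* con ℤ.0ℤ) :+ (x :- M) :* con ℤ.0ℤ) refl a x M
  where open ℤSolver.+-*-Solver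
quotient-eval M (a ∷ b ∷ f) x = begin
  a ℤ.+ x ℤ.* evalℤ (b ∷ f) x
    ≡⟨ cong (λ y → a ℤ.+ x ℤ.* y) (quotient-eval M (b ∷ f) x) ⟩
  a ℤ.+ x ℤ.* (evalℤ (b ∷ f) M ℤ.+ (x ℤ.- M) ℤ.* evalℤ (quotient M (b ∷ f)) x)
    ≡⟨ solve 5 (λ a x M e q → a :+ x :* (e :+ (x :- M) :* q) := (a :+ M :* e) :+ (x :- M) :* (e :+ x :* q))
         refl a x M (evalℤ (b ∷ f) M) (evalℤ (quotient M (b ∷ f)) x) ⟩
  (a ℤ.+ M ℤ.* evalℤ (b ∷ f) M) ℤ.+ (x ℤ.- M) ℤ.* (evalℤ (b ∷ f) M ℤ.+ x ℤ.* evalℤ (quotient M (b ∷ f)) x)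
    ∎
  where
  open ≡-Reasoning
  open ℤSolver.+-*-Solver

Bounded : ℕ → List ℤ → Set
Bounded B = All λ a → ℤ.∣ a ∣ ≤ B

length-quotient : ∀ M f {n} → length f ≤ suc n → length (quotient M f) ≤ n
length-quotient M []          h       = z≤n
length-quotient M (a ∷ [])    h       = z≤n
length-quotient M (a ∷ b ∷ f) {suc n} (s≤s h) = s≤s (length-quotient M (b ∷ f) h)

∣a∣≤∣a+b∣+∣b∣ : ∀ a b → ℤ.∣ a ∣ ≤ ℤ.∣ a ℤ.+ b ∣ + ℤ.∣ b ∣
∣a∣≤∣a+b∣+∣b∣ a b = subst (λ z → ℤ.∣ z ∣ ≤ ℤ.∣ a ℤ.+ b ∣ + ℤ.∣ b ∣)
  (solve 2 (λ a b → a :+ b :- b := a) refl a b) (ℤP.∣i-j∣≤∣i∣+∣j∣ (a ℤ.+ b) b)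
  where open ℤSolver.+-*-Solver

-- Horner's scheme read backwards: each coefficient is a number produced by the scheme minus `M`
-- times the next one. The bound `K` of the remainder serves for the first coefficient; afterwards
-- `B` takes its place.
quotient-bound : ∀ M f {K B B′} → ℤ.∣ evalℤ f M ∣ ≤ K → Bounded B (quotient M f) →
  K + ℤ.∣ M ∣ * B ≤ B′ → B + ℤ.∣ M ∣ * B ≤ B′ → Bounded B′ f
quotient-bound M []          hK hB h h′ = []
quotient-bound M (a ∷ [])    {K} hK hB h h′ = ≤-trans (subst (λ z → ℤ.∣ z ∣ ≤ K)
  (trans (cong (λ y → a ℤ.+ y) (ℤP.*-zeroʳ M)) (ℤP.+-identityʳ a)) hK) (≤-trans (m≤m+n K _) h) ∷ []
quotient-bound M (a ∷ b ∷ f) {K} {B} {B′} hK (he ∷ hB) h h′ = (begin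
    ℤ.∣ a ∣ ≤⟨ ∣a∣≤∣a+b∣+∣b∣ a (M ℤ.* e) ⟩
    ℤ.∣ a ℤ.+ M ℤ.* e ∣ + ℤ.∣ M ℤ.* e ∣ ≤⟨ +-mono-≤ hK (≤-reflexive (ℤP.abs-* M e)) ⟩
    K + ℤ.∣ M ∣ * ℤ.∣ e ∣ ≤⟨ +-monoʳ-≤ K (*-monoʳ-≤ ℤ.∣ M ∣ he) ⟩
    K + ℤ.∣ M ∣ * B ≤⟨ h ⟩
    B′ ∎)
  ∷ quotient-bound M (b ∷ f) he hB h′ h′
  where
  e = evalℤ (b ∷ f) M
  open ℕP.≤-Reasoning

-- After division by x - M the values at the remaining points are difference quotients of values of
-- `f`, so they are at most 2 K in absolute value; this gives an induction on the number of points.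
coeff-bound : ∀ n M K → Σ ℕ λ B → ∀ f → length f ≤ n →
  (∀ j → j < n → ℤ.∣ evalℤ f (+ (M + j)) ∣ ≤ K) → Bounded B f
coeff-bound zero    M K = 0 , λ { [] h v → [] }
coeff-bound (suc n) M K with coeff-bound n (suc M) (K + K)
... | B , ih = K + B + M * B , λ f h v →
    quotient-bound (+ M) f (at-M f v) (ih (quotient (+ M) f) (length-quotient (+ M) f h) (values f v))
      (+-monoˡ-≤ (M * B) (m≤m+n K B)) (+-monoˡ-≤ (M * B) (m≤n+m B K))
  where
  module _ (f : List ℤ) (v : ∀ j → j < suc n → ℤ.∣ evalℤ f (+ (M + j)) ∣ ≤ K) where
    at-M : ℤ.∣ evalℤ f (+ M) ∣ ≤ K
    at-M = subst (λ x → ℤ.∣ evalℤ f (+ x) ∣ ≤ K) (ℕP.+-identityʳ M) (v 0 (s≤s z≤n))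

    values : ∀ j → j < n → ℤ.∣ evalℤ (quotient (+ M) f) (+ (suc M + j)) ∣ ≤ K + K
    values j j<n = begin
      -- The denominator of the difference quotient is j + 1, and multiplying by it only enlarges
      -- the absolute value.
      ℤ.∣ q ∣ ≤⟨ ℕP.m≤n*m ℤ.∣ q ∣ (suc j) ⟩
      suc j * ℤ.∣ q ∣ ≡⟨ ℤP.abs-* (+ suc j) q ⟨
      ℤ.∣ + suc j ℤ.* q ∣ ≡⟨ cong (λ z → ℤ.∣ z ∣) difference ⟩
      ℤ.∣ evalℤ f x ℤ.- evalℤ f (+ M) ∣ ≤⟨ ℤP.∣i-j∣≤∣i∣+∣j∣ (evalℤ f x) (evalℤ f (+ M)) ⟩
      ℤ.∣ evalℤ f x ∣ + ℤ.∣ evalℤ f (+ M) ∣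
        ≤⟨ +-mono-≤ (subst (λ y → ℤ.∣ evalℤ f (+ y) ∣ ≤ K) (+-suc M j) (v (suc j) (s≤s j<n))) at-M ⟩
      K + K ∎
      where
      open ℕP.≤-Reasoning
      open ℤSolver.+-*-Solver
      x = + (suc M + j)
      q = evalℤ (quotient (+ M) f) x
      x-M : x ≡ + suc j ℤ.+ + M
      x-M = cong +_ (trans (sym (+-suc M j)) (ℕP.+-comm M (suc j)))
      difference : + suc j ℤ.* q ≡ evalℤ f x ℤ.- evalℤ f (+ M)
      difference = trans
        (trans (solve 4 (λ j q M e → j :* q := (e :+ ((j :+ M) :- M) :* q) :- e) refl (+ suc j) q (+ M) (evalℤ f (+ M)))
               (cong (λ z → (evalℤ f (+ M) ℤ.+ (z ℤ.- + M) ℤ.* q) ℤ.- evalℤ f (+ M)) (sym x-M)))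
        (cong (ℤ._- evalℤ f (+ M)) (sym (quotient-eval (+ M) f x)))

-- The first nonzero coefficient a of f, say of degree k, satisfies f(x)/xᵏ ≡ a mod x.
nonvanishing : ∀ f → ¬ toPoly f ≋ [] → Σ ℕ λ B → ∀ x → B < x → evalℤ f (+ x) ≢ ℤ.0ℤ
nonvanishing []      f≢0 = ⊥-elim (f≢0 ≋-refl)
nonvanishing (a ∷ f) f≢0 with a ℤ.≟ ℤ.0ℤ
... | no a≢0 = ℤ.∣ a ∣ , λ x B<x eq → <⇒≱ B<x
    (ℕD.∣⇒≤ {{ℕ.≢-nonZero λ z → a≢0 (ℤP.∣i∣≡0⇒i≡0 z)}} (ℕD.divides ℤ.∣ evalℤ f (+ x) ∣ (begin
      ℤ.∣ a ∣ ≡⟨ cong (λ z → ℤ.∣ z ∣) (solve 2 (λ a y → a := (a :+ y) :- y) refl a (+ x ℤ.* evalℤ f (+ x))) ⟩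
      ℤ.∣ (a ℤ.+ + x ℤ.* evalℤ f (+ x)) ℤ.- + x ℤ.* evalℤ f (+ x) ∣
                                      ≡⟨ cong (λ z → ℤ.∣ z ℤ.- + x ℤ.* evalℤ f (+ x) ∣) eq ⟩
      ℤ.∣ ℤ.0ℤ ℤ.- + x ℤ.* evalℤ f (+ x) ∣ ≡⟨ cong (λ z → ℤ.∣ z ∣) (ℤP.+-identityˡ (ℤ.- (+ x ℤ.* evalℤ f (+ x)))) ⟩
      ℤ.∣ ℤ.- (+ x ℤ.* evalℤ f (+ x)) ∣ ≡⟨ ℤP.∣-i∣≡∣i∣ (+ x ℤ.* evalℤ f (+ x)) ⟩
      ℤ.∣ + x ℤ.* evalℤ f (+ x) ∣ ≡⟨ ℤP.abs-* (+ x) _ ⟩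
      x * ℤ.∣ evalℤ f (+ x) ∣ ≡⟨ ℕP.*-comm x _ ⟩
      ℤ.∣ evalℤ f (+ x) ∣ * x ∎)))
  where
  open ≡-Reasoning
  open ℤSolver.+-*-Solver
... | yes refl with nonvanishing f (λ e → f≢0 (≋-trans (∷-cong ι-0 e) 0∷[]≋0))
...   | B , h = B , λ { (suc x) B<x eq → h (suc x) B<x
    (Sum.[ (λ ()) , (λ z → z) ]′ (ℤP.i*j≡0⇒i≡0∨j≡0 (+ suc x) (trans (sym (ℤP.+-identityˡ _)) eq))) }

-- Kronecker's decision procedure

≋? : ∀ p q → Dec (p ≋ q)
≋? []      q       = map′ ≋-sym ≋-sym (≋0? q)
≋? (a ∷ p) []      = ≋0? (a ∷ p)
≋? (a ∷ p) (b ∷ q) = map′ (λ { (e , e′) → ∷-cong e e′ }) (λ e → at e 0 , mk≋ λ i → at e (suc i))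
  (a ℚP.≟ b ×-dec ≋? p q)

search-ℤ : ∀ B {P : ℤ → Set} → (∀ a → Dec (P a)) → Dec (Σ ℤ λ a → ℤ.∣ a ∣ ≤ B × P a)
search-ℤ B {P} P? = map′ to from (ℕP.anyUpTo? (λ n → P? (+ n) ⊎-dec P? (ℤ.- + n)) (suc B))
  where
  to : (Σ ℕ λ n → n < suc B × (P (+ n) ⊎ P (ℤ.- + n))) → Σ ℤ λ a → ℤ.∣ a ∣ ≤ B × P a
  to (n , s≤s h , inj₁ pn) = + n , h , pn
  to (n , s≤s h , inj₂ pn) = ℤ.- + n , subst (_≤ B) (sym (ℤP.∣-i∣≡∣i∣ (+ n))) h , pn
  from : (Σ ℤ λ a → ℤ.∣ a ∣ ≤ B × P a) → Σ ℕ λ n → n < suc B × (P (+ n) ⊎ P (ℤ.- + n))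
  from (+ n , h , pn)        = n , s≤s h , inj₁ pn
  from (ℤ.-[1+ n ] , h , pn) = suc n , s≤s h , inj₂ pn

search : ∀ n B {P : List ℤ → Set} → (∀ f → Dec (P f)) →
  Dec (Σ (List ℤ) λ f → length f ≤ n × Bounded B f × P f)
search zero    B P? = map′ (λ p → [] , z≤n , [] , p) (λ { ([] , _ , _ , p) → p }) (P? [])
search (suc n) B {P} P? = map′ to from
  (P? [] ⊎-dec search-ℤ B (λ a → search n B (λ f → P? (a ∷ f))))
  where
  to : P [] ⊎ (Σ ℤ λ a → ℤ.∣ a ∣ ≤ B × Σ (List ℤ) λ f → length f ≤ n × Bounded B f × P (a ∷ f)) →
    Σ (List ℤ) λ f → length f ≤ suc n × Bounded B f × P f
  to (inj₁ p)                       = [] , z≤n , [] , p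
  to (inj₂ (a , ha , f , l , b , p)) = a ∷ f , s≤s l , ha ∷ b , p
  from : (Σ (List ℤ) λ f → length f ≤ suc n × Bounded B f × P f) →
    P [] ⊎ (Σ ℤ λ a → ℤ.∣ a ∣ ≤ B × Σ (List ℤ) λ f → length f ≤ n × Bounded B f × P (a ∷ f))
  from ([] , _ , _ , p)                = inj₁ p
  from (a ∷ f , s≤s l , ha ∷ b , p)    = inj₂ (a , ha , f , l , b , p)

-- A list may carry arbitrarily many trailing zeros, while the search runs through lists of bounded
-- length only.
truncate : ∀ n f → Integral f → (∀ i → n ≤ i → coeff f i ≡ 0ℚ) →
  Σ (List ℤ) λ zs → length zs ≤ n × toPoly zs ≋ f
truncate zero    f       intf h = [] , z≤n , mk≋ λ i → sym (h i z≤n)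
truncate (suc n) []      intf h = [] , z≤n , ≋-refl
truncate (suc n) (a ∷ f) intf h with truncate n f (λ i → intf (suc i)) (λ i le → h (suc i) (s≤s le)) | intf 0
... | zs , l , e | z , eq = z ∷ zs , s≤s l , ∷-cong (sym eq) e

toPoly-integral : ∀ zs → Integral (toPoly zs)
toPoly-integral []       i       = ℤ.0ℤ , sym ι-0
toPoly-integral (z ∷ zs) zero    = z , refl
toPoly-integral (z ∷ zs) (suc i) = toPoly-integral zs i

record ProperFactors (Q : Poly) : Set where
  field
    f g : Poly
    f-int : Integral f
    g-int : Integral g
    fg≋Q : f *ₚ g ≋ Q
    f-nonconst : deg f ≢ 0
    g-nonconst : deg g ≢ 0

module _ (Q : Poly) (intQ : Integral Q) (Q≢0 : ¬ Q ≋ []) where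
  private
    n = suc (deg Q)
    tQ = truncate n Q intQ (above (DegLE-deg Q))
    zQ = proj₁ tQ
    zQ≋Q = proj₂ (proj₂ tQ)
    nv = nonvanishing zQ (λ e → Q≢0 (≋-trans (≋-sym zQ≋Q) e))
    M = suc (proj₁ nv)

    total : ℕ → ℕ
    total zero    = 0
    total (suc k) = ℤ.∣ evalℤ zQ (+ (M + k)) ∣ + total k

    ≤total : ∀ k j → j < k → ℤ.∣ evalℤ zQ (+ (M + j)) ∣ ≤ total k
    ≤total (suc k) j j<k with ℕP.m≤n⇒m<n∨m≡n (≤-pred j<k)
    ... | inj₁ lt   = ≤-trans (≤total k j lt) (m≤n+m (total k) _)
    ... | inj₂ refl = m≤m+n _ (total k)

    B = proj₁ (coeff-bound n M (total n))

    -- The sample points start at `M`, beyond all zeros of `Q` among the natural numbers. There the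
    -- value of a factor divides a nonzero integer, which bounds it, and `coeff-bound` passes from
    -- values to coefficients.
    factor-bounded : ∀ zf zg → length zf ≤ n → toPoly zf *ₚ toPoly zg ≋ Q → Bounded B zf
    factor-bounded zf zg l e = proj₂ (coeff-bound n M (total n)) zf l λ j j<n →
      ≤-trans (values j) (≤total n j j<n)
      where
      evalℤ-product : ∀ x → evalℤ zf x ℤ.* evalℤ zg x ≡ evalℤ zQ x
      evalℤ-product x = ι-injective (begin
        ι (evalℤ zf x ℤ.* evalℤ zg x) ≡⟨ ι-* (evalℤ zf x) (evalℤ zg x) ⟩
        ι (evalℤ zf x) ℚ.* ι (evalℤ zg x) ≡⟨ cong₂ ℚ._*_ (eval-toPoly zf x) (eval-toPoly zg x) ⟨
        eval (toPoly zf) (ι x) ℚ.* eval (toPoly zg) (ι x) ≡⟨ eval-* (toPoly zf) (toPoly zg) (ι x) ⟨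
        eval (toPoly zf *ₚ toPoly zg) (ι x) ≡⟨ eval-cong (ι x) (≋-trans e (≋-sym zQ≋Q)) ⟩
        eval (toPoly zQ) (ι x) ≡⟨ eval-toPoly zQ x ⟩
        ι (evalℤ zQ x) ∎)
        where open ≡-Reasoning

      values : ∀ j → ℤ.∣ evalℤ zf (+ (M + j)) ∣ ≤ ℤ.∣ evalℤ zQ (+ (M + j)) ∣
      values j = ℕD.∣⇒≤ {{ℕ.≢-nonZero λ z → proj₂ nv (M + j) (m≤m+n M j) (ℤP.∣i∣≡0⇒i≡0 z)}}
        (ℕD.divides ℤ.∣ evalℤ zg x ∣ (trans (cong (λ z → ℤ.∣ z ∣) (sym (evalℤ-product x)))
          (trans (ℤP.abs-* (evalℤ zf x) (evalℤ zg x)) (ℕP.*-comm ℤ.∣ evalℤ zf x ∣ _))))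
        where x = + (M + j)

    IsFactorPair : List ℤ → List ℤ → Set
    IsFactorPair zf zg = toPoly zf *ₚ toPoly zg ≋ Q × deg (toPoly zf) ≢ 0 × deg (toPoly zg) ≢ 0

  properFactors? : Dec (ProperFactors Q)
  properFactors? = map′ to from (search n B λ zf → search n B λ zg →
      ≋? (toPoly zf *ₚ toPoly zg) Q ×-dec (¬? (deg (toPoly zf) ℕP.≟ 0) ×-dec ¬? (deg (toPoly zg) ℕP.≟ 0)))
    where
    Found = Σ (List ℤ) λ zf → length zf ≤ n × Bounded B zf × Σ (List ℤ) λ zg → length zg ≤ n × Bounded B zg × IsFactorPair zf zg

    to : Found → ProperFactors Q
    to (zf , _ , _ , zg , _ , _ , e , hf , hg) = record
      { f = toPoly zf ; g = toPoly zg ; f-int = toPoly-integral zf ; g-int = toPoly-integral zg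
      ; fg≋Q = e ; f-nonconst = hf ; g-nonconst = hg }

    from : ProperFactors Q → Found
    from F = proj₁ tf , proj₁ (proj₂ tf) , factor-bounded (proj₁ tf) (proj₁ tg) (proj₁ (proj₂ tf)) e
           , proj₁ tg , proj₁ (proj₂ tg) , factor-bounded (proj₁ tg) (proj₁ tf) (proj₁ (proj₂ tg)) (≋-trans (*-comm (toPoly (proj₁ tg)) _) e)
           , e , (λ z → f-nonconst (trans (deg-cong (≋-sym ef)) z)) , (λ z → g-nonconst (trans (deg-cong (≋-sym eg)) z))
      where
      open ProperFactors F
      f≢0 = *≢0⇒≢0ˡ {f} {g} λ e → Q≢0 (≋-trans (≋-sym fg≋Q) e)
      g≢0 = *≢0⇒≢0ʳ {f} {g} λ e → Q≢0 (≋-trans (≋-sym fg≋Q) e)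
      degQ : deg Q ≡ deg f + deg g
      degQ = trans (deg-cong (≋-sym fg≋Q)) (deg-* f≢0 g≢0)
      tf = truncate n f f-int (λ i le → above (DegLE-deg f) i (≤-trans (s≤s (subst (deg f ≤_) (sym degQ) (m≤m+n _ _))) le))
      tg = truncate n g g-int (λ i le → above (DegLE-deg g) i (≤-trans (s≤s (subst (deg g ≤_) (sym degQ) (m≤n+m _ _))) le))
      ef = proj₂ (proj₂ tf)
      eg = proj₂ (proj₂ tg)
      e : toPoly (proj₁ tf) *ₚ toPoly (proj₁ tg) ≋ Q
      e = ≋-trans (*-cong ef eg) fg≋Q

  -- By Gauss's lemma a factorisation over ℚ yields an integral one with the same degrees, so
  -- excluding integral factors suffices.
  irreducible-if : deg Q ≢ 0 → ¬ ProperFactors Q → IrreducibleQ Q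
  irreducible-if deg≢0 none = (λ e → Q≢0 (mk≋ e)) , (λ u → deg≢0 (proj₁ u)) , λ f g e → go f g (mk≋ e)
    where
    go : ∀ f g → f *ₚ g ≋ Q → IsUnitₚ f ⊎ IsUnitₚ g
    go f g e with deg f ℕP.≟ 0 | deg g ℕP.≟ 0
    ... | yes z | _     = inj₁ (z , λ h → *≢0⇒≢0ˡ {f} {g} (λ e′ → Q≢0 (≋-trans (≋-sym e) e′)) (mk≋ h))
    ... | no _  | yes z = inj₂ (z , λ h → *≢0⇒≢0ʳ {f} {g} (λ e′ → Q≢0 (≋-trans (≋-sym e) e′)) (mk≋ h))
    ... | no f≢ | no g≢ = ⊥-elim (none (record
        { f = f′ ; g = g′ ; f-int = f′-int ; g-int = g′-int ; fg≋Q = f′*g′≋Q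
        ; f-nonconst = λ z → f≢ (trans (∼⇒deg≡ f∼f′) z) ; g-nonconst = λ z → g≢ (trans (∼⇒deg≡ g∼g′) z) }))
      where open IntegralFactors (gauss f g intQ e)

  irreducible-or-factors : deg Q ≢ 0 → IrreducibleQ Q ⊎ ProperFactors Q
  irreducible-or-factors deg≢0 = go properFactors?
    where
    go : Dec (ProperFactors Q) → IrreducibleQ Q ⊎ ProperFactors Q
    go (yes F) = inj₂ F
    go (no h)  = inj₁ (irreducible-if deg≢0 h)

-- Descent to an irreducible factor

record IrreducibleFactor (S : Poly → Set) (Q : Poly) : Set where
  field
    factor      : Poly
    irreducible : IrreducibleQ factor
    S-factor    : S factor
    cofactor    : Poly
    divides-Q   : factor *ₚ cofactor ≋ Q

module _ (S : Poly → Set)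
         (S-nonconst : ∀ {f} → S f → deg f ≢ 0)
         (S-factor : ∀ {f g h} → Integral f → Integral g → f *ₚ g ≋ h → S h → S f ⊎ S g) where

  private
    -- One of two proper factors inherits `S`, and its degree is smaller because the other is not
    -- constant; `k` bounds the degree.
    descend : ∀ k Q → deg Q ≤ k → Integral Q → S Q → IrreducibleFactor S Q
    descend zero    Q le iQ sQ = ⊥-elim (S-nonconst sQ (n≤0⇒n≡0 le))
    descend (suc k) Q le iQ sQ = Sum.[ done , split ]′
        (irreducible-or-factors Q iQ (λ e → S-nonconst sQ (≋0⇒deg≡0 e)) (S-nonconst sQ))
      where
      done : IrreducibleQ Q → IrreducibleFactor S Q
      done irr = record { factor = Q ; irreducible = irr ; S-factor = sQ ; cofactor = const 1ℚ
                            ; divides-Q = ≋-trans (*-comm Q (const 1ℚ)) (≋-trans (const-* 1ℚ Q) (1·-identity Q)) }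
      split : ProperFactors Q → IrreducibleFactor S Q
      split F = go (S-factor f-int g-int fg≋Q sQ)
        where
        open ProperFactors F
        fg≢0 : ¬ f *ₚ g ≋ []
        fg≢0 e = S-nonconst sQ (≋0⇒deg≡0 (≋-trans (≋-sym fg≋Q) e))
        degQ : deg f + deg g ≤ suc k
        degQ = subst (_≤ suc k) (trans (deg-cong (≋-sym fg≋Q)) (deg-* (*≢0⇒≢0ˡ {f} {g} fg≢0) (*≢0⇒≢0ʳ {f} {g} fg≢0))) le
        go : S f ⊎ S g → IrreducibleFactor S Q
        go (inj₁ sf) = record { factor = factor ; irreducible = irreducible ; S-factor = sf′ ; cofactor = cofactor *ₚ g
            ; divides-Q = ≋-trans (≋-sym (*-assoc factor cofactor g)) (≋-trans (*-congˡ g divides-Q) fg≋Q) }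
          where
          open IrreducibleFactor (descend k f (≤-pred (≤-trans (ℕP.m<m+n (deg f) (ℕP.n≢0⇒n>0 g-nonconst)) degQ)) f-int sf)
            renaming (S-factor to sf′)
        go (inj₂ sg) = record { factor = factor ; irreducible = irreducible ; S-factor = sg′ ; cofactor = cofactor *ₚ f
            ; divides-Q = ≋-trans (≋-sym (*-assoc factor cofactor f)) (≋-trans (*-congˡ f divides-Q) (≋-trans (*-comm g f) fg≋Q)) }
          where
          open IrreducibleFactor (descend k g (≤-pred (≤-trans (ℕP.m<n+m (deg g) (ℕP.n≢0⇒n>0 f-nonconst)) degQ)) g-int sg)
            renaming (S-factor to sg′)

  irreducibleFactor : ∀ Q → Integral Q → S Q → IrreducibleFactor S Q
  irreducibleFactor Q = descend (deg Q) Q ≤-refl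

-- Binomial expansions

nC0≡1 : ∀ n → n C 0 ≡ 1
nC0≡1 zero    = refl
nC0≡1 (suc n) = refl

[k+1]*[n+1]C[k+1] : ∀ n k → suc k * (suc n C suc k) ≡ suc n * (n C k)
[k+1]*[n+1]C[k+1] zero    zero    = refl
[k+1]*[n+1]C[k+1] zero    (suc k) = trans (cong (suc (suc k) ℕ.*_) (k>n⇒nCk≡0 (s≤s (s≤s (z≤n {k})))))
  (trans (*-zeroʳ (suc (suc k))) (sym (trans (*-identityˡ (0 C suc k)) (k>n⇒nCk≡0 (s≤s (z≤n {k}))))))
[k+1]*[n+1]C[k+1] (suc n) zero    = begin
  1 * (suc (suc n) C 1) ≡⟨ *-identityˡ _ ⟩
  suc (suc n) C 1 ≡⟨ nC1≡n (suc (suc n)) ⟩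
  suc (suc n) ≡⟨ *-identityʳ _ ⟨
  suc (suc n) * 1 ≡⟨ cong (suc (suc n) ℕ.*_) (nC0≡1 (suc n)) ⟨
  suc (suc n) * (suc n C 0) ∎
  where open ≡-Reasoning
[k+1]*[n+1]C[k+1] (suc n) (suc k) = begin
  suc (suc k) * (suc (suc n) C suc (suc k))
    ≡⟨ cong (suc (suc k) ℕ.*_) (nCk+nC[k+1]≡[n+1]C[k+1] (suc n) (suc k)) ⟨
  suc (suc k) * ((suc n C suc k) + (suc n C suc (suc k)))
    ≡⟨ solve 3 (λ k a b → (con 1 :+ k) :* (a :+ b) := k :* a :+ a :+ (con 1 :+ k) :* b) refl (suc k) (suc n C suc k) (suc n C suc (suc k)) ⟩
  suc k * (suc n C suc k) + (suc n C suc k) + suc (suc k) * (suc n C suc (suc k))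
    ≡⟨ cong₂ (λ a b → a + (suc n C suc k) + b) ([k+1]*[n+1]C[k+1] n k) ([k+1]*[n+1]C[k+1] n (suc k)) ⟩
  suc n * (n C k) + (suc n C suc k) + suc n * (n C suc k)
    ≡⟨ solve 4 (λ n a b c → n :* a :+ c :+ n :* b := c :+ n :* (a :+ b)) refl (suc n) (n C k) (n C suc k) (suc n C suc k) ⟩
  (suc n C suc k) + suc n * ((n C k) + (n C suc k))
    ≡⟨ cong (λ z → (suc n C suc k) + suc n * z) (nCk+nC[k+1]≡[n+1]C[k+1] n k) ⟩
  suc (suc n) * (suc n C suc k)
    ∎
  where
  open ≡-Reasoning
  open ℕSolver.+-*-Solver

-- In the identity (k+1) C(p, k+1) = p C(p-1, k) the prime divides the right side but not k+1.
prime∣C : ∀ {p} → Prime p → ∀ k → suc k < p → p ℕD.∣ p C suc k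
prime∣C {suc p} pp k lt = Sum.[ (λ h → ⊥-elim (<⇒≱ lt (ℕD.∣⇒≤ h))) , (λ h → h) ]′
  (euclidsLemma (suc k) (suc p C suc k) pp (ℕD.divides (p C k)
    (trans ([k+1]*[n+1]C[k+1] p k) (ℕP.*-comm (suc p) (p C k)))))

-- homSum f Y Z k = Σ_{j ≤ k} f(j) Zʲ Yᵏ⁻ʲ
homSum : (ℕ → ℕ) → Poly → Poly → ℕ → Poly
homSum f Y Z zero    = const (ι (+ f 0))
homSum f Y Z (suc k) = const (ι (+ f 0)) *ₚ Y ^ₚ suc k +ₚ Z *ₚ homSum (λ j → f (suc j)) Y Z k

homSum-ext : ∀ {f g} Y Z k → (∀ j → f j ≡ g j) → homSum f Y Z k ≋ homSum g Y Z k
homSum-ext Y Z zero    h = const-cong (cong (λ z → ι (+ z)) (h 0))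
homSum-ext Y Z (suc k) h = +-cong (*-congˡ _ (const-cong (cong (λ z → ι (+ z)) (h 0))))
  (*-congʳ Z (homSum-ext Y Z k (λ j → h (suc j))))

private
  const-ι-+ : ∀ a b → const (ι (+ (a + b))) ≋ const (ι (+ a)) +ₚ const (ι (+ b))
  const-ι-+ a b = const-cong (ι-+ (+ a) (+ b))

homSum-+ : ∀ f g Y Z k → homSum (λ j → f j + g j) Y Z k ≋ homSum f Y Z k +ₚ homSum g Y Z k
homSum-+ f g Y Z zero    = const-ι-+ (f 0) (g 0)
homSum-+ f g Y Z (suc k) = ≋-trans
  (+-cong (*-congˡ (Y ^ₚ suc k) (const-ι-+ (f 0) (g 0))) (*-congʳ Z (homSum-+ (λ j → f (suc j)) (λ j → g (suc j)) Y Z k)))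
  (solve 6 (λ a b y z s t → (a :+ b) :* y :+ z :* (s :+ t) := (a :* y :+ z :* s) :+ (b :* y :+ z :* t)) ≋-refl
    (const (ι (+ f 0))) (const (ι (+ g 0))) (Y ^ₚ suc k) Z (homSum _ Y Z k) (homSum _ Y Z k))
  where open PolySolver

-- The sum on the right has one more term, which the hypothesis on `f` kills.
*-homSum : ∀ f Y Z k → f (suc k) ≡ 0 → Y *ₚ homSum f Y Z k ≋ homSum f Y Z (suc k)
*-homSum f Y Z zero    f≡0 = ≋-trans
  (solve 3 (λ y z a → y :* a := a :* (y :* con 1ℚ) :+ z :* con 0ℚ) ≋-refl Y Z (const (ι (+ f 0))))
  (+-congʳ (const (ι (+ f 0)) *ₚ Y ^ₚ 1) (*-congʳ Z (const-cong (trans (sym ι-0) (cong (λ z → ι (+ z)) (sym f≡0))))))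
  where open PolySolver
*-homSum f Y Z (suc k) f≡0 = ≋-trans
  (solve 5 (λ y z a p t → y :* (a :* p :+ z :* t) := a :* (y :* p) :+ z :* (y :* t)) ≋-refl
     Y Z (const (ι (+ f 0))) (Y ^ₚ suc k) (homSum (λ j → f (suc j)) Y Z k))
  (+-congʳ (const (ι (+ f 0)) *ₚ Y ^ₚ suc (suc k)) (*-congʳ Z (*-homSum (λ j → f (suc j)) Y Z k f≡0)))
  where open PolySolver

binomial : ∀ Y Z k → (Y +ₚ Z) ^ₚ k ≋ homSum (k C_) Y Z k
binomial Y Z zero    = const-cong (sym ι-1)
binomial Y Z (suc k) = begin
  (Y +ₚ Z) *ₚ (Y +ₚ Z) ^ₚ k ≈⟨ *-congʳ (Y +ₚ Z) (binomial Y Z k) ⟩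
  (Y +ₚ Z) *ₚ h ≈⟨ *-distribʳ h Y Z ⟩
  Y *ₚ h +ₚ Z *ₚ h ≈⟨ +-congˡ (Z *ₚ h) (*-homSum (k C_) Y Z k (k>n⇒nCk≡0 (ℕP.n<1+n k))) ⟩
  (const (ι (+ (k C 0))) *ₚ Y ^ₚ suc k +ₚ Z *ₚ h₁) +ₚ Z *ₚ h
    ≈⟨ solve 4 (λ a z s t → (a :+ z :* s) :+ z :* t := a :+ z :* (t :+ s)) ≋-refl (const (ι (+ (k C 0))) *ₚ Y ^ₚ suc k) Z h₁ h ⟩
  const (ι (+ (k C 0))) *ₚ Y ^ₚ suc k +ₚ Z *ₚ (h +ₚ h₁)
    ≈⟨ +-cong (*-congˡ (Y ^ₚ suc k) (const-cong (cong (λ z → ι (+ z)) (trans (nC0≡1 k) (sym (nC0≡1 (suc k)))))))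
              (*-congʳ Z (≋-trans (≋-sym (homSum-+ (k C_) (λ j → k C suc j) Y Z k))
                                  (homSum-ext Y Z k (nCk+nC[k+1]≡[n+1]C[k+1] k)))) ⟩
  homSum (suc k C_) Y Z (suc k) ∎
  where
  open ≋-Reasoning
  open PolySolver
  h  = homSum (k C_) Y Z k
  h₁ = homSum (λ j → k C suc j) Y Z k

-- This is ((Y + Z)ᵏ⁺¹ - Yᵏ⁺¹) / Z, whence the shift of the binomial coefficients; the induction
-- step is Pascal's rule.
geomQuot-binomial : ∀ Y Z k → geomQuot (suc k) (Y +ₚ Z) Y ≋ homSum (λ j → suc k C suc j) Y Z k
geomQuot-binomial Y Z zero    = ≋-trans (+-congʳ (const 1ℚ) (*-zeroʳ′ Y)) (≋-trans (+-identityʳ (const 1ℚ)) (const-cong (sym ι-1)))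
geomQuot-binomial Y Z (suc k) = begin
  (Y +ₚ Z) ^ₚ suc k +ₚ Y *ₚ geomQuot (suc k) (Y +ₚ Z) Y
    ≈⟨ +-cong (binomial Y Z (suc k)) (≋-trans (*-congʳ Y (geomQuot-binomial Y Z k))
         (*-homSum (λ j → suc k C suc j) Y Z k (k>n⇒nCk≡0 (ℕP.n<1+n (suc k))))) ⟩
  homSum (suc k C_) Y Z (suc k) +ₚ homSum (λ j → suc k C suc j) Y Z (suc k)
    ≈⟨ homSum-+ (suc k C_) (λ j → suc k C suc j) Y Z (suc k) ⟨
  homSum (λ j → (suc k C j) + (suc k C suc j)) Y Z (suc k)
    ≈⟨ homSum-ext Y Z (suc k) (nCk+nC[k+1]≡[n+1]C[k+1] (suc k)) ⟩
  homSum (λ j → suc (suc k) C suc j) Y Z (suc k)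
    ∎
  where open ≋-Reasoning

geomQuot-cong : ∀ k {u u′} v → u ≋ u′ → geomQuot k u v ≋ geomQuot k u′ v
geomQuot-cong zero    v e = ≋-refl
geomQuot-cong (suc k) v e = +-cong (^-cong k e) (*-congʳ v (geomQuot-cong k v e))

geomQuot-* : ∀ k u v → geomQuot k u v *ₚ (u -ₚ v) ≋ u ^ₚ k -ₚ v ^ₚ k
geomQuot-* zero    u v = ≋-sym (CommutativeRing.-‿inverseʳ polyRing (const 1ℚ))
geomQuot-* (suc k) u v = begin
  (u ^ₚ k +ₚ v *ₚ g) *ₚ (u -ₚ v)
    ≈⟨ solve 4 (λ u v p g → (p :+ v :* g) :* (u :- v) := p :* (u :- v) :+ v :* (g :* (u :- v))) ≋-refl u v (u ^ₚ k) g ⟩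
  u ^ₚ k *ₚ (u -ₚ v) +ₚ v *ₚ (g *ₚ (u -ₚ v))
    ≈⟨ +-congʳ (u ^ₚ k *ₚ (u -ₚ v)) (*-congʳ v (geomQuot-* k u v)) ⟩
  u ^ₚ k *ₚ (u -ₚ v) +ₚ v *ₚ (u ^ₚ k -ₚ v ^ₚ k)
    ≈⟨ solve 4 (λ u v p q → p :* (u :- v) :+ v :* (p :- q) := u :* p :- v :* q) ≋-refl u v (u ^ₚ k) (v ^ₚ k) ⟩
  u ^ₚ suc k -ₚ v ^ₚ suc k
    ∎
  where
  open ≋-Reasoning
  open PolySolver
  g = geomQuot k u v

-- The bracket of 𝒢

module Recursion (d-1 : ℕ) where
  d = suc d-1

  δ : Poly
  δ = const (ι (+ d-1))

  -- Equal to a - d + 1: the nonzero fixed points x of the map are the solutions of xᵈ = w.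
  w : Poly
  w = ℕ→ℚ d ·ₚ Xₚ +ₚ const 1ℚ

  const-d : const (ℕ→ℚ d) ≋ const 1ℚ +ₚ δ
  const-d = const-cong (trans (sym (ι≡/1 (+ d))) (trans (ι-+ (+ 1) (+ d-1)) (cong (ℚ._+ ι (+ d-1)) ι-1)))

  A≋ : A d ≋ (const 1ℚ +ₚ δ) *ₚ (Xₚ +ₚ const 1ℚ)
  A≋ = ≋-trans (≋-sym (const-* (ℕ→ℚ d) (Xₚ +ₚ const 1ℚ))) (*-congˡ (Xₚ +ₚ const 1ℚ) const-d)

  w≋ : w ≋ (const 1ℚ +ₚ δ) *ₚ Xₚ +ₚ const 1ℚ
  w≋ = +-congˡ (const 1ℚ) (≋-trans (≋-sym (const-* (ℕ→ℚ d) Xₚ)) (*-congˡ Xₚ const-d))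

  bracket : Poly → Poly → Poly
  bracket s s⁺ = A d ^ₚ d *ₚ s ^ₚ (d * (d ∸ 1)) -ₚ w *ₚ geomQuot d s⁺ (A d *ₚ s ^ₚ d)

  module _ (r s : Poly) where
    Y Z s⁺ r⁺ : Poly
    Y = A d *ₚ s ^ₚ d
    Z = r ^ₚ d -ₚ w *ₚ s ^ₚ d
    s⁺ = r ^ₚ d +ₚ ℕ→ℚ (d ∸ 1) ·ₚ s ^ₚ d
    r⁺ = A d *ₚ r *ₚ s ^ₚ (d ∸ 1)

    -- Holds because a - w = d - 1.
    s⁺≋Y+Z : s⁺ ≋ Y +ₚ Z
    s⁺≋Y+Z = begin
      r ^ₚ d +ₚ ℕ→ℚ d-1 ·ₚ s ^ₚ d
        ≈⟨ +-congʳ (r ^ₚ d) (≋-sym (const-* (ℕ→ℚ d-1) (s ^ₚ d))) ⟩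
      r ^ₚ d +ₚ const (ℕ→ℚ d-1) *ₚ s ^ₚ d
        ≈⟨ +-congʳ (r ^ₚ d) (*-congˡ (s ^ₚ d) (const-cong (sym (ι≡/1 (+ d-1))))) ⟩
      r ^ₚ d +ₚ δ *ₚ s ^ₚ d
        ≈⟨ solve 4 (λ R S x δ → R :+ δ :* S := ((con 1ℚ :+ δ) :* (x :+ con 1ℚ)) :* S :+ (R :- ((con 1ℚ :+ δ) :* x :+ con 1ℚ) :* S))
             ≋-refl (r ^ₚ d) (s ^ₚ d) Xₚ δ ⟩
      ((const 1ℚ +ₚ δ) *ₚ (Xₚ +ₚ const 1ℚ)) *ₚ s ^ₚ d +ₚ (r ^ₚ d -ₚ ((const 1ℚ +ₚ δ) *ₚ Xₚ +ₚ const 1ℚ) *ₚ s ^ₚ d)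
        ≈⟨ +-cong (*-congˡ (s ^ₚ d) A≋) (+-congʳ (r ^ₚ d) (neg-cong (*-congˡ (s ^ₚ d) w≋))) ⟨
      Y +ₚ Z ∎
      where
      open ≋-Reasoning
      open PolySolver

    private
      A^s^ : A d ^ₚ d *ₚ s ^ₚ (d * d-1) ≋ A d *ₚ Y ^ₚ d-1
      A^s^ = begin
        (A d *ₚ A d ^ₚ d-1) *ₚ s ^ₚ (d * d-1) ≈⟨ *-assoc (A d) (A d ^ₚ d-1) _ ⟩
        A d *ₚ (A d ^ₚ d-1 *ₚ s ^ₚ (d * d-1)) ≈⟨ *-congʳ (A d) (*-congʳ (A d ^ₚ d-1) (^-*-assoc s d d-1)) ⟨
        A d *ₚ (A d ^ₚ d-1 *ₚ (s ^ₚ d) ^ₚ d-1) ≈⟨ *-congʳ (A d) (*-^-distrib (A d) (s ^ₚ d) d-1) ⟨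
        A d *ₚ Y ^ₚ d-1 ∎
        where open ≋-Reasoning

    bracket≋ : bracket s s⁺ ≋ A d *ₚ Y ^ₚ d-1 -ₚ w *ₚ geomQuot d (Y +ₚ Z) Y
    bracket≋ = +-cong A^s^ (neg-cong (*-congʳ w (geomQuot-cong d Y s⁺≋Y+Z)))

    -- Subtract and add w Yᵈ. As Y = a sᵈ, the part a Yᵈ⁻¹ rᵈ - w Yᵈ is a Yᵈ⁻¹ Z, and (Y + Z)ᵈ - Yᵈ
    -- is `Z` times the geometric quotient.
    Z⁺≋ : r⁺ ^ₚ d -ₚ w *ₚ s⁺ ^ₚ d ≋ Z *ₚ bracket s s⁺
    Z⁺≋ = begin
      r⁺ ^ₚ d -ₚ w *ₚ s⁺ ^ₚ d
        ≈⟨ +-cong r⁺^d (neg-cong (*-congʳ w (^-cong d s⁺≋Y+Z))) ⟩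
      A d *ₚ T *ₚ r ^ₚ d -ₚ w *ₚ (Y +ₚ Z) ^ₚ d
        ≈⟨ solve 6 (λ A T R w U S → A :* T :* R :- w :* U
             := A :* T :* (R :- w :* S) :- w :* (U :- (A :* S) :* T)) ≋-refl (A d) T (r ^ₚ d) w ((Y +ₚ Z) ^ₚ d) (s ^ₚ d) ⟩
      A d *ₚ T *ₚ Z -ₚ w *ₚ ((Y +ₚ Z) ^ₚ d -ₚ Y ^ₚ d)
        ≈⟨ +-congʳ (A d *ₚ T *ₚ Z) (neg-cong (*-congʳ w (geomQuot-* d (Y +ₚ Z) Y))) ⟨
      A d *ₚ T *ₚ Z -ₚ w *ₚ (g *ₚ (Y +ₚ Z -ₚ Y))
        ≈⟨ solve 6 (λ A T w g Y Z → A :* T :* Z :- w :* (g :* (Y :+ Z :- Y)) := Z :* (A :* T :- w :* g)) ≋-refl (A d) T w g Y Z ⟩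
      Z *ₚ (A d *ₚ T -ₚ w *ₚ g)
        ≈⟨ *-congʳ Z bracket≋ ⟨
      Z *ₚ bracket s s⁺ ∎
      where
      open ≋-Reasoning
      open PolySolver
      T = Y ^ₚ d-1
      g = geomQuot d (Y +ₚ Z) Y
      r⁺^d : r⁺ ^ₚ d ≋ A d *ₚ T *ₚ r ^ₚ d
      r⁺^d = begin
        (A d *ₚ r *ₚ s ^ₚ d-1) ^ₚ d ≈⟨ *-^-distrib (A d *ₚ r) (s ^ₚ d-1) d ⟩
        (A d *ₚ r) ^ₚ d *ₚ (s ^ₚ d-1) ^ₚ d ≈⟨ *-cong (*-^-distrib (A d) r d) (≋-trans (^-*-assoc s d-1 d) (≡⇒≋ (cong (s ^ₚ_) (ℕP.*-comm d-1 d)))) ⟩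
        (A d ^ₚ d *ₚ r ^ₚ d) *ₚ s ^ₚ (d * d-1) ≈⟨ solve 3 (λ a b c → (a :* b) :* c := (a :* c) :* b) ≋-refl (A d ^ₚ d) (r ^ₚ d) (s ^ₚ (d * d-1)) ⟩
        (A d ^ₚ d *ₚ s ^ₚ (d * d-1)) *ₚ r ^ₚ d ≈⟨ *-congˡ (r ^ₚ d) A^s^ ⟩
        A d *ₚ T *ₚ r ^ₚ d ∎

-- Writing d = 3 + e lets the exponents d - 1 = 2 + e and d - 2 = 1 + e reduce by computation.
module Quotient (e : ℕ) where
  d-1 = suc (suc e)
  open Recursion d-1 public

  -- The cofactor of Z² in (Y + Z)ᵈ - Yᵈ - d Yᵈ⁻¹ Z.
  tail : Poly → Poly → Poly
  tail r s = homSum (λ j → d C suc (suc j)) (Y r s) (Z r s) (suc e)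

  quot : Poly → Poly → Poly → Poly
  quot r s Z′ = negₚ (const (ι (+ d)) *ₚ δ *ₚ Y r s ^ₚ d-1) -ₚ w *ₚ (Z′ *ₚ tail r s)

  -- The quotient 𝒢 = bracket / b (up to the constant d)
  bracket≋X*quot : ∀ r s Z′ → Z r s ≋ Xₚ *ₚ Z′ → bracket s (s⁺ r s) ≋ Xₚ *ₚ quot r s Z′
  bracket≋X*quot r s Z′ eZ = begin
    bracket s (s⁺ r s)
      ≈⟨ bracket≋ r s ⟩
    A d *ₚ T -ₚ w *ₚ geomQuot d (Y r s +ₚ Z r s) (Y r s)
      ≈⟨ +-congʳ (A d *ₚ T) (neg-cong (*-congʳ w (geomQuot-binomial (Y r s) (Z r s) d-1))) ⟩
    A d *ₚ T -ₚ w *ₚ (const (ι (+ (d C 1))) *ₚ T +ₚ Z r s *ₚ tail r s)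
      ≈⟨ +-cong (*-congˡ T A≋) (neg-cong (*-cong {w} w≋ (+-cong (*-congˡ T dC1) (*-congˡ (tail r s) eZ)))) ⟩
    (D *ₚ (Xₚ +ₚ const 1ℚ)) *ₚ T -ₚ (D *ₚ Xₚ +ₚ const 1ℚ) *ₚ (D *ₚ T +ₚ (Xₚ *ₚ Z′) *ₚ tail r s)
      -- The terms in Yᵈ⁻¹ combine with coefficient a - d w = - d (d - 1) b, which supplies the
      -- factor b; in the other term it comes from `Z`.
      ≈⟨ solve 5 (λ δ x T z t → let D = con 1ℚ :+ δ in
           (D :* (x :+ con 1ℚ)) :* T :- (D :* x :+ con 1ℚ) :* (D :* T :+ (x :* z) :* t)
           := x :* (:- (D :* δ :* T) :- (D :* x :+ con 1ℚ) :* (z :* t))) ≋-refl δ Xₚ T Z′ (tail r s) ⟩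
    Xₚ *ₚ (negₚ (D *ₚ δ *ₚ T) -ₚ (D *ₚ Xₚ +ₚ const 1ℚ) *ₚ (Z′ *ₚ tail r s))
      ≈⟨ *-congʳ Xₚ (+-cong (neg-cong (*-congˡ T (*-congˡ δ const-d′)))
           (neg-cong (*-congˡ (Z′ *ₚ tail r s) w≋))) ⟨
    Xₚ *ₚ quot r s Z′ ∎
    where
    open ≋-Reasoning
    open PolySolver
    T = Y r s ^ₚ d-1
    D = const 1ℚ +ₚ δ
    const-d′ : const (ι (+ d)) ≋ D
    const-d′ = ≋-trans (const-cong (ι≡/1 (+ d))) const-d
    dC1 : const (ι (+ (d C 1))) ≋ D
    dC1 = ≋-trans (const-cong (cong (λ z → ι (+ z)) (nC1≡n d))) const-d′

1^ : ∀ k → const 1ℚ ^ₚ k ≋ const 1ℚ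
1^ zero    = ≋-refl
1^ (suc k) = ≋-trans (*-congʳ (const 1ℚ) (1^ k)) (CommutativeRing.*-identityˡ polyRing (const 1ℚ))

module Sequences (e : ℕ) (pp : Prime (3 + e)) where
  open Quotient e public

  Yₙ Zₙ Bₙ Z′ₙ Qₙ tailₙ : ℕ → Poly
  Yₙ n = Y (r d n) (s d n)
  Zₙ n = Z (r d n) (s d n)
  Bₙ n = bracket (s d n) (s d (suc n))
  -- Z₀ = 1 - w = - d b.
  Z′ₙ zero    = negₚ (const (ι (+ d)))
  Z′ₙ (suc n) = Z′ₙ n *ₚ Bₙ n
  tailₙ n = tail (r d n) (s d n)
  Qₙ n = quot (r d n) (s d n) (Z′ₙ n)

  const-ιd : const (ι (+ d)) ≋ const 1ℚ +ₚ δ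
  const-ιd = ≋-trans (const-cong (ι≡/1 (+ d))) const-d

  Zₙ-suc : ∀ n → Zₙ (suc n) ≋ Zₙ n *ₚ Bₙ n
  Zₙ-suc n = Z⁺≋ (r d n) (s d n)

  Zₙ≋X*Z′ₙ : ∀ n → Zₙ n ≋ Xₚ *ₚ Z′ₙ n
  Zₙ≋X*Z′ₙ zero = begin
    const 1ℚ ^ₚ d -ₚ w *ₚ const 1ℚ ^ₚ d
      ≈⟨ +-cong (1^ d) (neg-cong (*-cong w≋ (1^ d))) ⟩
    const 1ℚ -ₚ ((const 1ℚ +ₚ δ) *ₚ Xₚ +ₚ const 1ℚ) *ₚ const 1ℚ
      ≈⟨ solve 2 (λ δ x → con 1ℚ :- ((con 1ℚ :+ δ) :* x :+ con 1ℚ) :* con 1ℚ := x :* (:- (con 1ℚ :+ δ))) ≋-refl δ Xₚ ⟩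
    Xₚ *ₚ negₚ (const 1ℚ +ₚ δ)
      ≈⟨ *-congʳ Xₚ (neg-cong const-ιd) ⟨
    Xₚ *ₚ negₚ (const (ι (+ d))) ∎
    where
    open ≋-Reasoning
    open PolySolver
  Zₙ≋X*Z′ₙ (suc n) = ≋-trans (Zₙ-suc n) (≋-trans (*-congˡ (Bₙ n) (Zₙ≋X*Z′ₙ n)) (*-assoc Xₚ (Z′ₙ n) (Bₙ n)))

  Bₙ≋X*Qₙ : ∀ n → Bₙ n ≋ Xₚ *ₚ Qₙ n
  Bₙ≋X*Qₙ n = bracket≋X*quot (r d n) (s d n) (Z′ₙ n) (Zₙ≋X*Z′ₙ n)

  divX-0∷ : ∀ {p q} → p ≋ 0ℚ ∷ q → divX p ≋ q
  divX-0∷ {[]}    h = mk≋ λ i → at h (suc i)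
  divX-0∷ {a ∷ p} h = mk≋ λ i → at h (suc i)

  calG≋ : ∀ n → calG d (suc n) ≋ oneOver d ·ₚ Qₙ n
  calG≋ n = ·-cong (oneOver d) (divX-0∷ (≋-trans (Bₙ≋X*Qₙ n) (X*≋0∷ (Qₙ n))))

  -- Among the binomial coefficients in `tailₙ` only that of Zᵈ⁻² is prime to d. All other
  -- contributions to Bₙ carry a factor d and are collected in `mainₙ`.
  Pₙ mainₙ topₙ : ℕ → Poly
  Pₙ n = const (ι (+ d)) *ₚ δ *ₚ Yₙ n ^ₚ d-1
  topₙ n = Zₙ n ^ₚ suc e
  mainₙ n = Xₚ *ₚ negₚ (Pₙ n) -ₚ w *ₚ (Zₙ n *ₚ (tailₙ n -ₚ topₙ n))

  Bₙ-split : ∀ n → Bₙ n ≋ mainₙ n -ₚ w *ₚ (Zₙ n *ₚ topₙ n)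
  Bₙ-split n = begin
    Bₙ n
      ≈⟨ Bₙ≋X*Qₙ n ⟩
    Xₚ *ₚ (negₚ (Pₙ n) -ₚ w *ₚ (Z′ₙ n *ₚ tailₙ n))
      ≈⟨ solve 6 (λ x P w z t c → x :* (:- P :- w :* (z :* t)) := (x :* (:- P) :- w :* ((x :* z) :* (t :- c))) :- w :* ((x :* z) :* c))
           ≋-refl Xₚ (Pₙ n) w (Z′ₙ n) (tailₙ n) (topₙ n) ⟩
    (Xₚ *ₚ negₚ (Pₙ n) -ₚ w *ₚ ((Xₚ *ₚ Z′ₙ n) *ₚ (tailₙ n -ₚ topₙ n))) -ₚ w *ₚ ((Xₚ *ₚ Z′ₙ n) *ₚ topₙ n)
      ≈⟨ +-cong (+-congʳ (Xₚ *ₚ negₚ (Pₙ n)) (neg-cong (*-congʳ w (*-congˡ (tailₙ n -ₚ topₙ n) (Zₙ≋X*Z′ₙ n)))))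
                (neg-cong (*-congʳ w (*-congˡ (topₙ n) (Zₙ≋X*Z′ₙ n)))) ⟨
    mainₙ n -ₚ w *ₚ (Zₙ n *ₚ topₙ n) ∎
    where
    open ≋-Reasoning
    open PolySolver

  ιd-Multiple : Multiple (d ^ 1) (ι (+ d))
  ιd-Multiple = + d , refl , divides ℤ.1ℤ (trans (cong +_ (sym (*-identityʳ d))) (sym (ℤP.*-identityˡ _)))

  module Filtration (N L : ℕ) {{nz : ℕ.NonZero N}} where
    open Newton d pp N L

    -- Every coefficient but the last is divisible by d, which adds `N` to the weight of its term. A
    -- common bound for `Y` and `Z` makes all terms of the homogeneous sum comparable.
    V-homSum : ∀ {f y} Y Z k → (∀ j → j < k → d ℕD.∣ f j) → f k ≡ 1 → V y Y → V y Z →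
      V (N + k * y) (homSum f Y Z k -ₚ Z ^ₚ k)
    V-homSum {f} Y Z zero h f≡1 hY hZ = V-cong (≋-sym (≋-trans (+-congˡ (negₚ (const 1ℚ)) (const-cong (trans (cong (λ z → ι (+ z)) f≡1) ι-1)))
      (CommutativeRing.-‿inverseʳ polyRing (const 1ℚ)))) V-0
    V-homSum {f} {y} Y Z (suc k) h f≡1 hY hZ = V-cong
      (solve 5 (λ a Yp Z s t → a :* Yp :+ Z :* (s :- t) := (a :* Yp :+ Z :* s) :- Z :* t) ≋-refl
         (const (ι (+ f 0))) (Y ^ₚ suc k) Z (homSum (λ j → f (suc j)) Y Z k) (Z ^ₚ k))
      (V-+ (V-mono (≤-reflexive (cong (ℕ._+ suc k * y) (sym (*-identityʳ N))))
             (V-* (const (ι (+ f 0))) (Y ^ₚ suc k) (V-const 1 f0 ≤-refl) (V-^ (suc k) Y hY)))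
           (V-mono (≤-reflexive (arith N y (k * y)))
             (V-* Z _ hZ (V-homSum Y Z k (λ j lt → h (suc j) (s≤s lt)) f≡1 hY hZ))))
      where
      open PolySolver
      f0 : Multiple (d ^ 1) (ι (+ f 0))
      f0 = + f 0 , refl , ℤD.∣ᵤ⇒∣ (subst (ℕD._∣ f 0) (sym (*-identityʳ d)) (h 0 (s≤s z≤n)))
      arith : ∀ N y k → N + (y + k) ≡ y + (N + k)
      arith = S.solve 3 (λ N y k → N S.:+ (y S.:+ k) S.:= y S.:+ (N S.:+ k)) refl
        where module S = ℕSolver.+-*-Solver

    V-int-const : ∀ k → V 0 (const (ι (+ k)))
    V-int-const k = V-int (+ k , refl)

    V-d : V N (const (ι (+ d)))
    V-d = V-const 1 ιd-Multiple (≤-reflexive (sym (*-identityʳ N)))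

    V-1 : V 0 (const 1ℚ)
    V-1 = V-int (ℤ.1ℤ , sym ι-1)

    V-A : V N (A d)
    V-A = V-cong (≋-sym (≋-trans A≋ (*-congˡ (Xₚ +ₚ const 1ℚ) (≋-sym const-ιd))))
      (V-mono (≤-reflexive (sym (ℕP.+-identityʳ N))) (V-* (const (ι (+ d))) (Xₚ +ₚ const 1ℚ) V-d (V-+ (V-mono z≤n V-X) V-1)))

    V-w : V 0 w
    V-w = V-cong (≋-sym (≋-trans w≋ (+-congˡ (const 1ℚ) (*-congˡ Xₚ (≋-sym const-ιd)))))
      (V-+ (V-mono z≤n (V-* (const (ι (+ d))) Xₚ V-d V-X)) V-1)

    V-Y-suc : ∀ {y} n → V y (Yₙ n) → V y (Zₙ n) → V (N + d * y) (Yₙ (suc n))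
    V-Y-suc n hY hZ = V-* (A d) (s d (suc n) ^ₚ d) V-A
      (V-^ d (s d (suc n)) (V-cong (≋-sym (s⁺≋Y+Z (r d n) (s d n))) (V-+ hY hZ)))

    V-tail-top : ∀ {y} n → V y (Yₙ n) → V y (Zₙ n) → V (N + suc e * y) (tailₙ n -ₚ topₙ n)
    V-tail-top n hY hZ = V-homSum (Yₙ n) (Zₙ n) (suc e) (λ j lt → prime∣C pp (suc j) (s≤s (s≤s lt))) (nCn≡1 d) hY hZ

    -- Two bounds for Zₙ are used: one shared with Yₙ inside the binomial sum, and a possibly better
    -- one for the factor Zₙ in front.
    V-main : ∀ {y z T} n → V y (Yₙ n) → V y (Zₙ n) → V z (Zₙ n) →
      T ≤ L + (N + d-1 * y) → T ≤ z + (N + suc e * y) → V T (mainₙ n)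
    V-main {y} n hY hZ hZ′ h₁ h₂ = V-+
      (V-mono h₁ (V-* Xₚ (negₚ (Pₙ n)) V-X (V-neg (Pₙ n) (V-* (const (ι (+ d)) *ₚ δ) (Yₙ n ^ₚ d-1)
        (V-mono (m≤m+n N 0) (V-* (const (ι (+ d))) δ V-d (V-int-const _))) (V-^ d-1 (Yₙ n) hY)))))
      (V-neg (w *ₚ (Zₙ n *ₚ (tailₙ n -ₚ topₙ n))) (V-mono h₂ (V-* w (Zₙ n *ₚ (tailₙ n -ₚ topₙ n)) V-w (V-* (Zₙ n) (tailₙ n -ₚ topₙ n) hZ′ (V-tail-top n hY hZ)))))

    V-B : ∀ {y z T} n → V y (Yₙ n) → V y (Zₙ n) → V z (Zₙ n) →
      T ≤ L + (N + d-1 * y) → T ≤ z + (N + suc e * y) → T ≤ z + suc e * z → V T (Bₙ n)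
    V-B n hY hZ hZ′ h₁ h₂ h₃ = V-cong (≋-sym (Bₙ-split n)) (V-+ (V-main n hY hZ hZ′ h₁ h₂)
      (V-neg (w *ₚ (Zₙ n *ₚ topₙ n)) (V-mono h₃ (V-* w (Zₙ n *ₚ topₙ n) V-w (V-* (Zₙ n) (topₙ n) hZ′ (V-^ (suc e) (Zₙ n) hZ′))))))

    Y₀≋A : Yₙ 0 ≋ A d
    Y₀≋A = ≋-trans (*-congʳ (A d) (1^ d)) (CommutativeRing.*-identityʳ polyRing (A d))

    V-Y₀ : V N (Yₙ 0)
    V-Y₀ = V-cong (≋-sym Y₀≋A) V-A

    V-Z₀ : V (L + N) (Zₙ 0)
    V-Z₀ = V-cong (≋-sym (Zₙ≋X*Z′ₙ 0)) (V-* Xₚ (Z′ₙ 0) V-X (V-neg (const (ι (+ d))) V-d))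

  -- (dᵏ⁺¹ - 1)/(d - 1), the valuation of Yₖ(0)
  E : ℕ → ℕ
  E zero    = 1
  E (suc k) = 1 + d * E k

  E-eq : ∀ k → 1 + d-1 * E k ≡ d ^ suc k
  E-eq zero    = solve 1 (λ e → con 1 :+ (con 2 :+ e) :* con 1 := (con 3 :+ e) :* con 1) refl e
    where open ℕSolver.+-*-Solver
  E-eq (suc k) = trans (solve 2 (λ e E → con 1 :+ (con 2 :+ e) :* (con 1 :+ (con 3 :+ e) :* E) := (con 3 :+ e) :* (con 1 :+ (con 2 :+ e) :* E)) refl e (E k))
    (cong (d ℕ.*_) (E-eq k))
    where open ℕSolver.+-*-Solver

  -- For the slope L / N the monomial bᴺ and the constant term of 𝒢ₙ₊₁ have the same weight.
  module Slope (n N : ℕ) {{nz : ℕ.NonZero N}} (N+1≡ : suc N ≡ d-1 * d ^ n) where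
    L = d ^ n
    open Newton d pp N L
    open Filtration N L

    private
      -- The weights of the constant term of Yₖ and of the monomial (d b)^(dᵏ), which dominates Zₖ.
      y z : ℕ → ℕ
      y k = N * E k
      z k = (N + L) * d ^ k

      y+L≤z : ∀ k → y k + L ≤ z k
      y+L≤z zero    = ≤-reflexive (solve 2 (λ N L → N :* con 1 :+ L := (N :+ L) :* con 1) refl N L)
        where open ℕSolver.+-*-Solver
      y+L≤z (suc k) = begin
        N * (1 + d * E k) + L ≡⟨ solve 4 (λ N L e E → N :* (con 1 :+ (con 3 :+ e) :* E) :+ L := (con 3 :+ e) :* (N :* E) :+ (N :+ L)) refl N L e (E k) ⟩
        d * (N * E k) + (N + L) ≤⟨ +-monoʳ-≤ (d * (N * E k)) (+-monoˡ-≤ L (≤-trans (n≤1+n N) (≤-reflexive N+1≡))) ⟩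
        d * (N * E k) + (d-1 * L + L)
                                                   ≡⟨ solve 3 (λ L e y → (con 3 :+ e) :* y :+ ((con 2 :+ e) :* L :+ L) := (con 3 :+ e) :* (y :+ L)) refl L e (y k) ⟩
        d * (y k + L) ≤⟨ *-monoʳ-≤ d (y+L≤z k) ⟩
        d * z k ≡⟨ solve 3 (λ d a b → d :* (a :* b) := a :* (d :* b)) refl d (N + L) (d ^ k) ⟩
        z (suc k) ∎
        where
        open ℕP.≤-Reasoning
        open ℕSolver.+-*-Solver

      -- The weight of (d b)^((d-1) dᵏ), the monomial that Zₖᵈ⁻¹ contributes to Bₖ.
      T : ℕ → ℕ
      T k = (N + L) * (d-1 * d ^ k)

      -- The two sides differ by exactly dⁿ - dᵏ. Equality at k = n is the tie that produces the
      -- second end of the segment.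
      T≤₁ : ∀ k → k ≤ n → T k ≤ L + (N + d-1 * y k)
      T≤₁ k k≤n = begin
        (N + L) * (d-1 * d ^ k) ≡⟨ solve 4 (λ N L g D → (N :+ L) :* (g :* D) := g :* N :* D :+ g :* L :* D) refl N L d-1 (d ^ k) ⟩
        d-1 * N * d ^ k + d-1 * L * d ^ k
                                                        ≡⟨ cong (λ a → d-1 * N * d ^ k + a * d ^ k) N+1≡ ⟨
        d-1 * N * d ^ k + suc N * d ^ k
                                                        ≡⟨ solve 3 (λ N e D → (con 2 :+ e) :* N :* D :+ (con 1 :+ N) :* D := D :+ N :* ((con 3 :+ e) :* D)) refl N e (d ^ k) ⟩
        d ^ k + N * d ^ suc k ≤⟨ +-monoˡ-≤ (N * d ^ suc k) (ℕP.^-monoʳ-≤ d k≤n) ⟩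
        L + N * d ^ suc k ≡⟨ cong (λ a → L + N * a) (E-eq k) ⟨
        L + N * (1 + d-1 * E k) ≡⟨ solve 4 (λ N L g E → L :+ N :* (con 1 :+ g :* E) := L :+ (N :+ g :* (N :* E))) refl N L d-1 (E k) ⟩
        L + (N + d-1 * y k) ∎
        where
        open ℕP.≤-Reasoning
        open ℕSolver.+-*-Solver

      T≤₂ : ∀ k → k ≤ n → T k ≤ z k + (N + suc e * y k)
      T≤₂ k k≤n = begin
        T k ≤⟨ T≤₁ k k≤n ⟩
        L + (N + d-1 * y k) ≡⟨ solve 4 (λ N L e y → L :+ (N :+ (con 2 :+ e) :* y) := (y :+ L) :+ (N :+ (con 1 :+ e) :* y)) refl N L e (y k) ⟩
        (y k + L) + (N + suc e * y k) ≤⟨ +-monoˡ-≤ (N + suc e * y k) (y+L≤z k) ⟩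
        z k + (N + suc e * y k) ∎
        where
        open ℕP.≤-Reasoning
        open ℕSolver.+-*-Solver

      T≡ : ∀ k → T k ≡ z k + suc e * z k
      T≡ k = solve 3 (λ a e D → a :* ((con 2 :+ e) :* D) := a :* D :+ (con 1 :+ e) :* (a :* D)) refl (N + L) e (d ^ k)
        where open ℕSolver.+-*-Solver

      V-YZ : ∀ k → k ≤ n → V (y k) (Yₙ k) × V (z k) (Zₙ k)
      V-Bₖ : ∀ k → k ≤ n → V (T k) (Bₙ k)

      V-YZ zero    k≤n = V-mono (≤-reflexive (*-identityʳ N)) V-Y₀
                       , V-mono (≤-reflexive (trans (*-identityʳ (N + L)) (ℕP.+-comm N L))) V-Z₀
      V-YZ (suc k) k<n = V-mono (≤-reflexive (solve 3 (λ N d E → N :* (con 1 :+ d :* E) := N :+ d :* (N :* E)) refl N d (E k)))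
            (V-Y-suc k (proj₁ ih) (V-mono (≤-trans (m≤m+n (y k) L) (y+L≤z k)) (proj₂ ih)))
        , V-cong (≋-sym (Zₙ-suc k)) (V-mono (≤-reflexive (solve 3 (λ a e D → a :* ((con 3 :+ e) :* D) := a :* D :+ a :* ((con 2 :+ e) :* D)) refl (N + L) e (d ^ k)))
            (V-* (Zₙ k) (Bₙ k) (proj₂ ih) (V-Bₖ k (<⇒≤ k<n))))
        where
        open ℕSolver.+-*-Solver
        ih = V-YZ k (<⇒≤ k<n)
      V-Bₖ k k≤n = V-B k (proj₁ (V-YZ k k≤n)) (V-mono (≤-trans (m≤m+n (y k) L) (y+L≤z k)) (proj₂ (V-YZ k k≤n)))
        (proj₂ (V-YZ k k≤n)) (T≤₁ k k≤n) (T≤₂ k k≤n) (≤-reflexive (T≡ k))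

    -- The weight (N + L)(N + 1) of Bₙ lowered by `L` for the division by b; it is the weight of
    -- dᴺ⁺¹ bᴺ.
    V-Qₙ : V (N * suc N + L * N) (Qₙ n)
    V-Qₙ = V-mono (≤-reflexive (sym (trans (cong (_∸ L) total) (ℕP.m+n∸n≡m _ L))))
      (V-tail (V-cong (≋-trans (Bₙ≋X*Qₙ n) (X*≋0∷ (Qₙ n))) (V-Bₖ n ≤-refl)))
      where
      total : T n ≡ N * suc N + L * N + L
      total = trans (cong ((N + L) ℕ.*_) (sym N+1≡))
        (solve 2 (λ N L → (N :+ L) :* (con 1 :+ N) := N :* (con 1 :+ N) :+ L :* N :+ L) refl N L)
        where open ℕSolver.+-*-Solver

-- Polynomials dominated by one known monomial

module MinimalIndex (p : ℕ) (pp : Prime p) (N L : ℕ) {{nz : ℕ.NonZero N}} where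
  open Valuation p pp
  open Newton p pp N L

  Exact-ι : ∀ {z} → ¬ (+ p ∣ z) → Exact 0 (ι z)
  Exact-ι {z} h = exactly z (cong ι (sym (ℤP.*-identityʳ z))) h

  p∤-small : ∀ {k} .{{_ : ℕ.NonZero k}} → k < p → ¬ (+ p ∣ + k)
  p∤-small k<p h = <⇒≱ k<p (ℕD.∣⇒≤ (ℤD.∣⇒∣ᵤ h))

  1<p : 1 < p
  1<p = ℕ.nonTrivial⇒n>1 p {{prime⇒nonTrivial pp}}

  Exact-1 : Exact 0 1ℚ
  Exact-1 = subst (Exact 0) ι-1 (Exact-ι (p∤-small 1<p))

  Exact-p : Exact 1 (ι (+ p))
  Exact-p = exactly ℤ.1ℤ (cong ι (trans (cong +_ (sym (*-identityʳ p))) (sym (ℤP.*-identityˡ _)))) (p∤-small 1<p)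

  Exact--1 : Exact 0 (ℚ.- 1ℚ)
  Exact--1 = subst (Exact 0) (trans (ι-neg ℤ.1ℤ) (cong ℚ.-_ ι-1))
    (Exact-ι {ℤ.-1ℤ} λ h → <⇒≱ 1<p (ℕD.∣⇒≤ (ℤD.∣⇒∣ᵤ h)))

  Exact-^ : ∀ k {v x} → Exact v x → Exact (k * v) (x ^ℚ k)
  Exact-^ zero    h = Exact-1
  Exact-^ (suc k) h = Exact-* h (Exact-^ k h)

  -- For N = 1 and L = 0 this says that `f` is congruent to a unit times pᵛ bⁱ modulo pᵛ⁺¹.
  record MinAt (i v : ℕ) (f : Poly) : Set where
    constructor minAt
    field
      unique : Unique f
      index≡ : Unique.index unique ≡ i
      val≡   : Unique.val unique ≡ v

    exact-i : Exact v (coeff f i)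
    exact-i = subst₂ (λ v i → Exact v (coeff f i)) val≡ index≡ (Unique.exact-at unique)

    V-minAt : V (N * v + L * i) f
    V-minAt = subst₂ (λ v i → V (N * v + L * i) f) val≡ index≡ (Unique.V-min unique)

  MinAt-cong : ∀ {i v f g} → f ≋ g → MinAt i v f → MinAt i v g
  MinAt-cong e (minAt u refl refl) = minAt (record { Unique u ; decomp = ≋-trans (≋-sym e) (Unique.decomp u) }) refl refl

  MinAt-mono : ∀ i {v x} → Exact v x → MinAt i v (mono i x)
  MinAt-mono i {v} {x} h = minAt (record { index = i ; val = v ; coef = x ; isExact = h ; rest = []
    ; decomp = ≋-sym (+-identityʳ (mono i x)) ; rest-V = V-0 }) refl refl

  MinAt-* : ∀ {i j v v′ f g} → MinAt i v f → MinAt j v′ g → MinAt (i + j) (v + v′) (f *ₚ g)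
  MinAt-* (minAt u refl refl) (minAt u′ refl refl) = minAt (Unique-* u u′) refl refl

  MinAt-^ : ∀ k {i v f} → MinAt i v f → MinAt (k * i) (k * v) (f ^ₚ k)
  MinAt-^ zero    m = MinAt-mono 0 Exact-1
  MinAt-^ (suc k) m = MinAt-* m (MinAt-^ k m)

  MinAt-neg : ∀ {i v f} → MinAt i v f → MinAt i v (negₚ f)
  MinAt-neg {f = f} m = MinAt-cong (const-* (ℚ.- 1ℚ) f) (MinAt-* (MinAt-mono 0 Exact--1) m)

  MinAt-+ : ∀ {i v f g} → MinAt i v f → V (suc (N * v + L * i)) g → MinAt i v (f +ₚ g)
  MinAt-+ {f = f} {g} (minAt u refl refl) h = minAt (record
    { index = index ; val = val ; coef = coef ; isExact = isExact ; rest = rest +ₚ g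
    ; decomp = ≋-trans (+-congˡ g decomp) (+-assoc (mono index coef) rest g)
    ; rest-V = V-+ rest-V h }) refl refl
    where open Unique u

-- The power of d in Bₙ, and the constant term of Qₙ

module Normalised (e : ℕ) (pp : Prime (3 + e)) where
  open Sequences e pp public
  open Valuation d pp public

  private
    module V₀ = Newton d pp 1 0
    module F₀ = Filtration 1 0
  module M₀ = MinimalIndex d pp 1 0

  -- Modulo higher powers of d, Zₙ is ± d^(dⁿ) b^(dⁿ).
  V₀-Yₙ : ∀ n → V₀.V (d ^ n) (Yₙ n)
  MinAt-Zₙ : ∀ n → M₀.MinAt (d ^ n) (d ^ n) (Zₙ n)
  MinAt-Bₙ : ∀ n → M₀.MinAt (d-1 * d ^ n) (d-1 * d ^ n) (Bₙ n)

  private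
    V₀-Zₙ : ∀ n → V₀.V (d ^ n) (Zₙ n)
    V₀-Zₙ n = V₀.V-mono (≤-reflexive (sym (trans (ℕP.+-identityʳ _) (*-identityˡ (d ^ n))))) (M₀.MinAt.V-minAt (MinAt-Zₙ n))

  V₀-Yₙ zero    = F₀.V-Y₀
  V₀-Yₙ (suc n) = V₀.V-mono (n≤1+n _) (F₀.V-Y-suc n (V₀-Yₙ n) (V₀-Zₙ n))

  MinAt-Zₙ zero    = M₀.MinAt-cong (≋-sym (≋-trans (Zₙ≋X*Z′ₙ 0) (X*≋0∷ (Z′ₙ 0))))
    (M₀.MinAt-mono 1 (Exact-* M₀.Exact--1 M₀.Exact-p))
  MinAt-Zₙ (suc n) = M₀.MinAt-cong (≋-sym (Zₙ-suc n)) (M₀.MinAt-* (MinAt-Zₙ n) (MinAt-Bₙ n))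

  -- Since w is 1 modulo d and `mainₙ` has an additional factor d, Bₙ agrees with - Zₙᵈ⁻¹ to first
  -- order.
  MinAt-Bₙ n = M₀.MinAt-cong (≋-sym eq) (M₀.MinAt-+ (M₀.MinAt-neg (M₀.MinAt-* (MinAt-Zₙ n) (M₀.MinAt-^ (suc e) (MinAt-Zₙ n))))
      (V₀.V-mono (≤-reflexive weight) (V₀.V-+ (F₀.V-main n (V₀-Yₙ n) (V₀-Zₙ n) (V₀-Zₙ n) ≤-refl (≤-reflexive shift))
        (V₀.V-neg ((const (ι (+ d)) *ₚ Xₚ) *ₚ (Zₙ n *ₚ topₙ n)) (V₀.V-* (const (ι (+ d)) *ₚ Xₚ) (Zₙ n *ₚ topₙ n) (V₀.V-* (const (ι (+ d))) Xₚ F₀.V-d V₀.V-X)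
          (V₀.V-* (Zₙ n) (topₙ n) (V₀-Zₙ n) (V₀.V-^ (suc e) (Zₙ n) (V₀-Zₙ n))))))))
    where
    T = d-1 * d ^ n
    weight : suc (1 * T + 0) ≡ 1 + T
    weight = cong suc (trans (ℕP.+-identityʳ _) (*-identityˡ T))
    shift : 1 + T ≡ d ^ n + (1 + suc e * d ^ n)
    shift = sym (+-suc (d ^ n) _)
    w≋d : w ≋ const (ι (+ d)) *ₚ Xₚ +ₚ const 1ℚ
    w≋d = ≋-trans w≋ (+-congˡ (const 1ℚ) (*-congˡ Xₚ (≋-sym const-ιd)))
    eq : Bₙ n ≋ negₚ (Zₙ n *ₚ topₙ n) +ₚ (mainₙ n -ₚ (const (ι (+ d)) *ₚ Xₚ) *ₚ (Zₙ n *ₚ topₙ n))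
    eq = begin
      Bₙ n ≈⟨ Bₙ-split n ⟩
      mainₙ n -ₚ w *ₚ (Zₙ n *ₚ topₙ n) ≈⟨ +-congʳ (mainₙ n) (neg-cong (*-congˡ (Zₙ n *ₚ topₙ n) w≋d)) ⟩
      mainₙ n -ₚ (const (ι (+ d)) *ₚ Xₚ +ₚ const 1ℚ) *ₚ (Zₙ n *ₚ topₙ n)
        ≈⟨ solve 3 (λ m a t → m :- (a :+ con 1ℚ) :* t := (:- t) :+ (m :- a :* t)) ≋-refl (mainₙ n) (const (ι (+ d)) *ₚ Xₚ) (Zₙ n *ₚ topₙ n) ⟩
      negₚ (Zₙ n *ₚ topₙ n) +ₚ (mainₙ n -ₚ (const (ι (+ d)) *ₚ Xₚ) *ₚ (Zₙ n *ₚ topₙ n)) ∎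
      where
      open ≋-Reasoning
      open PolySolver

  coeff-Qₙ : ∀ n i → coeff (Bₙ n) (suc i) ≡ coeff (Qₙ n) i
  coeff-Qₙ n i = at (≋-trans (Bₙ≋X*Qₙ n) (X*≋0∷ (Qₙ n))) (suc i)

  at-0 : Poly → ℚ
  at-0 f = coeff f 0

  Zₙ-at-0 : ∀ n → at-0 (Zₙ n) ≡ 0ℚ
  Zₙ-at-0 n = at (≋-trans (Zₙ≋X*Z′ₙ n) (X*≋0∷ (Z′ₙ n))) 0

  -- The factor Bₙ vanishes at 0. At index 0 the value is - d instead, which forces a separate
  -- treatment of the first constant term.
  Z′ₙ-at-0 : ∀ n → at-0 (Z′ₙ (suc n)) ≡ 0ℚ
  Z′ₙ-at-0 n = trans (coeff₀-* (Z′ₙ n) (Bₙ n)) (trans (cong (at-0 (Z′ₙ n) ℚ.*_)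
    (at (≋-trans (Bₙ≋X*Qₙ n) (X*≋0∷ (Qₙ n))) 0)) (ℚP.*-zeroʳ (at-0 (Z′ₙ n))))

  A-at-0 : at-0 (A d) ≡ ι (+ d)
  A-at-0 = trans (ℚP.*-identityʳ (ℕ→ℚ d)) (sym (ι≡/1 (+ d)))

  w-at-0 : at-0 w ≡ 1ℚ
  w-at-0 = trans (cong (ℚ._+ 1ℚ) (ℚP.*-zeroʳ (ℕ→ℚ d))) (ℚP.+-identityˡ 1ℚ)

  Y₀-at-0 : at-0 (Yₙ 0) ≡ ι (+ d)
  Y₀-at-0 = trans (at F₀.Y₀≋A 0) A-at-0

  Yₙ-suc-at-0 : ∀ n → at-0 (Yₙ (suc n)) ≡ ι (+ d) ℚ.* at-0 (Yₙ n) ^ℚ d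
  Yₙ-suc-at-0 n = trans (coeff₀-* (A d) (s d (suc n) ^ₚ d)) (cong₂ ℚ._*_ A-at-0 (trans (coeff₀-^ (s d (suc n)) d)
    (cong (_^ℚ d) (trans (at (s⁺≋Y+Z (r d n) (s d n)) 0) (trans (coeff-+ (Yₙ n) (Zₙ n) 0)
      (trans (cong (at-0 (Yₙ n) ℚ.+_) (Zₙ-at-0 n)) (ℚP.+-identityʳ (at-0 (Yₙ n)))))))))

  Yₙ-at-0 : ∀ n → Exact (E n) (at-0 (Yₙ n))
  Yₙ-at-0 zero    = subst (Exact 1) (sym Y₀-at-0) M₀.Exact-p
  Yₙ-at-0 (suc n) = subst (Exact (E (suc n))) (sym (Yₙ-suc-at-0 n)) (Exact-* M₀.Exact-p (M₀.Exact-^ d (Yₙ-at-0 n)))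

  Q-at-0 : ∀ n → at-0 (Qₙ n) ≡ (ℚ.- 1ℚ) ℚ.* (ι (+ d) ℚ.* ι (+ d-1) ℚ.* at-0 (Yₙ n) ^ℚ d-1)
               ℚ.+ (ℚ.- 1ℚ) ℚ.* (1ℚ ℚ.* (at-0 (Z′ₙ n) ℚ.* (ι (+ (d C 2)) ℚ.* at-0 (Yₙ n) ^ℚ suc e)))
  Q-at-0 n = trans (coeff-+ (negₚ (Pₙ n)) (negₚ (w *ₚ (Z′ₙ n *ₚ tailₙ n))) 0)
    (cong₂ ℚ._+_
      (trans (coeff-· (ℚ.- 1ℚ) (Pₙ n) 0) (cong ((ℚ.- 1ℚ) ℚ.*_) (trans (coeff₀-* (const (ι (+ d)) *ₚ δ) (Yₙ n ^ₚ d-1))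
        (cong₂ ℚ._*_ (coeff₀-* (const (ι (+ d))) δ) (coeff₀-^ (Yₙ n) d-1)))))
      (trans (coeff-· (ℚ.- 1ℚ) (w *ₚ (Z′ₙ n *ₚ tailₙ n)) 0) (cong ((ℚ.- 1ℚ) ℚ.*_) (trans (coeff₀-* w (Z′ₙ n *ₚ tailₙ n))
        (cong₂ ℚ._*_ w-at-0 (trans (coeff₀-* (Z′ₙ n) (tailₙ n)) (cong (at-0 (Z′ₙ n) ℚ.*_) tail-at-0)))))))
    where
    tail-at-0 : at-0 (tailₙ n) ≡ ι (+ (d C 2)) ℚ.* at-0 (Yₙ n) ^ℚ suc e
    tail-at-0 = trans (coeff-+ (const (ι (+ (d C 2))) *ₚ Yₙ n ^ₚ suc e) (Zₙ n *ₚ rest) 0)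
      (trans (cong₂ ℚ._+_ (trans (coeff₀-* (const (ι (+ (d C 2)))) (Yₙ n ^ₚ suc e)) (cong (ι (+ (d C 2)) ℚ.*_) (coeff₀-^ (Yₙ n) (suc e))))
                          (trans (coeff₀-* (Zₙ n) rest) (trans (cong (ℚ._* at-0 rest) (Zₙ-at-0 n)) (ℚP.*-zeroˡ (at-0 rest)))))
             (ℚP.+-identityʳ (ι (+ (d C 2)) ℚ.* at-0 (Yₙ n) ^ℚ suc e)))
      where rest = homSum (λ j → d C suc (suc (suc j))) (Yₙ n) (Zₙ n) e

  private
    [d-1]-exact : Exact 0 (ι (+ d-1))
    [d-1]-exact = M₀.Exact-ι (M₀.p∤-small ≤-refl)

    2*dC2 : 2 * (d C 2) ≡ d * d-1
    2*dC2 = trans ([k+1]*[n+1]C[k+1] d-1 1) (cong (d ℕ.*_) (nC1≡n d-1))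

    -- d C 2 = d h with 2 h = d - 1
    dC2-exact : Exact 1 (ι (+ (d C 2)))
    dC2-exact = go (prime∣C pp 1 (s≤s (s≤s (s≤s z≤n))))
      where
      go : d ℕD.∣ d C 2 → Exact 1 (ι (+ (d C 2)))
      go (ℕD.divides h eq) = subst (Exact 1) (trans (sym (ι-* (+ d) (+ h))) (cong ι (trans (sym (ℤP.pos-* d h)) (cong +_ (trans (ℕP.*-comm d h) (sym eq))))))
          (Exact-* M₀.Exact-p (M₀.Exact-ι λ d∣h → M₀.p∤-small (≤-refl {d}) (subst (λ k → + d ∣ + k) 2h
            (subst (+ d ∣_) (sym (ℤP.pos-* 2 h)) (ℤD.∣n⇒∣m*n (+ 2) d∣h)))))
        where
        2h : 2 * h ≡ d-1
        2h = ℕP.*-cancelˡ-≡ (2 * h) d-1 d (trans (trans (solve 2 (λ d h → d :* (con 2 :* h) := con 2 :* (h :* d)) refl d h)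
          (cong (2 ℕ.*_) (sym eq))) 2*dC2)
          where open ℕSolver.+-*-Solver

  -- For positive index only the term in Yₙ(0)ᵈ⁻¹ survives; its valuation is 1 + (d - 1) E n = dⁿ⁺¹.
  Qₙ-at-0 : ∀ n → Exact (d ^ suc n) (coeff (Qₙ n) 0)
  Qₙ-at-0 (suc n) = subst₂ Exact
    (trans (solve 2 (λ E e → con 0 :+ ((con 1 :+ con 0) :+ (con 2 :+ e) :* E) := con 1 :+ (con 2 :+ e) :* E) refl (E (suc n)) e) (E-eq (suc n)))
    (sym (trans (Q-at-0 (suc n)) (trans (cong (λ z → M ℚ.+ (ℚ.- 1ℚ) ℚ.* (1ℚ ℚ.* (z ℚ.* K))) (Z′ₙ-at-0 n))
      (QS.solve 2 (λ M B → M QS.:+ QS.con (ℚ.- 1ℚ) QS.:* (QS.con 1ℚ QS.:* (QS.con 0ℚ QS.:* B)) QS.:= M) refl M K))))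
    (Exact-* M₀.Exact--1 (Exact-* (Exact-* M₀.Exact-p [d-1]-exact) (M₀.Exact-^ d-1 (Yₙ-at-0 (suc n)))))
    where
    module QS = ℚSolver.+-*-Solver
    open ℕSolver.+-*-Solver
    M = (ℚ.- 1ℚ) ℚ.* (ι (+ d) ℚ.* ι (+ d-1) ℚ.* at-0 (Yₙ (suc n)) ^ℚ d-1)
    K = ι (+ (d C 2)) ℚ.* at-0 (Yₙ (suc n)) ^ℚ suc e
  -- Here both summands contribute: - d (d-1) dᵈ⁻¹ + d (d C 2) dᵈ⁻² = - (d C 2) dᵈ⁻¹.
  Qₙ-at-0 zero = subst₂ Exact
    (solve 1 (λ e → con 0 :+ (con 1 :+ (con 2 :+ e) :* con 1) := (con 3 :+ e) :* con 1) refl e)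
    (sym (trans (Q-at-0 0) (trans (cong (λ y → (ℚ.- 1ℚ) ℚ.* (D ℚ.* ι (+ d-1) ℚ.* (y ℚ.* y ^ℚ suc e)) ℚ.+ (ℚ.- 1ℚ) ℚ.* (1ℚ ℚ.* (((ℚ.- 1ℚ) ℚ.* D) ℚ.* (K ℚ.* y ^ℚ suc e))))
       Y₀-at-0)
     (trans (QS.solve 4 (λ D G B P → QS.con (ℚ.- 1ℚ) QS.:* (D QS.:* G QS.:* (D QS.:* P)) QS.:+ QS.con (ℚ.- 1ℚ) QS.:* (QS.con 1ℚ QS.:* ((QS.con (ℚ.- 1ℚ) QS.:* D) QS.:* (B QS.:* P)))
          QS.:= (D QS.:* P) QS.:* (B QS.:- D QS.:* G)) refl D (ι (+ d-1)) K (D ^ℚ suc e))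
       (trans (cong (λ z → (D ℚ.* D ^ℚ suc e) ℚ.* (K ℚ.- z)) DG)
         (QS.solve 2 (λ B P → P QS.:* (B QS.:- (B QS.:+ B)) QS.:= QS.con (ℚ.- 1ℚ) QS.:* (B QS.:* P)) refl K (D ℚ.* D ^ℚ suc e)))))))
    (Exact-* M₀.Exact--1 (Exact-* dC2-exact (M₀.Exact-^ d-1 M₀.Exact-p)))
    where
    module QS = ℚSolver.+-*-Solver
    open ℕSolver.+-*-Solver
    D = ι (+ d)
    K = ι (+ (d C 2))
    DG : D ℚ.* ι (+ d-1) ≡ K ℚ.+ K
    DG = trans (sym (ι-* (+ d) (+ d-1))) (trans (cong ι (trans (sym (ℤP.pos-* d d-1)) (cong +_ (trans (sym 2*dC2)
      (cong ((d C 2) ℕ.+_) (ℕP.+-identityʳ (d C 2))))))) (ι-+ (+ (d C 2)) (+ (d C 2))))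

-- The normalised polynomial, its segment, and the degree bound

module Polynomials (e : ℕ) (pp : Prime (3 + e)) where
  open Normalised e pp public

  d≢0 : ℕ.NonZero d
  d≢0 = prime⇒nonZero pp

  -- The degree of 𝒢ₙ₊₁ modulo d after removal of the content
  N : ℕ → ℕ
  N n = d-1 * d ^ n ∸ 1

  private
    1≤d^ : ∀ n → 1 ≤ d ^ n
    1≤d^ n = ℕP.n≢0⇒n>0 (ℕ.≢-nonZero⁻¹ (d ^ n) {{ℕP.m^n≢0 d n}})

  N+1≡ : ∀ n → suc (N n) ≡ d-1 * d ^ n
  N+1≡ n = ℕP.m+[n∸m]≡n (≤-trans (1≤d^ n) (m≤m+n (d ^ n) _))

  L≤N : ∀ n → d ^ n ≤ N n
  L≤N n = ≤-pred (begin
    suc (d ^ n) ≤⟨ +-monoˡ-≤ (d ^ n) (1≤d^ n) ⟩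
    d ^ n + d ^ n ≤⟨ +-monoʳ-≤ (d ^ n) (m≤m+n (d ^ n) _) ⟩
    d-1 * d ^ n ≡⟨ N+1≡ n ⟨
    suc (N n) ∎)
    where open ℕP.≤-Reasoning

  N≢0 : ∀ n → ℕ.NonZero (N n)
  N≢0 n = ℕ.>-nonZero (≤-trans (1≤d^ n) (L≤N n))

  module Final (n : ℕ) where
    private instance
      Nn≢0 = N≢0 n
    L = d ^ n
    open Newton d pp (N n) L {{Nn≢0}} public
    open Slope n (N n) (N+1≡ n) public using (V-Qₙ)

    c : ℚ
    c = ι (+ (d ^ suc (N n)))

    private
      inv = inverse (ι≢0 (d ^ suc (N n)) {{ℕP.m^n≢0 d (suc (N n)) {{d≢0}}}})
      u = proj₁ inv
      u*c≡1 : u ℚ.* c ≡ 1ℚ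
      u*c≡1 = proj₂ inv

    -- The divisor d^(N+1) is the exact power of d in the content of Qₙ; after the division the
    -- coefficient of index N is prime to d.
    H : Poly
    H = u ·ₚ Qₙ n

    c·H≋Q : c ·ₚ H ≋ Qₙ n
    c·H≋Q = ≋-trans (·-·-assoc c u (Qₙ n)) (≋-trans (≡⇒≋ (cong (_·ₚ Qₙ n) (trans (ℚP.*-comm c u) u*c≡1))) (1·-identity (Qₙ n)))

    private
      unscale : ∀ k z → u ℚ.* ι (z ℤ.* + (d ^ (k + suc (N n)))) ≡ ι (z ℤ.* + (d ^ k))
      unscale k z = begin
        u ℚ.* ι (z ℤ.* + (d ^ (k + suc (N n))))
          ≡⟨ cong (λ x → u ℚ.* ι (z ℤ.* x)) (trans (cong +_ (^-distribˡ-+-* d k (suc (N n)))) (ℤP.pos-* (d ^ k) (d ^ suc (N n)))) ⟩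
        u ℚ.* ι (z ℤ.* (+ (d ^ k) ℤ.* + (d ^ suc (N n))))
          ≡⟨ cong (u ℚ.*_) (trans (cong ι (sym (ℤP.*-assoc z (+ (d ^ k)) _))) (ι-* (z ℤ.* + (d ^ k)) _)) ⟩
        u ℚ.* (ι (z ℤ.* + (d ^ k)) ℚ.* c)
          ≡⟨ solve 3 (λ u a c → u :* (a :* c) := (u :* c) :* a) refl u (ι (z ℤ.* + (d ^ k))) c ⟩
        (u ℚ.* c) ℚ.* ι (z ℤ.* + (d ^ k))
          ≡⟨ trans (cong (ℚ._* ι (z ℤ.* + (d ^ k))) u*c≡1) (ℚP.*-identityˡ _) ⟩
        ι (z ℤ.* + (d ^ k)) ∎
        where
        open ≡-Reasoning
        open ℚSolver.+-*-Solver

      unscale-Multiple : ∀ k {x} → Multiple (d ^ (k + suc (N n))) x → Multiple (d ^ k) (u ℚ.* x)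
      unscale-Multiple k (_ , refl , divides z refl) = z ℤ.* + (d ^ k) , unscale k z , divides z refl

      unscale-Exact : ∀ k {x} → Exact (k + suc (N n)) x → Exact k (u ℚ.* x)
      unscale-Exact k (exactly z refl h) = exactly z (unscale k z) h

      Q-Multiple : ∀ i → Multiple (d ^ suc (N n)) (coeff (Qₙ n) i)
      Q-Multiple i = go (V₀.wt (M₀.MinAt.V-minAt (MinAt-Bₙ n)) (suc i))
        where
        module V₀ = Newton d pp 1 0
        go : V₀.Wt (1 * (d-1 * L) + 0) (suc i) (coeff (Bₙ n) (suc i)) → Multiple (d ^ suc (N n)) (coeff (Qₙ n) i)
        go (k , m , le) = Multiple-∣ (^-∣ d (subst₂ _≤_ (trans (ℕP.+-identityʳ _) (trans (*-identityˡ _) (sym (N+1≡ n))))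
          (trans (ℕP.+-identityʳ _) (*-identityˡ k)) le)) (subst (Multiple (d ^ k)) (coeff-Qₙ n i) m)

      -- If the weight bound for Qₙ provides too few factors d, it forces i to be at least N. There
      -- exponent 0 is enough, and integrality comes from the content.
      H-wt : ∀ i → Wt (N n * L) i (coeff H i)
      H-wt i = Wt-≡ (sym (coeff-· u (Qₙ n) i)) (go (wt V-Qₙ i))
        where
        go : Wt (N n * suc (N n) + L * N n) i (coeff (Qₙ n) i) → Wt (N n * L) i (u ℚ.* coeff (Qₙ n) i)
        go (k , m , le) with ≤-total k (suc (N n))
        ... | inj₁ k≤ = 0 , unscale-Multiple 0 (Q-Multiple i) , (begin
            N n * L ≡⟨ ℕP.*-comm (N n) L ⟩
            L * N n ≤⟨ +-cancelˡ-≤ (N n * suc (N n)) (L * N n) (L * i)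
                                                 (≤-trans le (+-monoˡ-≤ (L * i) (*-monoʳ-≤ (N n) k≤))) ⟩
            L * i ≡⟨ cong (ℕ._+ L * i) (*-zeroʳ (N n)) ⟨
            N n * 0 + L * i ∎)
          where open ℕP.≤-Reasoning
        ... | inj₂ ≤k = k ∸ suc (N n) , unscale-Multiple (k ∸ suc (N n)) (subst (λ k → Multiple (d ^ k) _) (sym k≡) m)
          , +-cancelˡ-≤ (N n * suc (N n)) (N n * L) _ (begin
            N n * suc (N n) + N n * L ≡⟨ cong (N n * suc (N n) ℕ.+_) (ℕP.*-comm (N n) L) ⟩
            N n * suc (N n) + L * N n ≤⟨ le ⟩
            N n * k + L * i ≡⟨ cong (λ k → N n * k + L * i) k≡ ⟨
            N n * (k ∸ suc (N n) + suc (N n)) + L * i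
              ≡⟨ solve 4 (λ N a b c → N :* (a :+ b) :+ c := N :* b :+ (N :* a :+ c)) refl (N n) (k ∸ suc (N n)) (suc (N n)) (L * i) ⟩
            N n * suc (N n) + (N n * (k ∸ suc (N n)) + L * i) ∎)
          where
          open ℕP.≤-Reasoning
          open ℕSolver.+-*-Solver
          k≡ : k ∸ suc (N n) + suc (N n) ≡ k
          k≡ = ℕP.m∸n+n≡m ≤k

    H-int : Integral H
    H-int i = go (wt (V-mono z≤n (mkV {f = H} H-wt)) i)
      where
      go : Wt 0 i (coeff H i) → IsInt (coeff H i)
      go (k , (z , eq , _) , _) = z , eq

    -- The remaining valuation is dⁿ⁺¹ - (d - 1) dⁿ = dⁿ.
    H-at-0 : Exact L (coeff H 0)
    H-at-0 = subst (Exact L) (sym (coeff-· u (Qₙ n) 0)) (unscale-Exact L (subst (λ k → Exact k (coeff (Qₙ n) 0))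
      (trans (cong (L ℕ.+_) (sym (N+1≡ n))) refl) (Qₙ-at-0 n)))

    H-at-N : Exact 0 (coeff H (N n))
    H-at-N = subst (Exact 0) (sym (coeff-· u (Qₙ n) (N n))) (unscale-Exact 0 (subst₂ Exact (sym (N+1≡ n))
      (trans (cong (coeff (Bₙ n)) (sym (N+1≡ n))) (coeff-Qₙ n (N n))) (M₀.MinAt.exact-i (MinAt-Bₙ n))))

    H-Two : Two H
    H-Two = record
      { i = 0 ; j = N n ; e = L ; e′ = 0 ; i<j = ℕ.>-nonZero⁻¹ (N n) ; exact-i = H-at-0 ; exact-j = H-at-N
      ; sameWt = trans w₀ (trans (ℕP.*-comm (N n) L) (cong (ℕ._+ L * N n) (sym (*-zeroʳ (N n)))))
      ; V-min = V-mono (≤-reflexive w₀) (mkV H-wt) }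
      where
      w₀ : N n * L + L * 0 ≡ N n * L
      w₀ = trans (cong (N n * L ℕ.+_) (*-zeroʳ L)) (ℕP.+-identityʳ _)

    -- N + 1 is a multiple of `L`, so a common divisor divides 1.
    coprime : Coprime (N n) L
    coprime {k} (k∣N , k∣L) = ℕD.∣1⇒≡1 (ℕD.∣m+n∣m⇒∣n (subst (k ℕD.∣_)
      (trans (sym (N+1≡ n)) (ℕP.+-comm 1 (N n))) (ℕD.∣n⇒∣m*n d-1 k∣L)) k∣N)

    N≤deg : ∀ {f} → Two f → N n ≤ deg f
    N≤deg = Two⇒N≤deg coprime

    H≢0 : ¬ H ≋ []
    H≢0 eq = Exact⇒≢0 H-at-0 (at eq 0)

    deg-H : deg H ≡ deg (Qₙ n)
    deg-H = ∼⇒deg≡ (mk∼ c (ι≢0 (d ^ suc (N n)) {{ℕP.m^n≢0 d (suc (N n)) {{d≢0}}}}) (≋-sym c·H≋Q))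

    calG∼H : H ∼ calG d (suc n)
    calG∼H = ∼-trans (mk∼ c (ι≢0 (d ^ suc (N n)) {{ℕP.m^n≢0 d (suc (N n)) {{d≢0}}}}) (≋-sym c·H≋Q))
      (mk∼ (oneOver d) oneOver≢0 (calG≋ n))
      where
      oneOver≢0 : oneOver d ≢ 0ℚ
      oneOver≢0 = inverse≢0 {ι (+ d)} (trans (ℚP.*-comm (oneOver d) (ι (+ d))) (d*oneOver≡1 d))

    -- The factor that inherits the segment already uses up the whole degree, so the other one is
    -- constant.
    irreducible-if-degree : deg H ≡ N n → IrreducibleQ H
    irreducible-if-degree degH = irreducible-if H H-int H≢0
        (λ z → ℕ.≢-nonZero⁻¹ (N n) (trans (sym degH) z)) none
      where
      none : ¬ ProperFactors H
      none F = Sum.[ (λ tf → g-nonconst (zero-of (N≤deg {f} tf) (trans (sym deg-fg) degH)))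
                   , (λ tg → f-nonconst (zero-of (N≤deg {g} tg) (trans (ℕP.+-comm (deg g) (deg f)) (trans (sym deg-fg) degH)))) ]′
                   (Two-factor {f} {g} f-int g-int fg≋Q H-Two)
        where
        open ProperFactors F
        fg≢0 : ¬ f *ₚ g ≋ []
        fg≢0 eq = H≢0 (≋-trans (≋-sym fg≋Q) eq)
        deg-fg : deg H ≡ deg f + deg g
        deg-fg = trans (deg-cong (≋-sym fg≋Q)) (deg-* (*≢0⇒≢0ˡ {f} {g} fg≢0) (*≢0⇒≢0ʳ {f} {g} fg≢0))
        zero-of : ∀ {a b m} → m ≤ a → a + b ≡ m → b ≡ 0
        zero-of {a} {b} {m} m≤a eq = ℕP.m+n≡0⇒n≡0 0 (n≤0⇒n≡0 (+-cancelˡ-≤ a b 0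
          (≤-trans (≤-reflexive eq) (≤-trans m≤a (m≤m+n a 0)))))

  DegLE-A : DegLE (A d) 1
  DegLE-A = DegLE-· (ℕ→ℚ d) {Xₚ +ₚ const 1ℚ} (DegLE-+ {Xₚ} {const 1ℚ} DegLE-X (DegLE-const 1ℚ 1))

  DegLE-w : DegLE w 1
  DegLE-w = DegLE-+ {ℕ→ℚ d ·ₚ Xₚ} {const 1ℚ} (DegLE-· (ℕ→ℚ d) {Xₚ} DegLE-X) (DegLE-const 1ℚ 1)

  K : ℕ
  K = d ^ d ∸ 1

  K+1≡ : suc K ≡ d ^ d
  K+1≡ = ℕP.m+[n∸m]≡n (1≤d^ d)

  -- The difference ρ - σ of the two degree bounds runs periodically through 2 - d, …, 1.
  record DegreeBound (n : ℕ) : Set where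
    field
      σ ρ i   : ℕ
      s-deg   : DegLE (s d n) σ
      r-deg   : DegLE (r d n) ρ
      1≤i     : 1 ≤ i
      i≤d     : i ≤ d
      -- An exact solution of the recursion for σ; dropping dⁱ gives the bound d^(d-1+n) / (dᵈ - 1).
      size    : K * σ + d ^ i ≡ d ^ (d-1 + n)
      balance : ρ + d ≡ σ + suc i

  bound₀ : DegreeBound 0
  bound₀ = record
    { σ = 0 ; ρ = 0 ; i = d-1 ; s-deg = DegLE-const 1ℚ 0 ; r-deg = DegLE-const 1ℚ 0
    ; 1≤i = s≤s z≤n ; i≤d = n≤1+n _
    ; size = trans (cong (ℕ._+ d ^ d-1) (*-zeroʳ K)) (cong (d ℕ.^_) (sym (ℕP.+-identityʳ d-1)))
    ; balance = refl }

  DegLE-s-suc : ∀ n {k} → DegLE (r d n) k → DegLE (s d n) k → DegLE (s d (suc n)) (d * k)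
  DegLE-s-suc n hr hs = DegLE-+ {r d n ^ₚ d} {ℕ→ℚ d-1 ·ₚ s d n ^ₚ d} (DegLE-^ d (r d n) hr)
    (DegLE-· (ℕ→ℚ d-1) {s d n ^ₚ d} (DegLE-^ d (s d n) hs))

  DegLE-r-suc : ∀ n {ρ σ} → DegLE (r d n) ρ → DegLE (s d n) σ → DegLE (r d (suc n)) (1 + ρ + d-1 * σ)
  DegLE-r-suc n hr hs = DegLE-* (A d *ₚ r d n) (s d n ^ₚ d-1) (DegLE-* (A d) (r d n) DegLE-A hr) (DegLE-^ d-1 (s d n) hs)

  -- For i < d the bound for r does not exceed that for s, and d σ serves for the next s. For i = d
  -- it exceeds it by one, d (σ + 1) is needed, and the difference of the new bounds falls back to 2
  -- - d.
  bound-suc : ∀ {n} (b : DegreeBound n) → Σ (DegreeBound (suc n)) λ b′ → d * DegreeBound.σ b ≤ DegreeBound.σ b′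
  bound-suc {n} b with ℕP.m≤n⇒m<n∨m≡n (DegreeBound.i≤d b)
  ... | inj₁ i<d = record
      { σ = d * σ ; ρ = 1 + ρ + d-1 * σ ; i = suc i
      ; s-deg = DegLE-s-suc n (DegLE-mono ρ≤σ r-deg) s-deg
      ; r-deg = DegLE-r-suc n r-deg s-deg
      ; 1≤i = s≤s z≤n ; i≤d = i<d
      ; size = trans (solve 4 (λ K d σ t → K :* (d :* σ) :+ d :* t := d :* (K :* σ :+ t)) refl K d σ (d ^ i))
          (trans (cong (d ℕ.*_) size) (cong (d ℕ.^_) (sym (+-suc (suc (suc e)) n))))
      ; balance = trans (solve 3 (λ ρ e σ → con 1 :+ ρ :+ (con 2 :+ e) :* σ :+ (con 3 :+ e) := (ρ :+ (con 3 :+ e)) :+ con 1 :+ (con 2 :+ e) :* σ) refl ρ e σ)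
          (trans (cong (λ x → x + 1 + d-1 * σ) balance)
            (solve 3 (λ i e σ → σ :+ (con 1 :+ i) :+ con 1 :+ (con 2 :+ e) :* σ := (con 3 :+ e) :* σ :+ (con 2 :+ i)) refl i e σ)) }
    , ≤-refl
    where
    open DegreeBound b
    open ℕSolver.+-*-Solver
    ρ≤σ : ρ ≤ σ
    ρ≤σ = +-cancelʳ-≤ d ρ σ (≤-trans (≤-reflexive balance) (+-monoʳ-≤ σ i<d))
  ... | inj₂ i≡d = record
      { σ = d * suc σ ; ρ = 1 + ρ + d-1 * σ ; i = 1
      ; s-deg = DegLE-s-suc n (DegLE-mono (≤-reflexive ρ≡) r-deg) (DegLE-mono (n≤1+n σ) s-deg)
      ; r-deg = DegLE-r-suc n r-deg s-deg
      ; 1≤i = s≤s z≤n ; i≤d = s≤s z≤n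
      ; size = trans (solve 3 (λ K d σ → K :* (d :* (con 1 :+ σ)) :+ d :* con 1 := d :* (K :* σ :+ (con 1 :+ K))) refl K d σ)
          (trans (cong (λ t → d * (K * σ + t)) (trans K+1≡ (cong (d ℕ.^_) (sym i≡d))))
            (trans (cong (d ℕ.*_) size) (cong (d ℕ.^_) (sym (+-suc (suc (suc e)) n)))))
      ; balance = trans (cong (λ ρ → 1 + ρ + d-1 * σ + d) ρ≡)
          (solve 2 (λ e σ → con 1 :+ (con 1 :+ σ) :+ (con 2 :+ e) :* σ :+ (con 3 :+ e) := (con 3 :+ e) :* (con 1 :+ σ) :+ con 2) refl e σ) }
    , *-monoʳ-≤ d (n≤1+n σ)
    where
    open DegreeBound b
    open ℕSolver.+-*-Solver
    ρ≡ : ρ ≡ suc σ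
    ρ≡ = ℕP.+-cancelʳ-≡ d ρ (suc σ) (trans balance (trans (cong (λ i → σ + suc i) i≡d) (+-suc σ d)))

  bound : ∀ n → DegreeBound n
  bound zero    = bound₀
  bound (suc n) = proj₁ (bound-suc (bound n))

  -- Both arguments of the geometric quotient receive the common bound σ′ + 1: Yₙ has degree at most
  -- 1 + d σ, and d σ ≤ σ′.
  DegLE-B : ∀ n → DegLE (Bₙ n) (d + d-1 * DegreeBound.σ (bound (suc n)))
  DegLE-B n = DegLE-+ {A d ^ₚ d *ₚ s d n ^ₚ (d * d-1)} {negₚ (w *ₚ geomQuot d (s d (suc n)) (Yₙ n))}
    (DegLE-mono le₁ (DegLE-* (A d ^ₚ d) (s d n ^ₚ (d * d-1)) (DegLE-^ d (A d) DegLE-A) (DegLE-^ (d * d-1) (s d n) s-deg)))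
    (DegLE-neg (w *ₚ geomQuot d (s d (suc n)) (Yₙ n)) (DegLE-mono le₂
      (DegLE-* w (geomQuot d (s d (suc n)) (Yₙ n)) DegLE-w (DegLE-geomQuot d-1 (s d (suc n)) (Yₙ n)
        (DegLE-mono (n≤1+n σ′) (DegreeBound.s-deg b′))
        (DegLE-mono (s≤s dσ≤) (DegLE-* (A d) (s d n ^ₚ d) DegLE-A (DegLE-^ d (s d n) s-deg)))))))
    where
    open DegreeBound (bound n)
    open ℕSolver.+-*-Solver
    b′ = bound (suc n)
    σ′ = DegreeBound.σ b′
    dσ≤ : d * σ ≤ σ′
    dσ≤ = proj₂ (bound-suc (bound n))
    le₁ : d * 1 + (d * d-1) * σ ≤ d + d-1 * σ′
    le₁ = +-mono-≤ (≤-reflexive (*-identityʳ d)) (≤-trans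
      (≤-reflexive (solve 3 (λ d g σ → d :* g :* σ := g :* (d :* σ)) refl d d-1 σ)) (*-monoʳ-≤ d-1 dσ≤))
    le₂ : 1 + d-1 * suc σ′ ≤ d + d-1 * σ′
    le₂ = ≤-reflexive (solve 2 (λ e σ → con 1 :+ (con 2 :+ e) :* (con 1 :+ σ) := (con 3 :+ e) :+ (con 2 :+ e) :* σ) refl e σ′)

  -- By `size`, K (d - 1) σ is at most dᵈ (N + 1). The constant added to N disappears in the limit.
  K*deg-Q : ∀ n → K * deg (Qₙ n) ≤ d ^ d * (N n + suc d)
  K*deg-Q n = begin
    K * deg (Qₙ n) ≤⟨ *-monoʳ-≤ K (DegLE⇒deg≤ (Qₙ n) (mkDegLE λ i lt → trans (sym (coeff-Qₙ n i)) (above (DegLE-B n) (suc i) (ℕP.m<n⇒m<1+n lt)))) ⟩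
    K * (d + d-1 * σ) ≡⟨ solve 4 (λ K d g σ → K :* (d :+ g :* σ) := K :* d :+ g :* (K :* σ)) refl K d d-1 σ ⟩
    K * d + d-1 * (K * σ) ≤⟨ +-mono-≤ (ℕP.*-monoˡ-≤ d (≤-trans (n≤1+n K) (≤-reflexive K+1≡)))
                                                       (*-monoʳ-≤ d-1 (≤-trans (m≤m+n (K * σ) (d ^ i)) (≤-reflexive (trans size
                                                         (trans (cong (d ℕ.^_) (+-suc (suc (suc e)) n)) (^-distribˡ-+-* d d n)))))) ⟩
    d ^ d * d + d-1 * (d ^ d * d ^ n)
                                                  ≡⟨ solve 4 (λ D d g t → D :* d :+ g :* (D :* t) := D :* (d :+ g :* t)) refl (d ^ d) d d-1 (d ^ n) ⟩
    d ^ d * (d + d-1 * d ^ n) ≡⟨ cong (λ t → d ^ d * (d + t)) (N+1≡ n) ⟨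
    d ^ d * (d + suc (N n)) ≡⟨ cong (d ^ d ℕ.*_) (trans (+-suc d (N n)) (trans (cong suc (ℕP.+-comm d (N n))) (sym (+-suc (N n) d)))) ⟩
    d ^ d * (N n + suc d) ∎
    where
    open DegreeBound (bound (suc n))
    open ℕP.≤-Reasoning
    open ℕSolver.+-*-Solver

-- Exact degrees for n + 1 ≤ d

module SmallIndex (e : ℕ) (pp : Prime (3 + e)) where
  open Polynomials e pp public

  D : ℚ
  D = ι (+ d)

  D≢0 : D ≢ 0ℚ
  D≢0 = ι≢0 d

  ℕ→ℚd≡D : ℕ→ℚ d ≡ D
  ℕ→ℚd≡D = sym (ι≡/1 (+ d))

  Lead-A : Lead (A d) 1 D
  Lead-A = mkLead (trans (ℚP.*-identityʳ (ℕ→ℚ d)) ℕ→ℚd≡D) DegLE-A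

  Lead-w : Lead w 1 D
  Lead-w = mkLead (trans (ℚP.*-identityʳ (ℕ→ℚ d)) ℕ→ℚd≡D) DegLE-w

  s₁≋D : s d 1 ≋ const D
  s₁≋D = ≋-trans (+-cong (1^ d) (·-cong (ℕ→ℚ d-1) (1^ d))) (const-cong
    (trans (cong (1ℚ ℚ.+_) (ℚP.*-identityʳ (ℕ→ℚ d-1))) (trans (cong₂ ℚ._+_ (sym ι-1) (sym (ι≡/1 (+ d-1)))) (sym (ι-+ (+ 1) (+ d-1))))))

  r₁≋A : r d 1 ≋ A d
  r₁≋A = ≋-trans (*-cong (CommutativeRing.*-identityʳ polyRing (A d)) (1^ d-1)) (CommutativeRing.*-identityʳ polyRing (A d))

  private
    Lead-r₁ : Lead (r d 1) 1 D
    Lead-r₁ = Lead-cong (≋-sym r₁≋A) Lead-A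

    DegLE-s₁ : DegLE (s d 1) 0
    DegLE-s₁ = DegLE-cong (≋-sym s₁≋D) (DegLE-const D 0)

    d*0<d*1 : d * 0 < d * 1
    d*0<d*1 = *-monoʳ-< d {0} {1} (s≤s z≤n)

    Lead-s₂ : Lead (s d 2) (d * 1) (D ^ℚ d)
    Lead-s₂ = Lead-+-lower (Lead-^ d (r d 1) Lead-r₁)
      (DegLE-· (ℕ→ℚ d-1) {s d 1 ^ₚ d} (DegLE-^ d (s d 1) DegLE-s₁)) d*0<d*1

    -- When the degree of r does not exceed that of s, the linear factor w lets w sᵈ dominate rᵈ.
    Lead-Z : ∀ n {S ρ l} → Lead (s d n) S l → DegLE (r d n) ρ → ρ ≤ S →
      Lead (Zₙ n) (1 + d * S) ((ℚ.- 1ℚ) ℚ.* (D ℚ.* l ^ℚ d))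
    Lead-Z n {S} {ρ} hs hr ρ≤S = Lead-cong (+-comm (negₚ (w *ₚ s d n ^ₚ d)) (r d n ^ₚ d)) (Lead-+-lower
      (Lead-· (ℚ.- 1ℚ) (Lead-* w (s d n ^ₚ d) Lead-w (Lead-^ d (s d n) hs))) (DegLE-^ d (r d n) hr) (s≤s (*-monoʳ-≤ d ρ≤S)))

  Lead-Z₀ : Lead (Zₙ 0) 1 (1ℚ ℚ.* ((ℚ.- 1ℚ) ℚ.* D))
  Lead-Z₀ = Lead-cong (≋-sym (Zₙ≋X*Z′ₙ 0)) (Lead-* Xₚ (Z′ₙ 0) Lead-X (Lead-· (ℚ.- 1ℚ) (Lead-const D)))

  -- Since s₁ is the constant d, here rᵈ dominates and the degree is d instead of d + 1. This is the
  -- origin of the exception at n = 1.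
  Lead-Z₁ : Lead (Zₙ 1) (d * 1) (D ^ℚ d)
  Lead-Z₁ = Lead-+-lower (Lead-^ d (r d 1) Lead-r₁) (DegLE-neg (w *ₚ s d 1 ^ₚ d) (DegLE-* w (s d 1 ^ₚ d) DegLE-w (DegLE-^ d (s d 1) DegLE-s₁)))
    (subst₂ _<_ (cong suc (sym (*-zeroʳ d))) (sym (*-identityʳ d)) (s≤s (s≤s z≤n)))

  Lead-Z₂ : Lead (Zₙ 2) (1 + d * (d * 1)) ((ℚ.- 1ℚ) ℚ.* (D ℚ.* (D ^ℚ d) ^ℚ d))
  Lead-Z₂ = Lead-Z 2 Lead-s₂ (DegLE-r-suc 1 (degLE Lead-r₁) DegLE-s₁)
    (subst₂ _≤_ (cong (2 ℕ.+_) (sym (*-zeroʳ d-1))) (sym (*-identityʳ d)) (s≤s (s≤s z≤n)))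

  record Degrees (j : ℕ) : Set where
    field
      l       : ℚ
      ρ       : ℕ
      l≢0     : l ≢ 0ℚ
      s-lead  : Lead (s d (2 + j)) (d ^ suc j) l
      r-deg   : DegLE (r d (2 + j)) ρ
      -- The bound ρ ≤ dʲ⁺¹ amounts to 2 + j ≤ d; the range m ≤ d comes from here.
      balance : ρ + d ≡ d ^ suc j + (2 + j)

  degrees : ∀ j → 2 + j ≤ d → Degrees j
  degrees zero    le = record
    { l = D ^ℚ d ; ρ = 1 + 1 + d-1 * 0 ; l≢0 = ^ℚ-≢0 d D≢0 ; s-lead = Lead-s₂
    ; r-deg = DegLE-r-suc 1 (degLE Lead-r₁) DegLE-s₁
    ; balance = solve 1 (λ e → con 2 :+ (con 2 :+ e) :* con 0 :+ (con 3 :+ e) := (con 3 :+ e) :* con 1 :+ con 2) refl e }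
    where open ℕSolver.+-*-Solver
  degrees (suc j) le = record
    { l = c ℚ.* l ^ℚ d ; ρ = 1 + ρ + d-1 * S
    ; l≢0 = ℚ-integral (λ eq → ι≢0 d-1 (trans (ι≡/1 (+ d-1)) eq)) (^ℚ-≢0 d l≢0)
    ; s-lead = Lead-cong (+-comm (c ·ₚ s d (2 + j) ^ₚ d) (r d (2 + j) ^ₚ d)) (Lead-+-lower (Lead-· c (Lead-^ d (s d (2 + j)) s-lead))
        (DegLE-^ d (r d (2 + j)) r-deg) (*-monoʳ-< d ρ<S))
    ; r-deg = DegLE-r-suc (2 + j) r-deg (degLE s-lead)
    ; balance = trans (solve 3 (λ ρ e S → con 1 :+ ρ :+ (con 2 :+ e) :* S :+ (con 3 :+ e) := (ρ :+ (con 3 :+ e)) :+ con 1 :+ (con 2 :+ e) :* S) refl ρ e S)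
        (trans (cong (λ x → x + 1 + d-1 * S) balance)
          (solve 3 (λ j e S → S :+ (con 2 :+ j) :+ con 1 :+ (con 2 :+ e) :* S := (con 3 :+ e) :* S :+ (con 3 :+ j)) refl j e S)) }
    where
    open Degrees (degrees j (≤-trans (n≤1+n _) le))
    open ℕSolver.+-*-Solver
    c = ℕ→ℚ d-1
    S = d ^ suc j
    ρ<S : ρ < S
    ρ<S = ℕP.+-cancelʳ-< d ρ S (≤-trans (s≤s (≤-reflexive balance)) (≤-trans (≤-reflexive (sym (+-suc S (2 + j)))) (+-monoʳ-≤ S le)))

  deg-Z : ∀ j → 2 + j ≤ d → deg (Zₙ (2 + j)) ≡ 1 + d ^ (2 + j)
  deg-Z j le = Lead⇒deg (Lead-Z (2 + j) s-lead r-deg (+-cancelʳ-≤ d ρ _ (≤-trans (≤-reflexive balance) (+-monoʳ-≤ (d ^ suc j) le))))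
      (ℚ-integral {ℚ.- 1ℚ} (λ ()) (ℚ-integral D≢0 (^ℚ-≢0 d l≢0)))
    where open Degrees (degrees j le)

  B≢0 : ∀ n → ¬ Bₙ n ≋ []
  B≢0 n eq = Exact⇒≢0 (M₀.MinAt.exact-i (MinAt-Bₙ n)) (at eq _)

  Z≢0 : ∀ n → ¬ Zₙ n ≋ []
  Z≢0 n eq = Exact⇒≢0 (M₀.MinAt.exact-i (MinAt-Zₙ n)) (at eq _)

  -- Additivity of degrees along Zₙ₊₁ = Zₙ · b Qₙ yields the degree of Qₙ without any analysis of
  -- cancellations inside the bracket.
  deg-Z-suc : ∀ n → deg (Zₙ (suc n)) ≡ deg (Zₙ n) + suc (deg (Qₙ n))
  deg-Z-suc n = begin
    deg (Zₙ (suc n)) ≡⟨ deg-cong (Zₙ-suc n) ⟩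
    deg (Zₙ n *ₚ Bₙ n) ≡⟨ deg-* (Z≢0 n) (B≢0 n) ⟩
    deg (Zₙ n) + deg (Bₙ n) ≡⟨ cong (deg (Zₙ n) ℕ.+_) (deg-cong (Bₙ≋X*Qₙ n)) ⟩
    deg (Zₙ n) + deg (Xₚ *ₚ Qₙ n) ≡⟨ cong (deg (Zₙ n) ℕ.+_) (deg-* X≢0 Q≢0) ⟩
    deg (Zₙ n) + (deg Xₚ + deg (Qₙ n)) ≡⟨ cong (λ k → deg (Zₙ n) + (k + deg (Qₙ n))) (Lead⇒deg Lead-X (λ ())) ⟩
    deg (Zₙ n) + suc (deg (Qₙ n)) ∎
    where
    open ≡-Reasoning
    XQ≢0 : ¬ Xₚ *ₚ Qₙ n ≋ []
    XQ≢0 eq = B≢0 n (≋-trans (Bₙ≋X*Qₙ n) eq)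
    X≢0 = *≢0⇒≢0ˡ {Xₚ} {Qₙ n} XQ≢0
    Q≢0 = *≢0⇒≢0ʳ {Xₚ} {Qₙ n} XQ≢0

  deg-Q₀ : deg (Qₙ 0) ≡ N 0
  deg-Q₀ = suc-injective (+-cancelˡ-≡ 1 _ _ (begin
    1 + suc (deg (Qₙ 0)) ≡⟨ cong (ℕ._+ suc (deg (Qₙ 0))) (Lead⇒deg Lead-Z₀ (ℚ-integral {1ℚ} (λ ()) (ℚ-integral {ℚ.- 1ℚ} (λ ()) D≢0))) ⟨
    deg (Zₙ 0) + suc (deg (Qₙ 0)) ≡⟨ deg-Z-suc 0 ⟨
    deg (Zₙ 1) ≡⟨ Lead⇒deg Lead-Z₁ (^ℚ-≢0 d D≢0) ⟩
    d * 1 ≡⟨ cong (1 ℕ.+_) (N+1≡ 0) ⟨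
    1 + suc (N 0) ∎))
    where open ≡-Reasoning

  private
    Z₂-lead≢0 : (ℚ.- 1ℚ) ℚ.* (D ℚ.* (D ^ℚ d) ^ℚ d) ≢ 0ℚ
    Z₂-lead≢0 = ℚ-integral {ℚ.- 1ℚ} (λ ()) (ℚ-integral D≢0 (^ℚ-≢0 d (^ℚ-≢0 d D≢0)))

  deg-Q₁ : deg (Qₙ 1) ≡ suc (N 1)
  deg-Q₁ = suc-injective (+-cancelˡ-≡ (d * 1) _ _ (begin
    d * 1 + suc (deg (Qₙ 1)) ≡⟨ cong (ℕ._+ suc (deg (Qₙ 1))) (Lead⇒deg Lead-Z₁ (^ℚ-≢0 d D≢0)) ⟨
    deg (Zₙ 1) + suc (deg (Qₙ 1)) ≡⟨ deg-Z-suc 1 ⟨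
    deg (Zₙ 2) ≡⟨ Lead⇒deg Lead-Z₂ Z₂-lead≢0 ⟩
    1 + d * (d * 1) ≡⟨ solve 1 (λ e → con 1 :+ (con 3 :+ e) :* ((con 3 :+ e) :* con 1)
                                               := (con 3 :+ e) :* con 1 :+ (con 1 :+ (con 2 :+ e) :* ((con 3 :+ e) :* con 1))) refl e ⟩
    d * 1 + suc (d-1 * d ^ 1) ≡⟨ cong (λ k → d * 1 + suc k) (N+1≡ 1) ⟨
    d * 1 + suc (suc (N 1)) ∎))
    where
    open ≡-Reasoning
    open ℕSolver.+-*-Solver

  deg-Q : ∀ j → 3 + j ≤ d → deg (Qₙ (2 + j)) ≡ N (2 + j)
  deg-Q j le = suc-injective (+-cancelˡ-≡ (1 + d ^ n) _ _ (begin
    1 + d ^ n + suc (deg (Qₙ n)) ≡⟨ cong (ℕ._+ suc (deg (Qₙ n))) (deg-Z j (≤-trans (n≤1+n _) le)) ⟨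
    deg (Zₙ n) + suc (deg (Qₙ n)) ≡⟨ deg-Z-suc n ⟨
    deg (Zₙ (suc n)) ≡⟨ deg-Z (suc j) le ⟩
    1 + d ^ suc n ≡⟨ solve 2 (λ e t → con 1 :+ (con 3 :+ e) :* t := con 1 :+ t :+ (con 2 :+ e) :* t) refl e (d ^ n) ⟩
    1 + d ^ n + d-1 * d ^ n ≡⟨ cong (1 + d ^ n ℕ.+_) (N+1≡ n) ⟨
    1 + d ^ n + suc (N n) ∎))
    where
    n = 2 + j
    open ≡-Reasoning
    open ℕSolver.+-*-Solver

-- The exceptional case n = 1

module LinearFactor (e : ℕ) (pp : Prime (3 + e)) where
  open SmallIndex e pp public

  private
    module F₁ = Final 1
    open F₁ using (H; c; c·H≋Q)

    instance
      N1≢0 = N≢0 1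

    Γ : ℚ
    Γ = ι (+ d-1)

    c≡ : c ≡ D ^ℚ suc (N 1)
    c≡ = ι-^ d (suc (N 1))

    c≢0 : c ≢ 0ℚ
    c≢0 eq = ^ℚ-≢0 (suc (N 1)) D≢0 (trans (sym c≡) eq)

    suc-N₁ : suc (N 1) ≡ d-1 * d
    suc-N₁ = trans (N+1≡ 1) (cong (d-1 ℕ.*_) (*-identityʳ d))

    d*d : d * d ≡ d + suc (N 1)
    d*d = cong (d ℕ.+_) (sym suc-N₁)

  -- Compare leading coefficients in Z₂ = Z₁ · b · c H, where those of Z₁ and Z₂ are dᵈ and - d ·
  -- d^(d²), and c = d^(d² - d).
  Lead-H : ∀ {x} → Lead H (suc (N 1)) x → x ≡ ℚ.- D
  Lead-H {x} h = ℚ-cancel (ℚ-integral (^ℚ-≢0 d D≢0) c≢0) (begin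
    (D ^ℚ d ℚ.* c) ℚ.* x ≡⟨ solve 3 (λ a b x → a :* b :* x := a :* (con 1ℚ :* (b :* x))) refl (D ^ℚ d) c x ⟩
    D ^ℚ d ℚ.* (1ℚ ℚ.* (c ℚ.* x)) ≡⟨ Lead-value lead-Z (Lead-index index Lead-Z₂) ⟩
    (ℚ.- 1ℚ) ℚ.* (D ℚ.* (D ^ℚ d) ^ℚ d) ≡⟨ cong (λ y → (ℚ.- 1ℚ) ℚ.* (D ℚ.* y)) (trans (^ℚ-*-assoc D d d)
                                                            (trans (cong (D ^ℚ_) d*d) (trans (^ℚ-distrib-+ D d (suc (N 1))) (cong (D ^ℚ d ℚ.*_) (sym c≡))))) ⟩
    (ℚ.- 1ℚ) ℚ.* (D ℚ.* (D ^ℚ d ℚ.* c)) ≡⟨ solve 2 (λ D m → con (ℚ.- 1ℚ) :* (D :* m) := m :* (:- D)) refl D (D ^ℚ d ℚ.* c) ⟩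
    (D ^ℚ d ℚ.* c) ℚ.* (ℚ.- D) ∎)
    where
    open ≡-Reasoning
    open ℚSolver.+-*-Solver
    lead-Z : Lead (Zₙ 2) (d * 1 + (1 + suc (N 1))) (D ^ℚ d ℚ.* (1ℚ ℚ.* (c ℚ.* x)))
    lead-Z = Lead-cong (≋-sym (Zₙ-suc 1)) (Lead-* (Zₙ 1) (Bₙ 1) Lead-Z₁ (Lead-cong (≋-sym (Bₙ≋X*Qₙ 1))
      (Lead-* Xₚ (Qₙ 1) Lead-X (Lead-cong c·H≋Q (Lead-· c h)))))
    index : 1 + d * (d * 1) ≡ d * 1 + (1 + suc (N 1))
    index = trans (cong (λ k → 1 + d * k) (*-identityʳ d)) (trans (cong suc d*d)
      (trans (sym (+-suc d (suc (N 1)))) (cong (ℕ._+ (1 + suc (N 1))) (sym (*-identityʳ d)))))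

  H₁-at-0 : coeff H 0 ≡ (ℚ.- Γ) ℚ.* D ^ℚ d
  H₁-at-0 = ℚ-cancel c≢0 (begin
    c ℚ.* coeff H 0 ≡⟨ trans (sym (coeff-· c H 0)) (at c·H≋Q 0) ⟩
    coeff (Qₙ 1) 0 ≡⟨ Q-at-0 1 ⟩
    (ℚ.- 1ℚ) ℚ.* (D ℚ.* Γ ℚ.* y ^ℚ d-1) ℚ.+ (ℚ.- 1ℚ) ℚ.* (1ℚ ℚ.* (coeff (Z′ₙ 1) 0 ℚ.* K′))
      ≡⟨ cong (λ z → (ℚ.- 1ℚ) ℚ.* (D ℚ.* Γ ℚ.* y ^ℚ d-1) ℚ.+ (ℚ.- 1ℚ) ℚ.* (1ℚ ℚ.* (z ℚ.* K′))) (Z′ₙ-at-0 0) ⟩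
    (ℚ.- 1ℚ) ℚ.* (D ℚ.* Γ ℚ.* y ^ℚ d-1) ℚ.+ (ℚ.- 1ℚ) ℚ.* (1ℚ ℚ.* (0ℚ ℚ.* K′))
      ≡⟨ solve 4 (λ D Γ P K → con (ℚ.- 1ℚ) :* (D :* Γ :* P) :+ con (ℚ.- 1ℚ) :* (con 1ℚ :* (con 0ℚ :* K)) := (:- Γ) :* (D :* P)) refl D Γ (y ^ℚ d-1) K′ ⟩
    (ℚ.- Γ) ℚ.* (D ℚ.* y ^ℚ d-1)
      ≡⟨ cong ((ℚ.- Γ) ℚ.*_) (trans (cong (λ z → D ℚ.* z ^ℚ d-1) y≡) power) ⟩
    (ℚ.- Γ) ℚ.* (c ℚ.* D ^ℚ d)
      ≡⟨ solve 3 (λ Γ c P → (:- Γ) :* (c :* P) := c :* ((:- Γ) :* P)) refl Γ c (D ^ℚ d) ⟩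
    c ℚ.* ((ℚ.- Γ) ℚ.* D ^ℚ d) ∎)
    where
    open ≡-Reasoning
    open ℚSolver.+-*-Solver
    y = coeff (Yₙ 1) 0
    K′ = ι (+ (d C 2)) ℚ.* y ^ℚ suc e
    y≡ : y ≡ D ^ℚ suc d
    y≡ = trans (Yₙ-suc-at-0 0) (cong (λ z → D ℚ.* z ^ℚ d) Y₀-at-0)
    power : D ℚ.* (D ^ℚ suc d) ^ℚ d-1 ≡ c ℚ.* D ^ℚ d
    power = trans (cong (D ℚ.*_) (^ℚ-*-assoc D (suc d) d-1)) (trans (cong (D ^ℚ_) exponents)
      (trans (^ℚ-distrib-+ D (suc (N 1)) d) (cong (ℚ._* D ^ℚ d) (sym c≡))))
      where
      exponents : suc (d-1 * suc d) ≡ suc (N 1) + d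
      exponents = trans (NS.solve 1 (λ e → NS.con 1 NS.:+ (NS.con 2 NS.:+ e) NS.:* (NS.con 4 NS.:+ e) NS.:= (NS.con 2 NS.:+ e) NS.:* (NS.con 3 NS.:+ e) NS.:+ (NS.con 3 NS.:+ e)) refl e)
        (cong (ℕ._+ d) (sym suc-N₁))
        where module NS = ℕSolver.+-*-Solver

  private
    d+2≤N+1 : suc (suc d) ≤ suc (N 1)
    d+2≤N+1 = subst (suc (suc d) ≤_) (sym suc-N₁) (≤-trans (≤-reflexive (ℕP.+-comm 2 d))
      (+-monoʳ-≤ d (≤-trans (s≤s (s≤s z≤n)) (m≤m+n d (e * d)))))

  -- An integral root x of 𝒢₂ is impossible: reduce modulo d if d ∤ x, otherwise the constant term dominates.
  no-integral-root : ∀ x → eval (Qₙ 1) (ι x) ≢ 0ℚ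
  no-integral-root x = go (+ d ∣? x)
    where
    prime-root : ∀ {x} → ¬ (+ d ∣ x) → eval (Qₙ 1) (ι x) ≢ 0ℚ
    prime-root {x} d∤x root = Exact⇒≢0 (subst (Exact val) (sym B-at-x) (Exact-+ mono-exact (rest-at-x (eval-V {j = 0} rest (x , refl , divides x (sym (ℤP.*-identityʳ x))) z≤n rest-V)))) B-root
      where
      open M₀.MinAt (MinAt-Bₙ 1) using (unique)
      open Newton d pp 1 0 using (module Unique)
      open Unique unique
      open Evaluation d pp 1 0
      B-root : eval (Bₙ 1) (ι x) ≡ 0ℚ
      B-root = trans (eval-cong (ι x) (Bₙ≋X*Qₙ 1)) (trans (eval-* Xₚ (Qₙ 1) (ι x)) (trans (cong (eval Xₚ (ι x) ℚ.*_) root) (ℚP.*-zeroʳ (eval Xₚ (ι x)))))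
      B-at-x : eval (Bₙ 1) (ι x) ≡ coef ℚ.* ι x ^ℚ index ℚ.+ eval rest (ι x)
      B-at-x = trans (eval-cong (ι x) decomp) (trans (eval-+ (mono index coef) rest (ι x)) (cong (ℚ._+ eval rest (ι x)) (eval-mono index coef (ι x))))
      mono-exact : Exact val (coef ℚ.* ι x ^ℚ index)
      mono-exact = subst (λ k → Exact k (coef ℚ.* ι x ^ℚ index)) (trans (cong (val ℕ.+_) (*-zeroʳ index)) (ℕP.+-identityʳ val))
        (Exact-* isExact (M₀.Exact-^ index (M₀.Exact-ι d∤x)))
      rest-at-x : (Σ ℕ λ k → Multiple (d ^ k) (eval rest (ι x)) × suc (1 * val + 0 * index) ≤ 1 * k) → Multiple (d ^ suc val) (eval rest (ι x))
      rest-at-x (k , m , le) = Multiple-∣ (^-∣ d (subst₂ _≤_ (cong suc (trans (ℕP.+-identityʳ _) (*-identityˡ val))) (*-identityˡ k) le)) m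

    multiple-root : ∀ y → eval (Qₙ 1) (ι (y ℤ.* + d)) ≢ 0ℚ
    multiple-root y root = Exact⇒≢0 (subst (Exact (d ^ 2)) (sym Q-at-x) (Exact-+ (Qₙ-at-0 1)
          (tail-at-x (eval-V {j = 1} (divX (Qₙ 1)) hx L≤ (V-tail (V-cong (head-tail (Qₙ 1)) F₁.V-Qₙ)))))) root
      where
      open Newton d pp (N 1) (d ^ 1) using (V-tail; V-cong)
      open Evaluation d pp (N 1) (d ^ 1)
      x₀ = ι (y ℤ.* + d)
      hx : Multiple (d ^ 1) x₀
      hx = y ℤ.* + d , refl , divides y (cong (λ k → y ℤ.* + k) (sym (*-identityʳ d)))
      L≤ : d ^ 1 ≤ N 1 * 1
      L≤ = ≤-trans (L≤N 1) (≤-reflexive (sym (*-identityʳ (N 1))))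
      Q-at-x : eval (Qₙ 1) x₀ ≡ coeff (Qₙ 1) 0 ℚ.+ x₀ ℚ.* eval (divX (Qₙ 1)) x₀
      Q-at-x = trans (eval-cong x₀ (head-tail (Qₙ 1))) (eval-∷ (coeff (Qₙ 1) 0) (divX (Qₙ 1)) x₀)
      T = N 1 * suc (N 1) + d ^ 1 * N 1
      T≡ : T ≡ N 1 * d ^ 2
      T≡ = trans (cong (λ k → N 1 * k + d ^ 1 * N 1) (N+1≡ 1))
        (solve 3 (λ N e t → N :* ((con 2 :+ e) :* t) :+ t :* N := N :* ((con 3 :+ e) :* t)) refl (N 1) e (d ^ 1))
        where open ℕSolver.+-*-Solver
      -- If k < d², then N (k + 1) ≤ N d² = T ≤ d + N k, hence N ≤ d, contrary to `d+2≤N+1`.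
      large : ∀ k → T ∸ d ^ 1 ≤ N 1 * k → d ^ 2 ≤ k
      large k le = ≮⇒≥ λ k<d² → <⇒≱ (≤-pred (subst (λ t → suc (suc t) ≤ suc (N 1)) (sym (*-identityʳ d)) d+2≤N+1)) (+-cancelʳ-≤ (N 1 * k) (N 1) (d ^ 1) (begin
        N 1 + N 1 * k ≡⟨ ℕP.*-suc (N 1) k ⟨
        N 1 * suc k ≤⟨ *-monoʳ-≤ (N 1) k<d² ⟩
        N 1 * d ^ 2 ≡⟨ T≡ ⟨
        T ≤⟨ m≤n+m∸n T (d ^ 1) ⟩
        d ^ 1 + (T ∸ d ^ 1) ≤⟨ +-monoʳ-≤ (d ^ 1) le ⟩
        d ^ 1 + N 1 * k ∎))
        where open ℕP.≤-Reasoning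
      tail-at-x : (Σ ℕ λ k → Multiple (d ^ k) (eval (divX (Qₙ 1)) x₀) × T ∸ d ^ 1 ≤ N 1 * k) → Multiple (d ^ suc (d ^ 2)) (x₀ ℚ.* eval (divX (Qₙ 1)) x₀)
      tail-at-x (k , m , le) = Multiple-∣ (subst (d ^ suc (d ^ 2) ℕD.∣_) (^-distribˡ-+-* d 1 k) (^-∣ d (s≤s (large k le)))) (Multiple-*₂ hx m)

    go : ∀ {x} → Dec (+ d ∣ x) → eval (Qₙ 1) (ι x) ≢ 0ℚ
    go (no d∤x)             = prime-root d∤x
    go (yes (divides y refl)) = multiple-root y

module SecondPolynomial (e : ℕ) (pp : Prime (3 + e)) where
  open LinearFactor e pp public

  private
    module F₁ = Final 1
    open F₁ using (H; c; c·H≋Q)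

    Γ : ℚ
    Γ = ι (+ d-1)

  -- If x = k/d is a root of 𝒢₂ then a = k + d satisfies (a² dᵈ⁻¹)ᵈ = (k + 1) (aᵈ + (d - 1) dᵈ)ᵈ.
  module Root (k : ℤ) (x : ℚ) (Dx : D ℚ.* x ≡ ι k) (root : eval (Qₙ 1) x ≡ 0ℚ) where
    a : ℤ
    a = k ℤ.+ + d

    private
      A-at-x : eval (A d) x ≡ ι a
      A-at-x = begin
        eval (A d) x ≡⟨ eval-· (ℕ→ℚ d) (Xₚ +ₚ const 1ℚ) x ⟩
        ℕ→ℚ d ℚ.* eval (Xₚ +ₚ const 1ℚ) x ≡⟨ cong₂ ℚ._*_ ℕ→ℚd≡D (trans (eval-+ Xₚ (const 1ℚ) x) (cong₂ ℚ._+_ (eval-X x) (eval-const 1ℚ x))) ⟩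
        D ℚ.* (x ℚ.+ 1ℚ) ≡⟨ trans (ℚP.*-distribˡ-+ D x 1ℚ) (cong₂ ℚ._+_ Dx (ℚP.*-identityʳ D)) ⟩
        ι k ℚ.+ D ≡⟨ ι-+ k (+ d) ⟨
        ι a ∎
        where open ≡-Reasoning

      w-at-x : eval w x ≡ ι (k ℤ.+ ℤ.1ℤ)
      w-at-x = trans (eval-+ (ℕ→ℚ d ·ₚ Xₚ) (const 1ℚ) x) (trans (cong₂ ℚ._+_
        (trans (eval-· (ℕ→ℚ d) Xₚ x) (trans (cong₂ ℚ._*_ ℕ→ℚd≡D (eval-X x)) Dx)) (trans (eval-const 1ℚ x) (sym ι-1)))
        (sym (ι-+ k ℤ.1ℤ)))

      r₁-at-x : eval (r d 1) x ≡ ι a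
      r₁-at-x = trans (eval-cong x r₁≋A) A-at-x

      s₁-at-x : eval (s d 1) x ≡ D
      s₁-at-x = trans (eval-cong x s₁≋D) (eval-const D x)

      R S : ℚ
      R = ι a ℚ.* ι a ℚ.* D ^ℚ d-1
      S = ι a ^ℚ d ℚ.+ Γ ℚ.* D ^ℚ d

      r₂-at-x : eval (r d 2) x ≡ R
      r₂-at-x = trans (eval-* (A d *ₚ r d 1) (s d 1 ^ₚ d-1) x) (cong₂ ℚ._*_
        (trans (eval-* (A d) (r d 1) x) (cong₂ ℚ._*_ A-at-x r₁-at-x))
        (trans (eval-^ (s d 1) d-1 x) (cong (_^ℚ d-1) s₁-at-x)))

      s₂-at-x : eval (s d 2) x ≡ S
      s₂-at-x = trans (eval-+ (r d 1 ^ₚ d) (ℕ→ℚ d-1 ·ₚ s d 1 ^ₚ d) x) (cong₂ ℚ._+_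
        (trans (eval-^ (r d 1) d x) (cong (_^ℚ d) r₁-at-x))
        (trans (eval-· (ℕ→ℚ d-1) (s d 1 ^ₚ d) x) (cong₂ ℚ._*_ (sym (ι≡/1 (+ d-1)))
          (trans (eval-^ (s d 1) d x) (cong (_^ℚ d) s₁-at-x)))))

      Z₂-at-x : eval (Zₙ 2) x ≡ 0ℚ
      Z₂-at-x = trans (eval-cong x (Zₙ-suc 1)) (trans (eval-* (Zₙ 1) (Bₙ 1) x) (trans (cong (eval (Zₙ 1) x ℚ.*_)
        (trans (eval-cong x (Bₙ≋X*Qₙ 1)) (trans (eval-* Xₚ (Qₙ 1) x) (trans (cong (eval Xₚ x ℚ.*_) root) (ℚP.*-zeroʳ (eval Xₚ x))))))
        (ℚP.*-zeroʳ (eval (Zₙ 1) x))))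

      equation : R ^ℚ d ≡ ι (k ℤ.+ ℤ.1ℤ) ℚ.* S ^ℚ d
      equation = begin
        R ^ℚ d ≡⟨ solve 2 (λ x y → x := (x :+ con (ℚ.- 1ℚ) :* y) :+ y) refl (R ^ℚ d) (ι (k ℤ.+ ℤ.1ℤ) ℚ.* S ^ℚ d) ⟩
        (R ^ℚ d ℚ.+ (ℚ.- 1ℚ) ℚ.* (ι (k ℤ.+ ℤ.1ℤ) ℚ.* S ^ℚ d)) ℚ.+ ι (k ℤ.+ ℤ.1ℤ) ℚ.* S ^ℚ d
                                                      ≡⟨ cong (ℚ._+ ι (k ℤ.+ ℤ.1ℤ) ℚ.* S ^ℚ d) (trans (sym expand) Z₂-at-x) ⟩
        0ℚ ℚ.+ ι (k ℤ.+ ℤ.1ℤ) ℚ.* S ^ℚ d ≡⟨ ℚP.+-identityˡ _ ⟩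
        ι (k ℤ.+ ℤ.1ℤ) ℚ.* S ^ℚ d ∎
        where
        open ≡-Reasoning
        open ℚSolver.+-*-Solver
        expand : eval (Zₙ 2) x ≡ R ^ℚ d ℚ.+ (ℚ.- 1ℚ) ℚ.* (ι (k ℤ.+ ℤ.1ℤ) ℚ.* S ^ℚ d)
        expand = trans (eval-+ (r d 2 ^ₚ d) (negₚ (w *ₚ s d 2 ^ₚ d)) x) (cong₂ ℚ._+_
          (trans (eval-^ (r d 2) d x) (cong (_^ℚ d) r₂-at-x))
          (trans (eval-· (ℚ.- 1ℚ) (w *ₚ s d 2 ^ₚ d) x) (cong ((ℚ.- 1ℚ) ℚ.*_) (trans (eval-* w (s d 2 ^ₚ d) x)
            (cong₂ ℚ._*_ w-at-x (trans (eval-^ (s d 2) d x) (cong (_^ℚ d) s₂-at-x)))))))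

    -- Comparing d-adic valuations, d^(d(d-1)) divides k + 1 if d ∤ k, so k is large.
    d∤k⇒large : ¬ (+ d ∣ k) → d ^ (d * d-1) ≤ ℤ.∣ k ∣ + 1
    d∤k⇒large d∤k = ≤-trans (go (exact (k ℤ.+ ℤ.1ℤ , refl) k+1≢0)) (ℤP.∣i+j∣≤∣i∣+∣j∣ k ℤ.1ℤ)
      where
      d∤a : ¬ (+ d ∣ a)
      d∤a h = d∤k (ℤD.∣m+n∣n⇒∣m h (divides ℤ.1ℤ (sym (ℤP.*-identityˡ (+ d)))))

      v₀ : ∀ {x} → Exact 0 x → ∀ j → Exact 0 (x ^ℚ j)
      v₀ {x} h j = subst (λ k → Exact k (x ^ℚ j)) (*-zeroʳ j) (M₀.Exact-^ j h)

      R-exact : Exact (d * d-1) (R ^ℚ d)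
      R-exact = M₀.Exact-^ d (subst (λ k → Exact k R) (*-identityʳ d-1)
        (Exact-* (Exact-* (M₀.Exact-ι d∤a) (M₀.Exact-ι d∤a)) (M₀.Exact-^ d-1 M₀.Exact-p)))

      S-exact : Exact 0 (S ^ℚ d)
      S-exact = v₀ (Exact-+ (v₀ (M₀.Exact-ι d∤a) d) (Multiple-* (+ d-1 , refl)
        (Multiple-∣ (^-∣ d {1} {d} (s≤s z≤n)) (subst (λ k → Multiple (d ^ k) (D ^ℚ d)) (*-identityʳ d) (Exact⇒Multiple (M₀.Exact-^ d M₀.Exact-p)))))) d

      k+1≢0 : ι (k ℤ.+ ℤ.1ℤ) ≢ 0ℚ
      k+1≢0 eq = Exact⇒≢0 R-exact (trans equation (trans (cong (ℚ._* S ^ℚ d) eq) (ℚP.*-zeroˡ (S ^ℚ d))))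

      go : (Σ ℕ λ v → Exact v (ι (k ℤ.+ ℤ.1ℤ))) → d ^ (d * d-1) ≤ ℤ.∣ k ℤ.+ ℤ.1ℤ ∣
      go (v , ex) = divisor (Multiple-∣ (^-∣ d v≥) (Exact⇒Multiple ex))
        where
        v≥ : d * d-1 ≤ v
        v≥ = subst (d * d-1 ≤_) (ℕP.+-identityʳ v) (Exact-≥ (Exact-* ex S-exact) (subst (Multiple _) equation (Exact⇒Multiple R-exact)))
        divisor : Multiple (d ^ (d * d-1)) (ι (k ℤ.+ ℤ.1ℤ)) → d ^ (d * d-1) ≤ ℤ.∣ k ℤ.+ ℤ.1ℤ ∣
        divisor (z , eq , h) = ℕD.∣⇒≤ {{ℕ.≢-nonZero λ z≡0 → k+1≢0 (trans (cong ι (ℤP.∣i∣≡0⇒i≡0 z≡0)) ι-0)}}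
          (ℤD.∣⇒∣ᵤ (subst (+ (d ^ (d * d-1)) ∣_) (sym (ι-injective eq)) h))

  -- With leading coefficients φ α = - d and constant terms ψ β = - (d - 1) dᵈ, the root - β / α of
  -- `g` is k / d for k = β φ. If d divides k, the root is an integer. Otherwise β divides d - 1 and
  -- φ divides d, so k is far below the size that `Root.d∤k⇒large` requires.
  no-linear-factor : ∀ f g → Integral f → Integral g → f *ₚ g ≋ H → deg f ≡ N 1 → deg g ≡ 1 → ⊥
  no-linear-factor f g intf intg fg≋H degf degg = conclude (intf (N 1)) (intg 1) (intg 0) (intf 0)
    where
    f-lead : Lead f (N 1) (coeff f (N 1))
    f-lead = DegLE⇒Lead (subst (DegLE f) degf (DegLE-deg f))

    g-lead : Lead g 1 (coeff g 1)
    g-lead = DegLE⇒Lead (subst (DegLE g) degg (DegLE-deg g))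

    leads : coeff f (N 1) ℚ.* coeff g 1 ≡ ℚ.- D
    leads = Lead-H (Lead-index (ℕP.+-comm (N 1) 1) (Lead-cong fg≋H (Lead-* f g f-lead g-lead)))

    constants : coeff f 0 ℚ.* coeff g 0 ≡ (ℚ.- Γ) ℚ.* D ^ℚ d
    constants = trans (sym (coeff₀-* f g)) (trans (at fg≋H 0) H₁-at-0)

    conclude : IsInt (coeff f (N 1)) → IsInt (coeff g 1) → IsInt (coeff g 0) → IsInt (coeff f 0) → ⊥
    conclude (φ , φ≡) (α , α≡) (β , β≡) (ψ , ψ≡) = go (+ d ∣? k)
      where
      k : ℤ
      k = β ℤ.* φ

      x : ℚ
      x = ι k ℚ.* oneOver d

      Dx : D ℚ.* x ≡ ι k
      Dx = trans (solve 3 (λ D k u → D :* (k :* u) := (D :* u) :* k) refl D (ι k) (oneOver d))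
        (trans (cong (ℚ._* ι k) (d*oneOver≡1 d)) (ℚP.*-identityˡ (ι k)))
        where open ℚSolver.+-*-Solver

      φα : ι φ ℚ.* ι α ≡ ℚ.- D
      φα = trans (sym (cong₂ ℚ._*_ φ≡ α≡)) leads

      g-at-x : eval g x ≡ 0ℚ
      g-at-x = ℚ-cancel D≢0 (begin
        D ℚ.* eval g x ≡⟨ cong (D ℚ.*_) (trans (eval-linear g x (degLE g-lead)) (cong₂ (λ b a → b ℚ.+ x ℚ.* a) β≡ α≡)) ⟩
        D ℚ.* (ι β ℚ.+ x ℚ.* ι α) ≡⟨ solve 4 (λ D b x a → D :* (b :+ x :* a) := D :* b :+ (D :* x) :* a) refl D (ι β) x (ι α) ⟩
        D ℚ.* ι β ℚ.+ (D ℚ.* x) ℚ.* ι α ≡⟨ cong (λ z → D ℚ.* ι β ℚ.+ z ℚ.* ι α) (trans Dx (ι-* β φ)) ⟩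
        D ℚ.* ι β ℚ.+ (ι β ℚ.* ι φ) ℚ.* ι α ≡⟨ solve 4 (λ D b f a → D :* b :+ (b :* f) :* a := b :* (D :+ f :* a)) refl D (ι β) (ι φ) (ι α) ⟩
        ι β ℚ.* (D ℚ.+ ι φ ℚ.* ι α) ≡⟨ cong (λ z → ι β ℚ.* (D ℚ.+ z)) φα ⟩
        ι β ℚ.* (D ℚ.- D) ≡⟨ solve 2 (λ D b → b :* (D :- D) := D :* con 0ℚ) refl D (ι β) ⟩
        D ℚ.* 0ℚ ∎)
        where
        open ≡-Reasoning
        open ℚSolver.+-*-Solver

      root : eval (Qₙ 1) x ≡ 0ℚ
      root = trans (eval-cong x (≋-trans (≋-sym c·H≋Q) (·-cong c (≋-sym fg≋H)))) (trans (eval-· c (f *ₚ g) x)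
        (trans (cong (c ℚ.*_) (trans (eval-* f g x) (trans (cong (eval f x ℚ.*_) g-at-x) (ℚP.*-zeroʳ (eval f x))))) (ℚP.*-zeroʳ c)))

      φ≤d : ℤ.∣ φ ∣ ≤ d
      φ≤d = ℕD.∣⇒≤ (ℕD.divides ℤ.∣ α ∣ (trans (sym (ℤP.∣-i∣≡∣i∣ (+ d))) (trans (cong (λ z → ℤ.∣ z ∣) (sym φα≡))
        (trans (ℤP.abs-* φ α) (ℕP.*-comm ℤ.∣ φ ∣ ℤ.∣ α ∣)))))
        where
        φα≡ : φ ℤ.* α ≡ ℤ.- (+ d)
        φα≡ = ι-injective (trans (ι-* φ α) (trans φα (sym (ι-neg (+ d)))))

      β≤d-1 : ¬ (+ d ∣ k) → ℤ.∣ β ∣ ≤ d-1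
      β≤d-1 d∤k = ℕD.∣⇒≤ (strip-prime-power pp d (λ h → d∤k (ℤD.∣m⇒∣m*n {m = β} φ (ℤD.∣ᵤ⇒∣ {+ d} {β} h)))
        (ℕD.divides ℤ.∣ ψ ∣ (trans (sym (ℤP.∣-i∣≡∣i∣ (+ (d-1 * d ^ d)))) (trans (cong (λ z → ℤ.∣ z ∣) (sym ψβ≡)) (ℤP.abs-* ψ β)))))
        where
        open ℚSolver.+-*-Solver
        ψβ≡ : ψ ℤ.* β ≡ ℤ.- (+ (d-1 * d ^ d))
        ψβ≡ = ι-injective (trans (ι-* ψ β) (trans (sym (cong₂ ℚ._*_ ψ≡ β≡)) (trans constants
          (trans (solve 2 (λ g p → (:- g) :* p := :- (g :* p)) refl Γ (D ^ℚ d)) (trans (cong ℚ.-_ (sym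
            (trans (cong ι (ℤP.pos-* d-1 (d ^ d))) (trans (ι-* (+ d-1) (+ (d ^ d))) (cong (Γ ℚ.*_) (ι-^ d d))))))
            (sym (ι-neg (+ (d-1 * d ^ d)))))))))

      small : ¬ (+ d ∣ k) → ℤ.∣ k ∣ + 1 < d ^ (d * d-1)
      small d∤k = begin-strict
        ℤ.∣ k ∣ + 1 ≡⟨ cong (ℕ._+ 1) (ℤP.abs-* β φ) ⟩
        ℤ.∣ β ∣ * ℤ.∣ φ ∣ + 1 ≤⟨ +-mono-≤ (*-mono-≤ (β≤d-1 d∤k) φ≤d) (s≤s (z≤n {d-1})) ⟩
        d-1 * d + d ≡⟨ solve 1 (λ e → (con 2 :+ e) :* (con 3 :+ e) :+ (con 3 :+ e) := (con 3 :+ e) :* ((con 3 :+ e) :* con 1)) refl e ⟩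
        d ^ 2 <⟨ ℕP.^-monoʳ-< d (s≤s (s≤s z≤n)) 2<dd ⟩
        d ^ (d * d-1) ∎
        where
        open ℕP.≤-Reasoning
        open ℕSolver.+-*-Solver
        2<dd : 2 < d * d-1
        2<dd = ≤-trans (s≤s (s≤s (s≤s z≤n))) (ℕP.m≤m*n d d-1)

      go : Dec (+ d ∣ k) → ⊥
      go (no d∤k) = <⇒≱ (small d∤k) (Root.d∤k⇒large k x Dx root d∤k)
      go (yes (divides y k≡)) = no-integral-root y (subst (λ x → eval (Qₙ 1) x ≡ 0ℚ) x≡ root)
        where
        x≡ : x ≡ ι y
        x≡ = ℚ-cancel D≢0 (trans Dx (trans (cong ι k≡) (trans (ι-* y (+ d)) (ℚP.*-comm (ι y) D))))

  private
    module F = Final 1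
  H₁-irreducible : IrreducibleQ H
  H₁-irreducible = irreducible-if H F.H-int F.H≢0 (λ z → ℕP.1+n≢0 (trans (sym deg-H₁) z)) none
    where
    deg-H₁ : deg H ≡ suc (N 1)
    deg-H₁ = trans F.deg-H deg-Q₁

    none : ¬ ProperFactors H
    none P = Sum.[ (λ tf → cases f g f-int g-int fg≋Q g-nonconst deg-fg (F.N≤deg {f} tf))
                 , (λ tg → cases g f g-int f-int (≋-trans (*-comm g f) fg≋Q) f-nonconst (trans deg-fg (ℕP.+-comm (deg f) (deg g))) (F.N≤deg {g} tg)) ]′
                 (F.Two-factor {f} {g} f-int g-int fg≋Q F.H-Two)
      where
      open ProperFactors P
      fg≢0 : ¬ f *ₚ g ≋ []
      fg≢0 eq = F.H≢0 (≋-trans (≋-sym fg≋Q) eq)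
      deg-fg : suc (N 1) ≡ deg f + deg g
      deg-fg = trans (sym deg-H₁) (trans (deg-cong (≋-sym fg≋Q)) (deg-* (*≢0⇒≢0ˡ {f} {g} fg≢0) (*≢0⇒≢0ʳ {f} {g} fg≢0)))

      -- The factor with the segment has degree at least N and the other is not constant; the total
      -- N + 1 leaves only the degrees N and 1.
      cases : ∀ f g → Integral f → Integral g → f *ₚ g ≋ H → deg g ≢ 0 → suc (N 1) ≡ deg f + deg g → N 1 ≤ deg f → ⊥
      cases f g if ig fg≋ g≢ sum N≤ = no-linear-factor f g if ig fg≋ degf (+-cancelˡ-≡ (N 1) (deg g) 1
          (trans (cong (ℕ._+ deg g) (sym degf)) (trans (sym sum) (ℕP.+-comm 1 (N 1)))))
        where
        degf : deg f ≡ N 1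
        degf = ℕP.≤-antisym (+-cancelʳ-≤ 1 (deg f) (N 1) (≤-trans (+-monoʳ-≤ (deg f) (ℕP.n≢0⇒n>0 g≢))
          (≤-reflexive (trans (sym sum) (ℕP.+-comm 1 (N 1)))))) N≤

-- Irreducibility under scaling and affine substitution

unit-cong : ∀ {f g} → deg f ≡ deg g → (g ≋ [] → f ≋ []) → IsUnitₚ f → IsUnitₚ g
unit-cong eq h (deg≡0 , f≢0) = trans (sym eq) deg≡0 , λ g≈0 → f≢0 (at (h (mk≋ g≈0)))

irreducible-∼ : ∀ {f g} → f ∼ g → IrreducibleQ f → IrreducibleQ g
irreducible-∼ {f} {g} f∼g@(mk∼ c c≢0 g≋cf) (f≢0 , nonunit , factors) =
    (λ g≈0 → ∼⇒≢0 f∼g (λ e → f≢0 (at e)) (mk≋ g≈0))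
  , (λ (deg≡0 , _) → nonunit (trans (∼⇒deg≡ f∼g) deg≡0 , f≢0))
  , split (inverse c≢0)
  where
  split : (Σ ℚ λ u → u ℚ.* c ≡ 1ℚ) → ∀ g₁ g₂ → g₁ *ₚ g₂ ≈ₚ g → IsUnitₚ g₁ ⊎ IsUnitₚ g₂
  split (u , uc) g₁ g₂ e = Sum.map₁ (unit-cong {u ·ₚ g₁} {g₁} (sym (∼⇒deg≡ g₁∼)) (·-cong u)) (factors (u ·ₚ g₁) g₂ (at (begin
    (u ·ₚ g₁) *ₚ g₂ ≈⟨ ·-*-assoc u g₁ g₂ ⟩
    u ·ₚ (g₁ *ₚ g₂) ≈⟨ ·-cong u (≋-trans (mk≋ e) g≋cf) ⟩
    u ·ₚ (c ·ₚ f) ≈⟨ ·-·-assoc u c f ⟩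
    (u ℚ.* c) ·ₚ f ≡⟨ cong (_·ₚ f) uc ⟩
    1ℚ ·ₚ f ≈⟨ 1·-identity f ⟩
    f ∎)))
    where
    open ≋-Reasoning
    g₁∼ : g₁ ∼ u ·ₚ g₁
    g₁∼ = mk∼ u (inverse≢0 uc) ≋-refl

-- Meant for b = a/d - 1 and its inverse a = (b + 1) d. The degree bounds for both maps and the two
-- inverse laws make composition preserve degrees and irreducibility.
module Substitution (τ τ⁻¹ : Poly) (τ-linear : DegLE τ 1) (τ⁻¹-linear : DegLE τ⁻¹ 1)
                    (τ∘τ⁻¹ : compose τ τ⁻¹ ≋ Xₚ) (τ⁻¹∘τ : compose τ⁻¹ τ ≋ Xₚ) where

  compose-inverse : ∀ f → compose (compose f τ) τ⁻¹ ≋ f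
  compose-inverse f = ≋-trans (compose-assoc f τ τ⁻¹) (≋-trans (compose-congʳ f τ∘τ⁻¹) (compose-id f))

  compose-inverse′ : ∀ f → compose (compose f τ⁻¹) τ ≋ f
  compose-inverse′ f = ≋-trans (compose-assoc f τ⁻¹ τ) (≋-trans (compose-congʳ f τ⁻¹∘τ) (compose-id f))

  deg-compose : ∀ f → deg (compose f τ) ≡ deg f
  deg-compose f = ℕP.≤-antisym (DegLE⇒deg≤ (compose f τ) (DegLE-compose f τ-linear (DegLE-deg f)))
    (subst (_≤ deg (compose f τ)) (deg-cong (compose-inverse f))
      (DegLE⇒deg≤ (compose (compose f τ) τ⁻¹) (DegLE-compose (compose f τ) τ⁻¹-linear (DegLE-deg (compose f τ)))))

  irreducible-compose : ∀ f → IrreducibleQ f → IrreducibleQ (compose f τ)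
  irreducible-compose f (f≢0 , nonunit , factors) =
      (λ e → f≢0 (at (≋-trans (≋-sym (compose-inverse f)) (compose-0 (compose f τ) τ⁻¹ (mk≋ e)))))
    , (λ (deg≡0 , _) → nonunit (trans (sym (deg-compose f)) deg≡0 , f≢0))
    , λ g h e → Sum.map (back g) (back h) (factors (compose g τ⁻¹) (compose h τ⁻¹) (at (begin
        compose g τ⁻¹ *ₚ compose h τ⁻¹ ≈⟨ compose-* g h τ⁻¹ ⟨
        compose (g *ₚ h) τ⁻¹ ≈⟨ compose-cong {g *ₚ h} {compose f τ} τ⁻¹ (mk≋ e) ⟩
        compose (compose f τ) τ⁻¹ ≈⟨ compose-inverse f ⟩
        f ∎)))
    where
    open ≋-Reasoning
    back : ∀ g → IsUnitₚ (compose g τ⁻¹) → IsUnitₚ g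
    back g = unit-cong {compose g τ⁻¹} {g} (trans (sym (deg-compose (compose g τ⁻¹))) (deg-cong (compose-inverse′ g)))
      (compose-0 g τ⁻¹)

-- The asymptotic estimate

n<m^n : ∀ {m} → 1 < m → ∀ n → n < m ^ n
n<m^n         1<m zero    = s≤s z≤n
n<m^n {m} 1<m (suc n) = begin-strict
  suc n <⟨ s≤s (n<m^n 1<m n) ⟩
  suc (m ^ n) ≤⟨ +-monoˡ-≤ (m ^ n) (≤-trans (s≤s z≤n) (n<m^n 1<m n)) ⟩
  m ^ n + m ^ n ≡⟨ cong (λ k → m ^ n + k) (ℕP.+-identityʳ (m ^ n)) ⟨
  2 * m ^ n ≤⟨ ℕP.*-monoˡ-≤ (m ^ n) 1<m ⟩
  m ^ suc n ∎
  where open ℕP.≤-Reasoning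

-- The additive error `t` is absorbed in one of two ways: if k t ≤ D, it costs at most one extra D
-- on the right; otherwise D ≤ k t ≤ N ≤ φ, and K ≤ P already suffices.
ratio-bound : ∀ K P k {N t D φ} → K ≤ P → K * D ≤ P * (N + t) → k * t ≤ N → N ≤ φ →
  K * k * D ≤ P * (k * φ + D)
ratio-bound K P k {N} {t} {D} {φ} K≤P KD≤ kt≤N N≤φ = Sum.[ large , small ]′ (≤-total (k * t) D)
  where
  open ℕP.≤-Reasoning
  open ℕSolver.+-*-Solver

  large : k * t ≤ D → K * k * D ≤ P * (k * φ + D)
  large kt≤D = begin
    K * k * D ≡⟨ solve 3 (λ K k D → K :* k :* D := k :* (K :* D)) refl K k D ⟩
    k * (K * D) ≤⟨ *-monoʳ-≤ k KD≤ ⟩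
    k * (P * (N + t)) ≡⟨ solve 4 (λ k P N t → k :* (P :* (N :+ t)) := P :* (k :* N :+ k :* t)) refl k P N t ⟩
    P * (k * N + k * t) ≤⟨ *-monoʳ-≤ P (+-mono-≤ (*-monoʳ-≤ k N≤φ) kt≤D) ⟩
    P * (k * φ + D) ∎

  small : D ≤ k * t → K * k * D ≤ P * (k * φ + D)
  small D≤kt = begin
    K * k * D ≡⟨ ℕP.*-assoc K k D ⟩
    K * (k * D) ≤⟨ *-mono-≤ K≤P (*-monoʳ-≤ k (≤-trans D≤kt (≤-trans kt≤N N≤φ))) ⟩
    P * (k * φ) ≤⟨ *-monoʳ-≤ P (m≤m+n (k * φ) D) ⟩
    P * (k * φ + D) ∎

-- Back to the variable a

module Main (e : ℕ) (pp : Prime (3 + e)) where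
  open SecondPolynomial e pp

  τ : Poly
  τ = oneOver d ·ₚ Xₚ -ₚ const 1ℚ

  private
    u = oneOver d

    u*d≡1 : u ℚ.* ℕ→ℚ d ≡ 1ℚ
    u*d≡1 = trans (ℚP.*-comm u (ℕ→ℚ d)) (trans (cong (ℚ._* u) ℕ→ℚd≡D) (d*oneOver≡1 d))

    τ-linear : DegLE τ 1
    τ-linear = DegLE-+ {u ·ₚ Xₚ} {negₚ (const 1ℚ)} (DegLE-· u {Xₚ} DegLE-X) (DegLE-neg (const 1ℚ) (DegLE-const 1ℚ 1))

    compose-τ : ∀ q → compose τ q ≋ const u *ₚ q -ₚ const 1ℚ
    compose-τ q = ≋-trans (compose-+ (u ·ₚ Xₚ) (negₚ (const 1ℚ)) q)
      (+-cong (≋-trans (compose-· u Xₚ q) (*-congʳ (const u) (compose-X q))) (compose-const ((ℚ.- 1ℚ) ℚ.* 1ℚ) q))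

    compose-A : ∀ q → compose (A d) q ≋ const (ℕ→ℚ d) *ₚ (q +ₚ const 1ℚ)
    compose-A q = ≋-trans (compose-· (ℕ→ℚ d) (Xₚ +ₚ const 1ℚ) q)
      (*-congʳ (const (ℕ→ℚ d)) (≋-trans (compose-+ Xₚ (const 1ℚ) q) (+-cong (compose-X q) (compose-const 1ℚ q))))

    const-u*d : const u *ₚ const (ℕ→ℚ d) ≋ const 1ℚ
    const-u*d = ≋-trans (const-*-const u (ℕ→ℚ d)) (const-cong u*d≡1)

    τ∘A : compose τ (A d) ≋ Xₚ
    τ∘A = begin
      compose τ (A d)
        ≈⟨ compose-τ (A d) ⟩
      const u *ₚ A d -ₚ const 1ℚ
        ≈⟨ +-congˡ (negₚ (const 1ℚ)) (*-congʳ (const u) (const-* (ℕ→ℚ d) (Xₚ +ₚ const 1ℚ))) ⟨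
      const u *ₚ (const (ℕ→ℚ d) *ₚ (Xₚ +ₚ const 1ℚ)) -ₚ const 1ℚ
        ≈⟨ +-congˡ (negₚ (const 1ℚ)) (≋-trans (≋-sym (*-assoc (const u) (const (ℕ→ℚ d)) (Xₚ +ₚ const 1ℚ))) (*-congˡ (Xₚ +ₚ const 1ℚ) const-u*d)) ⟩
      const 1ℚ *ₚ (Xₚ +ₚ const 1ℚ) -ₚ const 1ℚ
        ≈⟨ solve 1 (λ x → con 1ℚ :* (x :+ con 1ℚ) :- con 1ℚ := x) ≋-refl Xₚ ⟩
      Xₚ ∎
      where
      open ≋-Reasoning
      open PolySolver

    A∘τ : compose (A d) τ ≋ Xₚ
    A∘τ = begin
      compose (A d) τ
        ≈⟨ compose-A τ ⟩
      const (ℕ→ℚ d) *ₚ (u ·ₚ Xₚ -ₚ const 1ℚ +ₚ const 1ℚ)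
        ≈⟨ *-congʳ (const (ℕ→ℚ d)) (+-congˡ (const 1ℚ) (+-congˡ (negₚ (const 1ℚ)) (const-* u Xₚ))) ⟨
      const (ℕ→ℚ d) *ₚ (const u *ₚ Xₚ -ₚ const 1ℚ +ₚ const 1ℚ)
        ≈⟨ solve 3 (λ d u x → d :* (u :* x :- con 1ℚ :+ con 1ℚ) := (u :* d) :* x) ≋-refl (const (ℕ→ℚ d)) (const u) Xₚ ⟩
      (const u *ₚ const (ℕ→ℚ d)) *ₚ Xₚ
        ≈⟨ *-congˡ Xₚ const-u*d ⟩
      const 1ℚ *ₚ Xₚ
        ≈⟨ CommutativeRing.*-identityˡ polyRing Xₚ ⟩
      Xₚ ∎
      where
      open ≋-Reasoning
      open PolySolver

  open Substitution τ (A d) τ-linear DegLE-A τ∘A A∘τ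

  factorOf : ∀ n → IrreducibleFactor (Final.Two n) (Final.H n)
  factorOf n = irreducibleFactor Two
      (λ {f} two deg≡0 → ℕ.≢-nonZero⁻¹ (N n) {{N≢0 n}} (n≤0⇒n≡0 (subst (N n ≤_) deg≡0 (N≤deg {f} two))))
      (λ {f} {g} → Two-factor {f} {g}) H H-int H-Two
    where open Final n

  F : ℕ → Poly
  -- A default value: all claims about `F` concern m ≥ 1.
  F zero    = const 1ℚ
  F (suc n) = compose (IrreducibleFactor.factor (factorOf n)) τ

  F-irreducible : ∀ n → IrreducibleQ (F (suc n))
  F-irreducible n = irreducible-compose (IrreducibleFactor.factor (factorOf n)) (IrreducibleFactor.irreducible (factorOf n))

  F∣G : ∀ n → F (suc n) ∣ₚ G d (suc n)
  F∣G n = compose (factor ·ₚ cofactor) τ , at (begin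
      compose φ τ *ₚ compose (factor ·ₚ cofactor) τ ≈⟨ compose-* φ (factor ·ₚ cofactor) τ ⟨
      compose (φ *ₚ (factor ·ₚ cofactor)) τ ≈⟨ compose-cong {φ *ₚ (factor ·ₚ cofactor)} {calG d (suc n)} τ (begin
          φ *ₚ (factor ·ₚ cofactor) ≈⟨ *-comm φ (factor ·ₚ cofactor) ⟩
          (factor ·ₚ cofactor) *ₚ φ ≈⟨ ·-*-assoc factor cofactor φ ⟩
          factor ·ₚ (cofactor *ₚ φ) ≈⟨ ·-cong factor (≋-trans (*-comm cofactor φ) divides-Q) ⟩
          factor ·ₚ Final.H n ≈⟨ scaled ⟨
          calG d (suc n) ∎) ⟩
      G d (suc n) ∎)
    where
    open ≋-Reasoning
    open IrreducibleFactor (factorOf n) renaming (factor to φ)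
    open _∼_ (Final.calG∼H n)

  N≤deg-F : ∀ n → N n ≤ deg (F (suc n))
  N≤deg-F n = subst (N n ≤_) (sym (deg-compose φ)) (Final.N≤deg n {φ} S-factor)
    where open IrreducibleFactor (factorOf n) renaming (factor to φ)

  deg-G : ∀ n → deg (G d (suc n)) ≡ deg (Qₙ n)
  deg-G n = trans (deg-compose (calG d (suc n))) (trans (sym (∼⇒deg≡ (Final.calG∼H n))) (Final.deg-H n))

  G-irreducible : ∀ m → 1 ≤ m → m ≤ d → IrreducibleQ (G d m)
  G-irreducible (suc n) 1≤m m≤d = irreducible-compose (calG d (suc n)) (irreducible-∼ (Final.calG∼H n) (H-irreducible n m≤d))
    where
    H-irreducible : ∀ n → suc n ≤ d → IrreducibleQ (Final.H n)
    H-irreducible 0             le = Final.irreducible-if-degree 0 (trans (Final.deg-H 0) deg-Q₀)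
    H-irreducible 1             le = H₁-irreducible
    H-irreducible (suc (suc j)) le = Final.irreducible-if-degree (2 + j) (trans (Final.deg-H (2 + j)) (deg-Q j le))

  -- Division by dᵈ (k + 1) deg G turns this into deg F / deg G ≥ 1 - 1/dᵈ - 1/(k + 1), so the
  -- inequalities for all k express the bound on the lower limit. The hypothesis on n gives (k +
  -- 1)(d + 1) ≤ N, because n < dⁿ ≤ N.
  liminf-bound : ∀ k n → suc k * suc d ≤ n →
    K * suc k * deg (G d (suc n)) ≤ d ^ d * (suc k * deg (F (suc n)) + deg (G d (suc n)))
  liminf-bound k n le = ratio-bound K (d ^ d) (suc k) (ℕP.m∸n≤m (d ^ d) 1)
    (subst (λ D → K * D ≤ d ^ d * (N n + suc d)) (sym (deg-G n)) (K*deg-Q n))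
    (≤-trans le (≤-trans (<⇒≤ (n<m^n (s≤s (s≤s z≤n)) n)) (L≤N n)))
    (N≤deg-F n)

  theorem :
    (Σ (ℕ → Poly) λ F →
      (∀ m → 1 ≤ m → IrreducibleQ (F m) × F m ∣ₚ G d m)
      × (∀ k → Σ ℕ λ M → ∀ m → M ≤ m →
          (d ^ d ∸ 1) * suc k * deg (G d m)
            ≤ d ^ d * (suc k * deg (F m) + deg (G d m))))
    × (∀ m → 1 ≤ m → m ≤ d → IrreducibleQ (G d m))
  theorem = (F , (λ { (suc n) _ → F-irreducible n , F∣G n })
               -- The threshold is one larger than in `liminf-bound`, as m = n + 1.
               , λ k → suc (suc k * suc d) , λ { (suc n) (s≤s le) → liminf-bound k n le })
          , G-irreducible

mainTheorem1 : (d : ℕ) → Prime d → 3 ≤ d →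
    (Σ (ℕ → Poly) λ F →
    (∀ m → 1 ≤ m → IrreducibleQ (F m) × F m ∣ₚ G d m)
    × (∀ k → Σ ℕ λ M → ∀ m → M ≤ m →
    (d ^ d ∸ 1) * suc k * deg (G d m)
    ≤ d ^ d * (suc k * deg (F m) + deg (G d m))))
    × (∀ m → 1 ≤ m → m ≤ d → IrreducibleQ (G d m))
mainTheorem1 (suc (suc (suc e))) pp _ = Main.theorem e pp
mainTheorem1 zero                _  ()
mainTheorem1 (suc zero)          _  (s≤s ())
mainTheorem1 (suc (suc zero))    _  (s≤s (s≤s ()))
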